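{- Suppose $k\geq t+2\geq 4$ and $n\geq t+\max\{15(t+2)^2(k-t),\,10k^2\}$. Let $\mathcal{F},\mathcal{G}\subseteq\binom{[n]}{k}$ be cross $t$-intersecting families with $|\cap\mathcal{F}|<t$ and $|\cap\mathcal{G}|<t$. The following hold. (i) If $k\geq 2t+2$, then $|\mathcal{F}||\mathcal{G}|\leq|\mathcal{H}(n,k,t)|^2$, with equality if and only if $\mathcal{F}=\mathcal{H}(X,K,L)$ and $\mathcal{G}=\mathcal{H}(X,L,K)$ for some $X\in\binom{[n]}{t}$ and $K,L\in\binom{[n]}{k+1}$ with $X\subseteq K\cap L$ and $|K\cap L|\geq t+2$. (ii) If $k\leq 2t+1$, then $|\mathcal{F}||\mathcal{G}|\leq|\mathcal{A}(n,k,t)|^2$, with equality if and only if $\mathcal{F}=\mathcal{G}=\mathcal{A}(Z)$ for some $Z\in\binom{[n]}{t+2}$.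
   Context: $n,k,t$ are positive integers, $[n]=\{1,\dots,n\}$, $[i,j]=\{i,i+1,\dots,j\}$, and $\binom{[n]}{k}$ is the family of all $k$-subsets of $[n]$. For a family $\mathcal{F}$ of sets, $\cap\mathcal{F}$ denotes the intersection of all its members. Families $\mathcal{F},\mathcal{G}$ are cross $t$-intersecting if $|F\cap G|\ge t$ for all $F\in\mathcal{F}$, $G\in\mathcal{G}$. For $Z\in\binom{[n]}{t+2}$, $\mathcal{A}(Z)=\{F\in\binom{[n]}{k}:|F\cap Z|\geq t+1\}$, and $\mathcal{A}(n,k,t)=\mathcal{A}([t+2])$. For $X\in\binom{[n]}{t}$ and $K,L\in\binom{[n]}{k+1}$ with $X\subseteq K\cap L$, $$\mathcal{H}(X,K,L)=\left\{F\in\binom{[n]}{k}:X\subseteq F,\ F\cap(L\setminus X)\neq\emptyset\right\}\cup\{K\setminus\{x\}:x\in X\},$$ and $\mathcal{H}(n,k,t)=\mathcal{H}([t],[k+1],[k+1])=\{F\in\binom{[n]}{k}:[t]\subseteq F,\ F\cap[t+1,k+1]\neq\emptyset\}\cup\{[k+1]\setminus\{i\}:i\in[t]\}$. -}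

module Defs where

open import Data.Fin.Base using (toℕ)
open import Data.Fin.Properties using (any?)
open import Data.Fin.Subset using (Subset; inside; outside; _∈_; _⊆_; _∩_; _─_; _-_; ⋂; Nonempty; ∣_∣)
open import Data.Fin.Subset.Properties using (_∈?_; _⊆?_; nonempty?)
open import Data.List.Base using (List; []; _∷_; filter; length; cartesianProductWith)
open import Data.List.Membership.Propositional renaming (_∈_ to _∈ˡ_) using ()
open import Data.List.Membership.Propositional.Properties using (∈-cartesianProductWith⁺)
open import Data.List.Relation.Unary.All using ([]; _∷_)
open import Data.List.Relation.Unary.AllPairs using ([]; _∷_)
open import Data.List.Relation.Unary.Any using (here; there)
open import Data.List.Relation.Unary.Unique.Propositional using (Unique)
open import Data.List.Relation.Unary.Unique.Propositional.Properties using (cartesianProductWith⁺)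
open import Data.Nat.Base using (ℕ; zero; suc; _≤_; _+_)
open import Data.Nat.Properties using (_≟_; _≤?_; _<?_)
open import Data.Product.Base using (_×_; ∃-syntax)
open import Data.Sum.Base using (_⊎_)
open import Data.Vec.Base as Vec using (tabulate)
open import Data.Vec.Properties using (≡-dec; ∷-injective)
import Data.Bool.Properties as Bool
open import Level using (0ℓ)
open import Relation.Binary.PropositionalEquality using (_≡_; refl)
open import Relation.Nullary.Decidable using (does; _×-dec_; _⊎-dec_)
open import Relation.Unary using (Pred; Decidable; _≐_)

-- The ground set [n] is Fin n, the element i of [n] being the one with toℕ = i − 1.

-- Decidability of membership costs no generality: it only makes the
-- (finite) family enumerable constructively.
record Family (n : ℕ) : Set₁ where
  field
    Mem  : Pred (Subset n) 0ℓ
    mem? : Decidable Mem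

open Family public

infix 4 _∈ᶠ_ _≈ᶠ_

_∈ᶠ_ : ∀ {n} → Subset n → Family n → Set
F ∈ᶠ 𝓕 = Mem 𝓕 F

_≈ᶠ_ : ∀ {n} → Family n → Family n → Set
𝓕 ≈ᶠ 𝓖 = Mem 𝓕 ≐ Mem 𝓖

allSubsets : ∀ n → List (Subset n)
allSubsets zero    = Vec.[] ∷ []
allSubsets (suc n) = cartesianProductWith Vec._∷_ (inside ∷ outside ∷ []) (allSubsets n)

∈-allSubsets : ∀ {n} (F : Subset n) → F ∈ˡ allSubsets n
∈-allSubsets Vec.[]              = here refl
∈-allSubsets (inside  Vec.∷ F) = ∈-cartesianProductWith⁺ Vec._∷_ {xs = inside ∷ outside ∷ []} (here refl) (∈-allSubsets F)
∈-allSubsets (outside Vec.∷ F) = ∈-cartesianProductWith⁺ Vec._∷_ {xs = inside ∷ outside ∷ []} (there (here refl)) (∈-allSubsets F)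

allSubsets-unique : ∀ n → Unique (allSubsets n)
allSubsets-unique zero    = [] ∷ []
allSubsets-unique (suc n) =
  cartesianProductWith⁺ Vec._∷_ ∷-injective
    (((λ ()) ∷ []) ∷ [] ∷ []) (allSubsets-unique n)

members : ∀ {n} → Family n → List (Subset n)
members {n} 𝓕 = filter (mem? 𝓕) (allSubsets n)

size : ∀ {n} → Family n → ℕ
size 𝓕 = length (members 𝓕)

-- The empty family has intersection [n], as for the library's ⋂.
⋂ᶠ : ∀ {n} → Family n → Subset n
⋂ᶠ 𝓕 = ⋂ (members 𝓕)

Uniform : ∀ {n} → ℕ → Family n → Set
Uniform k 𝓕 = ∀ F → F ∈ᶠ 𝓕 → ∣ F ∣ ≡ k

CrossIntersecting : ∀ {n} → ℕ → Family n → Family n → Set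
CrossIntersecting t 𝓕 𝓖 = ∀ F G → F ∈ᶠ 𝓕 → G ∈ᶠ 𝓖 → t ≤ ∣ F ∩ G ∣

-- {1, …, j} as a subset of [n]; it has j elements only when j ≤ n.
[1⋯_] : ∀ {n} → ℕ → Subset n
[1⋯ j ] = tabulate (λ i → does (toℕ i <? j))

𝓐 : ∀ {n} → ℕ → ℕ → Subset n → Family n
𝓐 k t Z = record
  { Mem  = λ F → ∣ F ∣ ≡ k × t + 1 ≤ ∣ F ∩ Z ∣
  ; mem? = λ F → (∣ F ∣ ≟ k) ×-dec (t + 1 ≤? ∣ F ∩ Z ∣)
  }

𝓐₀ : (n k t : ℕ) → Family n
𝓐₀ n k t = 𝓐 k t [1⋯ t + 2 ]

𝓗 : ∀ {n} → ℕ → (X K L : Subset n) → Family n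
𝓗 k X K L = record
  { Mem  = λ F → (∣ F ∣ ≡ k × X ⊆ F × Nonempty (F ∩ (L ─ X)))
               ⊎ (∃[ x ] (x ∈ X × F ≡ K - x))
  ; mem? = λ F → ((∣ F ∣ ≟ k) ×-dec (X ⊆? F) ×-dec nonempty? (F ∩ (L ─ X)))
          ⊎-dec any? (λ x → (x ∈? X) ×-dec ≡-dec Bool._≟_ F (K - x))
  }

𝓗₀ : (n k t : ℕ) → Family n
𝓗₀ n k t = 𝓗 k [1⋯ t ] [1⋯ k + 1 ] [1⋯ k + 1 ]

{-# OPTIONS --safe #-}
module Submission where

-- Let 𝒮 consist of the minimal t-covers of 𝓖 of size at most k, and 𝒯 of those of 𝒮. Each
-- member of 𝓕 contains a member of 𝒮 and each member of 𝓖 one of 𝒯, the families 𝒮 and 𝒯 are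
-- cross t-intersecting, and by non-triviality their members have more than t elements. Branching
-- along covers bounds |𝒮ₚ||𝒯_q| for the levels of sizes t + p and t + q, and n is so large that
-- |𝓕||𝓖| is governed by the first levels 𝒮₁ and 𝒯₁. Either |𝒮₁||𝒯₁| ≤ (t + 1) max(k − t + 1, t + 2),
-- too few for the extremal value; or all members of 𝒮₁ and 𝒯₁ lie in one (t + 2)-set Z, whence
-- 𝓕, 𝓖 ⊆ 𝓐(Z); or they all contain one t-set X. In the last case let A and B be the sets of
-- points extending X into 𝒮₁ and 𝒯₁. These have at most k − t + 1 elements; if both have that many,
-- then 𝓕 ⊆ 𝓗(X, X ∪ B, X ∪ A) and 𝓖 ⊆ 𝓗(X, X ∪ A, X ∪ B), and otherwise the product drops
-- below |𝓗(n,k,t)|².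

open import Defs
import Data.Bool.Properties as Bool
open import Data.Empty using (⊥)
open import Data.Fin.Base using (Fin; zero; suc; toℕ)
import Data.Fin.Properties as Finₚ
open import Data.Fin.Subset using (Subset; inside; outside; _∈_; _∉_; _⊆_; _∩_; _∪_; _─_; _-_; ∁; ⁅_⁆; ⊤; ⋂; Nonempty; Empty; ∣_∣) renaming (⊥ to ∅)
open import Data.Fin.Subset.Properties
open import Data.List.Base using (List; []; _∷_; _++_; filter; length; map)
open import Data.List.Membership.Propositional renaming (_∈_ to _∈ˡ_) using (lose)
open import Data.List.Membership.Propositional.Properties using (∈-map⁺; ∈-filter⁺; ∈-filter⁻; ∈-++⁺ˡ; ∈-++⁺ʳ)
open import Data.List.Properties using (length-++; filter-++; length-map; ++-identityʳ)
open import Data.List.Relation.Unary.All using ([]; _∷_)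
open import Data.List.Relation.Unary.AllPairs using ([]; _∷_)
open import Data.List.Relation.Unary.Any as Any using (Any; here; there; any?)
open import Data.List.Relation.Unary.Unique.Propositional using (Unique)
import Data.List.Relation.Unary.Unique.Propositional.Properties as Uniqueₚ
open import Data.Nat.Base using (ℕ; zero; suc; _+_; _*_; _∸_; _^_; _⊔_; _≤_; _<_; _≥_; z≤n; s≤s; s≤s⁻¹; NonZero; >-nonZero)
open import Data.Nat.Combinatorics using (_C_; nCn≡1; nC1≡n; nCk+nC[k+1]≡[n+1]C[k+1]; k>n⇒nCk≡0; nCk≡nC[n∸k])
open import Data.Nat.Induction using (<-wellFounded)
open import Data.Nat.ListAction using (sum)
open import Data.Nat.Properties
open import Data.Nat.Tactic.RingSolver using (solve-∀)
open import Data.Product.Base using (_×_; _,_; proj₁; proj₂; ∃-syntax)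
open import Data.Sum.Base using (_⊎_; inj₁; inj₂; [_,_]′)
open import Data.Vec.Base as Vec using (tabulate; here; there)
open import Data.Vec.Properties using (≡-dec; ∷-injective; ∷-injectiveʳ; lookup∘tabulate; lookup⇒[]=; []=⇒lookup)
open import Function.Base using (_∘_; id; case_of_)
open import Function.Bundles using (_⇔_; mk⇔)
open import Induction.WellFounded using (Acc; acc)
open import Level using (0ℓ)
open import Relation.Binary.PropositionalEquality
open import Relation.Nullary using (¬_; Dec; yes; no; does; contradiction)
open import Relation.Nullary.Decidable using (_×-dec_; _⊎-dec_; _→-dec_; ¬?; decidable-stable; dec-true; dec-false)
open import Relation.Unary using (Pred; Decidable)

-- Neither |𝓕| nor |𝓖| can be bounded alone: if 𝓖 consists of two sets meeting in t - 1 points, 𝓕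
-- can exceed the extremal size. So all estimates concern products. The bound for level t + p of `𝒮`
-- has a binomial factor that grows with the covering number of that level and a power that shrinks
-- when level t + q of `𝒯` is hard to cover. Multiplied with its mirror image, it regroups into two
-- brackets, one for each covering number. The double sum over p and q is then compared with a
-- geometric series whose first term carries |𝒮₁||𝒯₁|. Two comparisons are needed. With m = k - t +
-- 1 and M = max(m, t + 2), the ratio 6M/(15(t + 2)²) serves while m is comparable to t, but it
-- exceeds 1 when k is much larger. Once m ≥ 3(t + 1), the binomial factors are charged to n - t
-- itself, and the ratio becomes 3/16, free of all parameters. With D the number of k-sets through a
-- (t + 1)-set, the two extremal sizes are about mD and (t + 2)D, so k ≥ 2t + 2, which says m > t +
-- 2, is where 𝓗 overtakes 𝓐.

private variable
  n : ℕ

-- Cardinalities and enumeration of finite subsets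

∣p∩q∣+∣p─q∣≡∣p∣ : (p q : Subset n) → ∣ p ∩ q ∣ + ∣ p ─ q ∣ ≡ ∣ p ∣
∣p∩q∣+∣p─q∣≡∣p∣ Vec.[] Vec.[] = refl
∣p∩q∣+∣p─q∣≡∣p∣ (inside  Vec.∷ p) (inside  Vec.∷ q) = cong suc (∣p∩q∣+∣p─q∣≡∣p∣ p q)
∣p∩q∣+∣p─q∣≡∣p∣ (inside  Vec.∷ p) (outside Vec.∷ q) =
  trans (+-suc ∣ p ∩ q ∣ ∣ p ─ q ∣) (cong suc (∣p∩q∣+∣p─q∣≡∣p∣ p q))
∣p∩q∣+∣p─q∣≡∣p∣ (outside Vec.∷ p) (inside  Vec.∷ q) = ∣p∩q∣+∣p─q∣≡∣p∣ p q
∣p∩q∣+∣p─q∣≡∣p∣ (outside Vec.∷ p) (outside Vec.∷ q) = ∣p∩q∣+∣p─q∣≡∣p∣ p q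

∣p∪q∣+∣p∩q∣≡∣p∣+∣q∣ : (p q : Subset n) → ∣ p ∪ q ∣ + ∣ p ∩ q ∣ ≡ ∣ p ∣ + ∣ q ∣
∣p∪q∣+∣p∩q∣≡∣p∣+∣q∣ Vec.[] Vec.[] = refl
∣p∪q∣+∣p∩q∣≡∣p∣+∣q∣ (inside  Vec.∷ p) (inside  Vec.∷ q) =
  cong suc (trans (+-suc _ _) (trans (cong suc (∣p∪q∣+∣p∩q∣≡∣p∣+∣q∣ p q)) (sym (+-suc _ _))))
∣p∪q∣+∣p∩q∣≡∣p∣+∣q∣ (inside  Vec.∷ p) (outside Vec.∷ q) = cong suc (∣p∪q∣+∣p∩q∣≡∣p∣+∣q∣ p q)
∣p∪q∣+∣p∩q∣≡∣p∣+∣q∣ (outside Vec.∷ p) (inside  Vec.∷ q) =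
  trans (cong suc (∣p∪q∣+∣p∩q∣≡∣p∣+∣q∣ p q)) (sym (+-suc _ _))
∣p∪q∣+∣p∩q∣≡∣p∣+∣q∣ (outside Vec.∷ p) (outside Vec.∷ q) = ∣p∪q∣+∣p∩q∣≡∣p∣+∣q∣ p q

∈─⁻ : (p q : Subset n) {x : Fin n} → x ∈ p ─ q → x ∈ p × x ∉ q
∈─⁻ (inside Vec.∷ p) (outside Vec.∷ q) here = here , λ ()
∈─⁻ (outside Vec.∷ p) (inside  Vec.∷ q) {zero} ()
∈─⁻ (outside Vec.∷ p) (outside Vec.∷ q) {zero} ()
∈─⁻ (_ Vec.∷ p) (_ Vec.∷ q) (there x∈) with ∈─⁻ p q x∈
... | x∈p , x∉q = there x∈p , λ { (there x∈q) → x∉q x∈q }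

disjoint⇒∣∩∣≡0 : (p q : Subset n) → (∀ {x} → x ∈ p → x ∉ q) → ∣ p ∩ q ∣ ≡ 0
disjoint⇒∣∩∣≡0 {n} p q dis =
  trans (cong ∣_∣ (Empty-unique λ { (x , x∈) → let (a , b) = x∈p∩q⁻ p q x∈ in dis a b })) (∣⊥∣≡0 n)

disjoint⇒∣∪∣≡ : (p q : Subset n) → (∀ {x} → x ∈ p → x ∉ q) → ∣ p ∪ q ∣ ≡ ∣ p ∣ + ∣ q ∣
disjoint⇒∣∪∣≡ p q dis = begin
  ∣ p ∪ q ∣               ≡⟨ sym (+-identityʳ _) ⟩
  ∣ p ∪ q ∣ + 0           ≡⟨ cong (∣ p ∪ q ∣ +_) (sym (disjoint⇒∣∩∣≡0 p q dis)) ⟩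
  ∣ p ∪ q ∣ + ∣ p ∩ q ∣   ≡⟨ ∣p∪q∣+∣p∩q∣≡∣p∣+∣q∣ p q ⟩
  ∣ p ∣ + ∣ q ∣           ∎
  where open ≡-Reasoning

x∉p⇒∣p∪⁅x⁆∣≡ : (p : Subset n) {x : Fin n} → x ∉ p → ∣ p ∪ ⁅ x ⁆ ∣ ≡ suc ∣ p ∣
x∉p⇒∣p∪⁅x⁆∣≡ p {x} x∉p = trans
  (disjoint⇒∣∪∣≡ p ⁅ x ⁆ λ y∈p y∈x → x∉p (subst (_∈ p) (x∈⁅y⁆⇒x≡y x y∈x) y∈p))
  (trans (cong (∣ p ∣ +_) (∣⁅x⁆∣≡1 x)) (+-comm ∣ p ∣ 1))

∪-least : {p q r : Subset n} → p ⊆ r → q ⊆ r → p ∪ q ⊆ r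
∪-least {p = p} {q} p⊆ q⊆ x∈ with x∈p∪q⁻ p q x∈
... | inj₁ a = p⊆ a
... | inj₂ b = q⊆ b

⁅x⁆⊆ : {x : Fin n} {r : Subset n} → x ∈ r → ⁅ x ⁆ ⊆ r
⁅x⁆⊆ {x = x} {r} x∈r y∈ = subst (_∈ r) (sym (x∈⁅y⁆⇒x≡y x y∈)) x∈r

∩-greatest : {p q r : Subset n} → r ⊆ p → r ⊆ q → r ⊆ p ∩ q
∩-greatest r⊆p r⊆q x∈ = x∈p∩q⁺ (r⊆p x∈ , r⊆q x∈)

x∈p⇒suc∣p-x∣≡∣p∣ : (p : Subset n) {x : Fin n} → x ∈ p → suc ∣ p - x ∣ ≡ ∣ p ∣
x∈p⇒suc∣p-x∣≡∣p∣ p {x} x∈p = begin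
  1 + ∣ p - x ∣                ≡⟨ cong (_+ ∣ p - x ∣) (sym (∣⁅x⁆∣≡1 x)) ⟩
  ∣ ⁅ x ⁆ ∣ + ∣ p - x ∣        ≡⟨ cong (λ z → ∣ z ∣ + ∣ p - x ∣) (⊆-antisym (∩-greatest (⁅x⁆⊆ x∈p) id) (p∩q⊆q p ⁅ x ⁆)) ⟩
  ∣ p ∩ ⁅ x ⁆ ∣ + ∣ p - x ∣    ≡⟨ ∣p∩q∣+∣p─q∣≡∣p∣ p ⁅ x ⁆ ⟩
  ∣ p ∣                        ∎
  where open ≡-Reasoning

∈-⁻ : (p : Subset n) {x y : Fin n} → y ∈ p - x → y ∈ p × y ≢ x
∈-⁻ p {x} y∈ with ∈─⁻ p ⁅ x ⁆ y∈
... | a , b = a , λ { refl → b (x∈⁅x⁆ x) }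

⊈⇒∃ : (p q : Subset n) → ¬ (p ⊆ q) → ∃[ x ] (x ∈ p × x ∉ q)
⊈⇒∃ p q p⊈q with nonempty? (p ─ q)
... | yes (x , x∈) = x , ∈─⁻ p q x∈
... | no ∄ = contradiction (λ {x} x∈p → decidable-stable (x ∈? q) λ x∉q → ∄ (x , x∈p∧x∉q⇒x∈p─q x∈p x∉q)) p⊈q

∣p∣<∣q∣⇒∃ : (p q : Subset n) → ∣ p ∣ < ∣ q ∣ → ∃[ x ] (x ∈ q × x ∉ p)
∣p∣<∣q∣⇒∃ p q lt = ⊈⇒∃ q p λ q⊆p → <⇒≱ lt (p⊆q⇒∣p∣≤∣q∣ q⊆p)

⊆∧∣∣≤⇒≡ : {p q : Subset n} → p ⊆ q → ∣ q ∣ ≤ ∣ p ∣ → p ≡ q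
⊆∧∣∣≤⇒≡ {p = p} {q} p⊆q le with q ⊆? p
... | yes q⊆p = ⊆-antisym p⊆q q⊆p
... | no q⊈p = contradiction le (<⇒≱ (p⊂q⇒∣p∣<∣q∣ (p⊆q , ⊈⇒∃ q p q⊈p)))

subsetOfSize : (p : Subset n) {j : ℕ} → j ≤ ∣ p ∣ → ∃[ q ] (q ⊆ p × ∣ q ∣ ≡ j)
subsetOfSize {n} p {zero} _ = ∅ , ⊆-min p , ∣⊥∣≡0 n
subsetOfSize (inside Vec.∷ p) {suc j} (s≤s le) with subsetOfSize p le
... | q , q⊆p , eq = inside Vec.∷ q , in⊆in q⊆p , cong suc eq
subsetOfSize (outside Vec.∷ p) {suc j} le with subsetOfSize p le
... | q , q⊆p , eq = outside Vec.∷ q , out⊆ q⊆p , eq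

module _ {n : ℕ} {P : Pred (Fin n) 0ℓ} (P? : Decidable P) where

  comprehension : Subset n
  comprehension = tabulate (λ x → does (P? x))

  ∈-comprehension⁺ : ∀ {x} → P x → x ∈ comprehension
  ∈-comprehension⁺ {x} px = lookup⇒[]= x _ (trans (lookup∘tabulate _ x) (dec-true (P? x) px))

  ∈-comprehension⁻ : ∀ {x} → x ∈ comprehension → P x
  ∈-comprehension⁻ {x} x∈ with P? x
  ... | yes px = px
  ... | no ¬px = case trans (sym (dec-false (P? x) ¬px)) (trans (sym (lookup∘tabulate _ x)) ([]=⇒lookup x∈)) of λ ()

elements : Subset n → List (Fin n)
elements Vec.[] = []
elements (inside  Vec.∷ p) = zero ∷ map suc (elements p)
elements (outside Vec.∷ p) = map suc (elements p)

length-elements : (p : Subset n) → length (elements p) ≡ ∣ p ∣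
length-elements Vec.[] = refl
length-elements (inside  Vec.∷ p) = cong suc (trans (length-map suc (elements p)) (length-elements p))
length-elements (outside Vec.∷ p) = trans (length-map suc (elements p)) (length-elements p)

∈-elements : {p : Subset n} {x : Fin n} → x ∈ p → x ∈ˡ elements p
∈-elements {p = inside Vec.∷ p} here = here refl
∈-elements {p = inside Vec.∷ p} (there x∈) = there (∈-map⁺ suc (∈-elements x∈))
∈-elements {p = outside Vec.∷ p} (there x∈) = ∈-map⁺ suc (∈-elements x∈)

subsetsOfSize : Subset n → ℕ → List (Subset n)
subsetsOfSize {n} p zero = ∅ ∷ []
subsetsOfSize Vec.[] (suc j) = []
subsetsOfSize (inside Vec.∷ p) (suc j) =
  map (inside Vec.∷_) (subsetsOfSize p j) ++ map (outside Vec.∷_) (subsetsOfSize p (suc j))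
subsetsOfSize (outside Vec.∷ p) (suc j) = map (outside Vec.∷_) (subsetsOfSize p (suc j))

length-subsetsOfSize : (p : Subset n) (j : ℕ) → length (subsetsOfSize p j) ≡ ∣ p ∣ C j
length-subsetsOfSize p zero = refl
length-subsetsOfSize Vec.[] (suc j) = refl
length-subsetsOfSize (inside Vec.∷ p) (suc j) = begin
  length (map (inside Vec.∷_) (subsetsOfSize p j) ++ map (outside Vec.∷_) (subsetsOfSize p (suc j)))
    ≡⟨ length-++ (map (inside Vec.∷_) (subsetsOfSize p j)) ⟩
  length (map (inside Vec.∷_) (subsetsOfSize p j)) + length (map (outside Vec.∷_) (subsetsOfSize p (suc j)))
    ≡⟨ cong₂ _+_ (trans (length-map _ (subsetsOfSize p j)) (length-subsetsOfSize p j))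
                 (trans (length-map _ (subsetsOfSize p (suc j))) (length-subsetsOfSize p (suc j))) ⟩
  ∣ p ∣ C j + ∣ p ∣ C suc j
    ≡⟨ nCk+nC[k+1]≡[n+1]C[k+1] ∣ p ∣ j ⟩
  suc ∣ p ∣ C suc j ∎
  where open ≡-Reasoning
length-subsetsOfSize (outside Vec.∷ p) (suc j) =
  trans (length-map _ (subsetsOfSize p (suc j))) (length-subsetsOfSize p (suc j))

∈-subsetsOfSize : {p q : Subset n} {j : ℕ} → q ⊆ p → ∣ q ∣ ≡ j → q ∈ˡ subsetsOfSize p j
∈-subsetsOfSize {p = p} {q} {zero} q⊆p eq = here (Empty-unique λ { (x , x∈q) →
  <⇒≢ (subst (_≤ ∣ q ∣) (∣⁅x⁆∣≡1 x) (p⊆q⇒∣p∣≤∣q∣ (⁅x⁆⊆ x∈q))) (sym eq) })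
∈-subsetsOfSize {p = Vec.[]} {Vec.[]} {suc j} q⊆p ()
∈-subsetsOfSize {p = inside Vec.∷ p} {inside Vec.∷ q} {suc j} q⊆p eq =
  ∈-++⁺ˡ (∈-map⁺ (inside Vec.∷_) (∈-subsetsOfSize (drop-∷-⊆ q⊆p) (suc-injective eq)))
∈-subsetsOfSize {p = inside Vec.∷ p} {outside Vec.∷ q} {suc j} q⊆p eq =
  ∈-++⁺ʳ (map (inside Vec.∷_) (subsetsOfSize p j)) (∈-map⁺ (outside Vec.∷_) (∈-subsetsOfSize (drop-∷-⊆ q⊆p) eq))
∈-subsetsOfSize {p = outside Vec.∷ p} {inside Vec.∷ q} {suc j} q⊆p eq with q⊆p here
... | ()
∈-subsetsOfSize {p = outside Vec.∷ p} {outside Vec.∷ q} {suc j} q⊆p eq =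
  ∈-map⁺ (outside Vec.∷_) (∈-subsetsOfSize (drop-∷-⊆ q⊆p) eq)

-- Counting subsets with a decidable property

# : {P : Pred (Subset n) 0ℓ} → Decidable P → ℕ
# P? = length (filter P? (allSubsets _))

module _ {A : Set} where

  length-filter-mono : {P Q : Pred A 0ℓ} (P? : Decidable P) (Q? : Decidable Q) →
    (∀ x → P x → Q x) → ∀ xs → length (filter P? xs) ≤ length (filter Q? xs)
  length-filter-mono P? Q? imp [] = z≤n
  length-filter-mono P? Q? imp (x ∷ xs) with P? x | Q? x
  ... | yes _  | yes _ = s≤s (length-filter-mono P? Q? imp xs)
  ... | yes px | no ¬q = contradiction (imp x px) ¬q
  ... | no _   | yes _ = m≤n⇒m≤1+n (length-filter-mono P? Q? imp xs)
  ... | no _   | no _  = length-filter-mono P? Q? imp xs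

  length-filter-⊎ : {P Q R : Pred A 0ℓ} (P? : Decidable P) (Q? : Decidable Q) (R? : Decidable R) →
    (∀ x → P x → Q x ⊎ R x) → ∀ xs → length (filter P? xs) ≤ length (filter Q? xs) + length (filter R? xs)
  length-filter-⊎ P? Q? R? imp [] = z≤n
  length-filter-⊎ P? Q? R? imp (x ∷ xs) with P? x | Q? x | R? x | length-filter-⊎ P? Q? R? imp xs
  ... | no _   | yes _ | yes _ | ih = m≤n⇒m≤1+n (≤-trans ih (+-monoʳ-≤ _ (n≤1+n _)))
  ... | no _   | yes _ | no _  | ih = m≤n⇒m≤1+n ih
  ... | no _   | no _  | yes _ | ih = ≤-trans ih (+-monoʳ-≤ _ (n≤1+n _))
  ... | no _   | no _  | no _  | ih = ih
  ... | yes _  | yes _ | yes _ | ih = s≤s (≤-trans ih (+-monoʳ-≤ _ (n≤1+n _)))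
  ... | yes _  | yes _ | no _  | ih = s≤s ih
  ... | yes _  | no _  | yes _ | ih = ≤-trans (s≤s ih) (≤-reflexive (sym (+-suc _ _)))
  ... | yes px | no ¬q | no ¬r | ih with imp x px
  ...   | inj₁ q = contradiction q ¬q
  ...   | inj₂ r = contradiction r ¬r

  length-filter-⊎-disjoint : {P Q R : Pred A 0ℓ} (P? : Decidable P) (Q? : Decidable Q) (R? : Decidable R) →
    (∀ x → Q x → P x) → (∀ x → R x → P x) → (∀ x → Q x → ¬ R x) →
    ∀ xs → length (filter Q? xs) + length (filter R? xs) ≤ length (filter P? xs)
  length-filter-⊎-disjoint P? Q? R? q⇒p r⇒p dis [] = z≤n
  length-filter-⊎-disjoint P? Q? R? q⇒p r⇒p dis (x ∷ xs)
    with P? x | Q? x | R? x | length-filter-⊎-disjoint P? Q? R? q⇒p r⇒p dis xs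
  ... | _      | yes q | yes r | ih = contradiction r (dis x q)
  ... | yes _  | yes _ | no _  | ih = s≤s ih
  ... | yes _  | no _  | yes _ | ih = ≤-trans (≤-reflexive (+-suc _ _)) (s≤s ih)
  ... | yes _  | no _  | no _  | ih = m≤n⇒m≤1+n ih
  ... | no ¬p  | yes q | no _  | ih = contradiction (q⇒p x q) ¬p
  ... | no ¬p  | no _  | yes r | ih = contradiction (r⇒p x r) ¬p
  ... | no _   | no _  | no _  | ih = ih

  -- An element in `Q` but not in `P` would make the count for `Q` the larger one, since the rest of
  -- the list still compares by containment. This is what turns a containment of families of equal
  -- size into an equality.
  length-filter-saturated : {P Q : Pred A 0ℓ} (P? : Decidable P) (Q? : Decidable Q) →
    (∀ x → P x → Q x) → ∀ xs → length (filter Q? xs) ≤ length (filter P? xs) → ∀ {x} → x ∈ˡ xs → Q x → P x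
  length-filter-saturated P? Q? imp (y ∷ ys) le x∈ qx with P? y | Q? y
  length-filter-saturated P? Q? imp (y ∷ ys) le (here refl) qx | yes py | _ = py
  length-filter-saturated P? Q? imp (y ∷ ys) le (here refl) qx | no _ | no ¬q = contradiction qx ¬q
  length-filter-saturated P? Q? imp (y ∷ ys) le x∈ qx | no _ | yes _ =
    contradiction (length-filter-mono P? Q? imp ys) (<⇒≱ le)
  length-filter-saturated P? Q? imp (y ∷ ys) le (there x∈) qx | yes py | yes _ =
    length-filter-saturated P? Q? imp ys (s≤s⁻¹ le) x∈ qx
  length-filter-saturated P? Q? imp (y ∷ ys) le (there x∈) qx | yes py | no ¬q = contradiction (imp y py) ¬q
  length-filter-saturated P? Q? imp (y ∷ ys) le (there x∈) qx | no _ | no _ =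
    length-filter-saturated P? Q? imp ys le x∈ qx

  length-filter-none : {P : Pred A 0ℓ} (P? : Decidable P) → (∀ x → ¬ P x) → ∀ xs → length (filter P? xs) ≡ 0
  length-filter-none P? none [] = refl
  length-filter-none P? none (x ∷ xs) with P? x
  ... | yes px = contradiction px (none x)
  ... | no _   = length-filter-none P? none xs

  length-filter-map : {B : Set} {P : Pred A 0ℓ} (P? : Decidable P) (f : B → A) →
    ∀ xs → length (filter P? (map f xs)) ≡ length (filter (P? ∘ f) xs)
  length-filter-map P? f [] = refl
  length-filter-map P? f (x ∷ xs) with P? (f x)
  ... | yes _ = cong suc (length-filter-map P? f xs)
  ... | no _  = length-filter-map P? f xs

module _ {P Q : Pred (Subset n) 0ℓ} (P? : Decidable P) (Q? : Decidable Q) where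

  #-mono : (∀ F → P F → Q F) → # P? ≤ # Q?
  #-mono imp = length-filter-mono P? Q? imp (allSubsets _)

  #-saturated : (∀ F → P F → Q F) → # Q? ≤ # P? → ∀ F → Q F → P F
  #-saturated imp le F = length-filter-saturated P? Q? imp (allSubsets _) le (∈-allSubsets F)

#-cong : {P Q : Pred (Subset n) 0ℓ} (P? : Decidable P) (Q? : Decidable Q) →
  (∀ F → P F → Q F) → (∀ F → Q F → P F) → # P? ≡ # Q?
#-cong P? Q? f g = ≤-antisym (#-mono P? Q? f) (#-mono Q? P? g)

#-⊎ : {P Q R : Pred (Subset n) 0ℓ} (P? : Decidable P) (Q? : Decidable Q) (R? : Decidable R) →
  (∀ F → P F → Q F ⊎ R F) → # P? ≤ # Q? + # R?
#-⊎ P? Q? R? imp = length-filter-⊎ P? Q? R? imp (allSubsets _)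

#-⊎-disjoint : {P Q R : Pred (Subset n) 0ℓ} (P? : Decidable P) (Q? : Decidable Q) (R? : Decidable R) →
  (∀ F → P F → Q F ⊎ R F) → (∀ F → Q F → P F) → (∀ F → R F → P F) → (∀ F → Q F → ¬ R F) → # P? ≡ # Q? + # R?
#-⊎-disjoint P? Q? R? imp q r dis =
  ≤-antisym (#-⊎ P? Q? R? imp) (length-filter-⊎-disjoint P? Q? R? q r dis (allSubsets _))

#-none : {P : Pred (Subset n) 0ℓ} (P? : Decidable P) → (∀ F → ¬ P F) → # P? ≡ 0
#-none P? none = length-filter-none P? none (allSubsets _)

#-⋃ : {I : Set} {P : Pred (Subset n) 0ℓ} (P? : Decidable P) {Q : I → Pred (Subset n) 0ℓ} (Q? : ∀ i → Decidable (Q i)) →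
  ∀ is → (∀ F → P F → Any (λ i → Q i F) is) → # P? ≤ sum (map (λ i → # (Q? i)) is)
#-⋃ P? Q? [] imp = ≤-reflexive (#-none P? λ F pF → case imp F pF of λ ())
#-⋃ P? Q? (i ∷ is) imp = ≤-trans
  (#-⊎ P? (Q? i) (λ F → any? (λ i → Q? i F) is) λ F pF → Any.toSum (imp F pF))
  (+-monoʳ-≤ (# (Q? i)) (#-⋃ (λ F → any? (λ i → Q? i F) is) Q? is λ F x → x))

sum-map-≤ : {I : Set} (f : I → ℕ) {c : ℕ} (is : List I) → (∀ i → f i ≤ c) → sum (map f is) ≤ length is * c
sum-map-≤ f [] le = z≤n
sum-map-≤ f (i ∷ is) le = +-mono-≤ (le i) (sum-map-≤ f is le)

-- The bound is demanded at every index. Where it holds only for some, the caller puts the condition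
-- on the index into the predicate, so that the other indices count nothing.
#-⋃-≤ : {I : Set} {P : Pred (Subset n) 0ℓ} (P? : Decidable P) {Q : I → Pred (Subset n) 0ℓ} (Q? : ∀ i → Decidable (Q i)) →
  ∀ is {c} → (∀ F → P F → Any (λ i → Q i F) is) → (∀ i → # (Q? i) ≤ c) → # P? ≤ length is * c
#-⋃-≤ P? Q? is imp le = ≤-trans (#-⋃ P? Q? is imp) (sum-map-≤ _ is le)

#-∷ : {P : Pred (Subset (suc n)) 0ℓ} (P? : Decidable P) →
  # P? ≡ # (P? ∘ (inside Vec.∷_)) + # (P? ∘ (outside Vec.∷_))
#-∷ {n} P? = begin
  length (filter P? (ins ++ (outs ++ [])))
    ≡⟨ cong length (filter-++ P? ins (outs ++ [])) ⟩
  length (filter P? ins ++ filter P? (outs ++ []))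
    ≡⟨ length-++ (filter P? ins) ⟩
  length (filter P? ins) + length (filter P? (outs ++ []))
    ≡⟨ cong₂ _+_ (length-filter-map P? (inside Vec.∷_) as) (begin
        length (filter P? (outs ++ []))  ≡⟨ cong (length ∘ filter P?) (++-identityʳ outs) ⟩
        length (filter P? outs)          ≡⟨ length-filter-map P? (outside Vec.∷_) as ⟩
        length (filter (P? ∘ (outside Vec.∷_)) as) ∎) ⟩
  # (P? ∘ (inside Vec.∷_)) + # (P? ∘ (outside Vec.∷_)) ∎
  where
    open ≡-Reasoning
    as = allSubsets n
    ins = map (inside Vec.∷_) as
    outs = map (outside Vec.∷_) as

#-unique : {P : Pred (Subset n) 0ℓ} (P? : Decidable P) (G : Subset n) → (∀ F → P F → F ≡ G) → # P? ≤ 1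
#-unique {zero} P? G uniq with P? Vec.[]
... | yes _ = s≤s z≤n
... | no _  = z≤n
#-unique {suc n} {P} P? (inside Vec.∷ G) uniq = ≤-trans (≤-reflexive (#-∷ P?))
  (+-mono-≤ (#-unique (P? ∘ (inside Vec.∷_)) G λ F pF → proj₂ (∷-injective (uniq _ pF)))
            (≤-reflexive (#-none (P? ∘ (outside Vec.∷_)) λ F pF → case uniq _ pF of λ ())))
#-unique {suc n} {P} P? (outside Vec.∷ G) uniq = ≤-trans (≤-reflexive (#-∷ P?))
  (+-mono-≤ (≤-reflexive (#-none (P? ∘ (inside Vec.∷_)) λ F pF → case uniq _ pF of λ ()))
            (#-unique (P? ∘ (outside Vec.∷_)) G λ F pF → proj₂ (∷-injective (uniq _ pF))))

#-∷-cong : {P : Pred (Subset (suc n)) 0ℓ} {Q R : Pred (Subset n) 0ℓ} (P? : Decidable P) (Q? : Decidable Q) (R? : Decidable R) →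
  (∀ F → P (inside Vec.∷ F) → Q F) → (∀ F → Q F → P (inside Vec.∷ F)) →
  (∀ F → P (outside Vec.∷ F) → R F) → (∀ F → R F → P (outside Vec.∷ F)) → # P? ≡ # Q? + # R?
#-∷-cong P? Q? R? p⇒q q⇒p p⇒r r⇒p = trans (#-∷ P?)
  (cong₂ _+_ (#-cong (P? ∘ (inside Vec.∷_)) Q? p⇒q q⇒p) (#-cong (P? ∘ (outside Vec.∷_)) R? p⇒r r⇒p))

-- Exact counts and the sizes of 𝓗 and 𝓐

none? : Decidable {A = Subset n} (λ _ → ⊥)
none? _ = no λ ()

#none≡0 : ∀ n → # (none? {n}) ≡ 0
#none≡0 n = #-none (none? {n}) λ _ ()

Between : (S A : Subset n) (w : ℕ) → Pred (Subset n) 0ℓ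
Between S A w F = ∣ F ∣ ≡ w × S ⊆ F × Empty (F ∩ A)

between? : (S A : Subset n) (w : ℕ) → Decidable (Between S A w)
between? S A w F = (∣ F ∣ ≟ w) ×-dec (S ⊆? F) ×-dec ¬? (nonempty? (F ∩ A))

private
  drop-empty : ∀ {s} {p : Subset n} → Empty (s Vec.∷ p) → Empty p
  drop-empty e (x , x∈) = e (suc x , there x∈)

  ext-empty : {p : Subset n} → Empty p → Empty (outside Vec.∷ p)
  ext-empty e (suc x , there x∈) = e (x , x∈)

-- Induction on the ground set: a point of `S` or of `A` leaves no choice, and a free point gives
-- Pascal's rule.
#-between : (S A : Subset n) (j : ℕ) → (∀ {x} → x ∈ S → x ∉ A) →
  # (between? S A (∣ S ∣ + j)) ≡ ∣ ∁ (S ∪ A) ∣ C j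
#-between Vec.[] Vec.[] zero dis = refl
#-between Vec.[] Vec.[] (suc j) dis = #-none (between? Vec.[] Vec.[] (suc j)) λ { Vec.[] (() , _) }
#-between {suc n} (inside Vec.∷ S) (inside Vec.∷ A) j dis = contradiction here (dis here)
#-between {suc n} (inside Vec.∷ S) (outside Vec.∷ A) j dis = trans
  (#-∷-cong (between? _ _ _) (between? S A (∣ S ∣ + j)) none?
    (λ { F (e , sub , emp) → suc-injective e , drop-∷-⊆ sub , drop-empty emp })
    (λ { F (e , sub , emp) → cong suc e , in⊆in sub , ext-empty emp })
    (λ { F (e , sub , emp) → case sub here of λ () }) (λ _ ()))
  (trans (cong₂ _+_ (#-between S A j λ x∈ x∈A → dis (there x∈) (there x∈A)) (#none≡0 n)) (+-identityʳ _))
#-between {suc n} (outside Vec.∷ S) (inside Vec.∷ A) j dis = trans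
  (#-∷-cong (between? _ _ _) none? (between? S A (∣ S ∣ + j))
    (λ { F (e , sub , emp) → emp (zero , here) }) (λ _ ())
    (λ { F (e , sub , emp) → e , drop-∷-⊆ sub , drop-empty emp })
    (λ { F (e , sub , emp) → e , out⊆ sub , ext-empty emp }))
  (cong₂ _+_ (#none≡0 n) (#-between S A j λ x∈ x∈A → dis (there x∈) (there x∈A)))
#-between {suc n} (outside Vec.∷ S) (outside Vec.∷ A) zero dis = trans
  (#-∷-cong (between? _ _ _) none? (between? S A (∣ S ∣ + 0))
    (λ { F (e , sub , emp) → <⇒≢ (s≤s (p⊆q⇒∣p∣≤∣q∣ (drop-∷-⊆ sub))) (sym (trans e (+-identityʳ ∣ S ∣))) }) (λ _ ())
    (λ { F (e , sub , emp) → e , drop-∷-⊆ sub , drop-empty emp })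
    (λ { F (e , sub , emp) → e , out⊆ sub , ext-empty emp }))
  (cong₂ _+_ (#none≡0 n) (#-between S A 0 λ x∈ x∈A → dis (there x∈) (there x∈A)))
#-between {suc n} (outside Vec.∷ S) (outside Vec.∷ A) (suc j) dis = trans
  (#-∷-cong (between? _ _ _) (between? S A (∣ S ∣ + j)) (between? S A (∣ S ∣ + suc j))
    (λ { F (e , sub , emp) → suc-injective (trans e (+-suc ∣ S ∣ j)) , drop-∷-⊆ sub , drop-empty emp })
    (λ { F (e , sub , emp) → trans (cong suc e) (sym (+-suc ∣ S ∣ j)) , out⊆ sub , ext-empty emp })
    (λ { F (e , sub , emp) → e , drop-∷-⊆ sub , drop-empty emp })
    (λ { F (e , sub , emp) → e , out⊆ sub , ext-empty emp }))
  (trans (cong₂ _+_ (#-between S A j dis′) (#-between S A (suc j) dis′)) (nCk+nC[k+1]≡[n+1]C[k+1] ∣ ∁ (S ∪ A) ∣ j))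
  where
  dis′ : ∀ {x} → x ∈ S → x ∉ A
  dis′ x∈ x∈A = dis (there x∈) (there x∈A)

∣∁[S∪A]∣ : (S A : Subset n) → (∀ {x} → x ∈ S → x ∉ A) → ∣ ∁ (S ∪ A) ∣ ≡ n ∸ (∣ S ∣ + ∣ A ∣)
∣∁[S∪A]∣ {n} S A dis = trans (∣∁p∣≡n∸∣p∣ (S ∪ A)) (cong (n ∸_) (disjoint⇒∣∪∣≡ S A dis))

Containing : (S : Subset n) (k : ℕ) → Pred (Subset n) 0ℓ
Containing S k F = ∣ F ∣ ≡ k × S ⊆ F

containing? : (S : Subset n) (k : ℕ) → Decidable (Containing S k)
containing? S k F = (∣ F ∣ ≟ k) ×-dec (S ⊆? F)

Hitting : (S A : Subset n) (k : ℕ) → Pred (Subset n) 0ℓ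
Hitting S A k F = ∣ F ∣ ≡ k × S ⊆ F × Nonempty (F ∩ A)

hitting? : (S A : Subset n) (k : ℕ) → Decidable (Hitting S A k)
hitting? S A k F = (∣ F ∣ ≟ k) ×-dec (S ⊆? F) ×-dec nonempty? (F ∩ A)

#-between′ : (S A : Subset n) {k : ℕ} → ∣ S ∣ ≤ k → (∀ {x} → x ∈ S → x ∉ A) →
  # (between? S A k) ≡ (n ∸ (∣ S ∣ + ∣ A ∣)) C (k ∸ ∣ S ∣)
#-between′ {n} S A {k} s≤k dis = trans
  (cong (λ w → # (between? S A w)) (sym (m+[n∸m]≡n s≤k)))
  (trans (#-between S A (k ∸ ∣ S ∣) dis) (cong (_C (k ∸ ∣ S ∣)) (∣∁[S∪A]∣ S A dis)))

#-containing : (S : Subset n) {k : ℕ} → ∣ S ∣ ≤ k → # (containing? S k) ≡ (n ∸ ∣ S ∣) C (k ∸ ∣ S ∣)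
#-containing {n} S {k} s≤k = trans
  (#-cong (containing? S k) (between? S ∅ k)
    (λ { F (e , sub) → e , sub , λ { (x , x∈) → ∉⊥ (proj₂ (x∈p∩q⁻ F ∅ x∈)) } })
    (λ { F (e , sub , _) → e , sub }))
  (trans (#-between′ S ∅ s≤k (λ _ → ∉⊥))
    (cong (λ z → (n ∸ z) C (k ∸ ∣ S ∣)) (trans (cong (∣ S ∣ +_) (∣⊥∣≡0 n)) (+-identityʳ ∣ S ∣))))

#-hitting : (S A : Subset n) {k : ℕ} → ∣ S ∣ ≤ k → (∀ {x} → x ∈ S → x ∉ A) →
  # (hitting? S A k) + (n ∸ (∣ S ∣ + ∣ A ∣)) C (k ∸ ∣ S ∣) ≡ (n ∸ ∣ S ∣) C (k ∸ ∣ S ∣)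
#-hitting S A {k} s≤k dis = trans
  (cong (# (hitting? S A k) +_) (sym (#-between′ S A s≤k dis)))
  (trans (sym (#-⊎-disjoint (containing? S k) (hitting? S A k) (between? S A k)
    (λ { F (e , sub) → case nonempty? (F ∩ A) of λ { (yes ne) → inj₁ (e , (λ {x} → sub {x}) , ne) ; (no ¬ne) → inj₂ (e , (λ {x} → sub {x}) , ¬ne) } })
    (λ { F (e , sub , _) → e , sub }) (λ { F (e , sub , _) → e , sub })
    (λ { F (_ , _ , ne) (_ , _ , ¬ne) → ¬ne ne })))
  (#-containing S s≤k))

Split : (Z : Subset n) (i j : ℕ) → Pred (Subset n) 0ℓ
Split Z i j F = ∣ F ∩ Z ∣ ≡ i × ∣ F ─ Z ∣ ≡ j

split? : (Z : Subset n) (i j : ℕ) → Decidable (Split Z i j)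
split? Z i j F = (∣ F ∩ Z ∣ ≟ i) ×-dec (∣ F ─ Z ∣ ≟ j)

#-split : (Z : Subset n) (i j : ℕ) → # (split? Z i j) ≡ (∣ Z ∣ C i) * (∣ ∁ Z ∣ C j)
#-split Vec.[] zero zero = refl
#-split Vec.[] zero (suc j) = refl
#-split Vec.[] (suc i) j = refl
#-split {suc n} (inside Vec.∷ Z) zero j = trans
  (#-∷-cong (split? _ _ _) none? (split? Z 0 j) (λ { F (() , _) }) (λ _ ()) (λ F x → x) (λ F x → x))
  (cong₂ _+_ (#none≡0 n) (#-split Z 0 j))
#-split {suc n} (inside Vec.∷ Z) (suc i) j = trans
  (#-∷-cong (split? _ _ _) (split? Z i j) (split? Z (suc i) j)
    (λ { F (a , b) → suc-injective a , b }) (λ { F (a , b) → cong suc a , b }) (λ F x → x) (λ F x → x))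
  (trans (cong₂ _+_ (#-split Z i j) (#-split Z (suc i) j))
  (trans (sym (*-distribʳ-+ (∣ ∁ Z ∣ C j) (∣ Z ∣ C i) (∣ Z ∣ C suc i)))
    (cong (_* (∣ ∁ Z ∣ C j)) (nCk+nC[k+1]≡[n+1]C[k+1] ∣ Z ∣ i))))
#-split {suc n} (outside Vec.∷ Z) i zero = trans
  (#-∷-cong (split? _ _ _) none? (split? Z i 0) (λ { F (_ , ()) }) (λ _ ()) (λ F x → x) (λ F x → x))
  (cong₂ _+_ (#none≡0 n) (#-split Z i 0))
#-split {suc n} (outside Vec.∷ Z) i (suc j) = trans
  (#-∷-cong (split? _ _ _) (split? Z i j) (split? Z i (suc j))
    (λ { F (a , b) → a , suc-injective b }) (λ { F (a , b) → a , cong suc b }) (λ F x → x) (λ F x → x))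
  (trans (cong₂ _+_ (#-split Z i j) (#-split Z i (suc j)))
  (trans (sym (*-distribˡ-+ (∣ Z ∣ C i) (∣ ∁ Z ∣ C j) (∣ ∁ Z ∣ C suc j)))
    (cong ((∣ Z ∣ C i) *_) (nCk+nC[k+1]≡[n+1]C[k+1] ∣ ∁ Z ∣ j))))

Punctured : (X K : Subset n) → Pred (Subset n) 0ℓ
Punctured X K F = ∃[ x ] (x ∈ X × F ≡ K - x)

punctured? : (X K : Subset n) → Decidable (Punctured X K)
punctured? X K F = Finₚ.any? λ x → (x ∈? X) ×-dec ≡-dec Bool._≟_ F (K - x)

-- Distinct points of `X` give distinct sets. In the induction a first point lying in `X`
-- contributes the one set omitting it, whose tail is all of `K`; it is counted as a set of size
-- `∣ K ∣` containing `K`.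
#-punctured : (X K : Subset n) → X ⊆ K → # (punctured? X K) ≡ ∣ X ∣
#-punctured Vec.[] Vec.[] X⊆K = refl
#-punctured {suc n} (inside Vec.∷ X) (outside Vec.∷ K) X⊆K = case X⊆K here of λ ()
#-punctured {suc n} (inside Vec.∷ X) (inside Vec.∷ K) X⊆K = trans
  (#-∷-cong (punctured? _ _) (punctured? X K) (containing? K ∣ K ∣)
    (λ { F (zero , _ , ()) ; F (suc x , there x∈ , e) → x , x∈ , ∷-injectiveʳ e })
    (λ { F (x , x∈ , e) → suc x , there x∈ , cong (inside Vec.∷_) e })
    (λ { F (zero , _ , e) → subst (Containing K ∣ K ∣) (sym (trans (∷-injectiveʳ e) (p─⊥≡p K))) (refl , id)
       ; F (suc x , _ , ()) })
    (λ { F (e , sub) → zero , here , cong (outside Vec.∷_)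
           (trans (sym (⊆∧∣∣≤⇒≡ sub (≤-reflexive e))) (sym (p─⊥≡p K))) }))
  (trans (cong₂ _+_ (#-punctured X K (drop-∷-⊆ X⊆K))
    (trans (#-containing K ≤-refl) (cong ((n ∸ ∣ K ∣) C_) (n∸n≡0 ∣ K ∣)))) (+-comm ∣ X ∣ 1))
#-punctured {suc n} (outside Vec.∷ X) (inside Vec.∷ K) X⊆K = trans
  (#-∷-cong (punctured? _ _) (punctured? X K) none?
    (λ { F (zero , () , _) ; F (suc x , there x∈ , e) → x , x∈ , ∷-injectiveʳ e })
    (λ { F (x , x∈ , e) → suc x , there x∈ , cong (inside Vec.∷_) e })
    (λ { F (zero , () , _) ; F (suc x , _ , ()) }) (λ _ ()))
  (trans (cong₂ _+_ (#-punctured X K (drop-∷-⊆ X⊆K)) (#none≡0 n)) (+-identityʳ ∣ X ∣))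
#-punctured {suc n} (outside Vec.∷ X) (outside Vec.∷ K) X⊆K = trans
  (#-∷-cong (punctured? _ _) none? (punctured? X K)
    (λ { F (zero , () , _) ; F (suc x , _ , ()) }) (λ _ ())
    (λ { F (zero , () , _) ; F (suc x , there x∈ , e) → x , x∈ , ∷-injectiveʳ e })
    (λ { F (x , x∈ , e) → suc x , there x∈ , cong (outside Vec.∷_) e }))
  (cong₂ _+_ (#none≡0 n) (#-punctured X K (drop-∷-⊆ X⊆K)))

-- The sets through `X` either meet `L ─ X` or avoid it, and the sets `K - x` are none of these, as
-- they omit a point of `X`. The additive form avoids truncated subtraction, and shows that the
-- overlap of `K` and `L` does not affect the size.
size-𝓗 : ∀ {k t} (X K L : Subset n) → ∣ X ∣ ≡ t → ∣ L ∣ ≡ k + 1 → X ⊆ K → X ⊆ L → t ≤ k →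
  size (𝓗 k X K L) + (n ∸ (k + 1)) C (k ∸ t) ≡ (n ∸ t) C (k ∸ t) + t
size-𝓗 {n} {k} {t} X K L refl L≡ X⊆K X⊆L t≤k = begin
  size (𝓗 k X K L) + (n ∸ (k + 1)) C (k ∸ t)
    ≡⟨ cong₂ _+_ (#-⊎-disjoint (mem? (𝓗 k X K L)) (hitting? X (L ─ X) k) (punctured? X K)
         (λ F x → x) (λ F → inj₁) (λ F → inj₂)
         (λ { F (_ , X⊆F , _) (x , x∈X , refl) → proj₂ (∈-⁻ K (X⊆F x∈X)) refl }))
         (cong (λ z → (n ∸ z) C (k ∸ t)) (sym sz)) ⟩
  (# (hitting? X (L ─ X) k) + # (punctured? X K)) + (n ∸ (t + ∣ L ─ X ∣)) C (k ∸ t)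
    ≡⟨ xyz (# (hitting? X (L ─ X) k)) _ _ ⟩
  (# (hitting? X (L ─ X) k) + (n ∸ (t + ∣ L ─ X ∣)) C (k ∸ t)) + # (punctured? X K)
    ≡⟨ cong₂ _+_ (#-hitting X (L ─ X) t≤k λ x∈ x∈L → proj₂ (∈─⁻ L X x∈L) x∈) (#-punctured X K X⊆K) ⟩
  (n ∸ t) C (k ∸ t) + t ∎
  where
  open ≡-Reasoning
  xyz : ∀ a b c → (a + b) + c ≡ (a + c) + b
  xyz = solve-∀
  sz : t + ∣ L ─ X ∣ ≡ k + 1
  sz = trans (cong (λ z → ∣ z ∣ + ∣ L ─ X ∣) (sym (⊆-antisym (p∩q⊆q L X) (∩-greatest X⊆L id))))
    (trans (∣p∩q∣+∣p─q∣≡∣p∣ L X) L≡)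

-- A member meets `Z` in t + 1 or in t + 2 points; the first leaves C(t + 2, t + 1) = t + 2 choices
-- inside `Z`, the second only one.
size-𝓐 : ∀ {k t} (Z : Subset n) → ∣ Z ∣ ≡ t + 2 → t + 2 ≤ k →
  size (𝓐 k t Z) ≡ (t + 2) * ((n ∸ (t + 2)) C (k ∸ (t + 1))) + (n ∸ (t + 2)) C (k ∸ (t + 2))
size-𝓐 {n} {k} {t} Z Z≡ τ≤k = begin
  size (𝓐 k t Z)
    ≡⟨ #-⊎-disjoint (mem? (𝓐 k t Z)) (split? Z (t + 1) (k ∸ (t + 1))) (split? Z (t + 2) (k ∸ (t + 2)))
         to (from (t + 1) ≤-refl (≤-trans (+-monoʳ-≤ t (n≤1+n 1)) τ≤k)) (from (t + 2) (+-monoʳ-≤ t (n≤1+n 1)) τ≤k)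
         (λ { F (a , _) (b , _) → <⇒≢ (+-monoʳ-< t ≤-refl) (trans (sym a) b) }) ⟩
  # (split? Z (t + 1) (k ∸ (t + 1))) + # (split? Z (t + 2) (k ∸ (t + 2)))
    ≡⟨ cong₂ _+_ (#-split Z (t + 1) (k ∸ (t + 1))) (#-split Z (t + 2) (k ∸ (t + 2))) ⟩
  (∣ Z ∣ C (t + 1)) * (∣ ∁ Z ∣ C (k ∸ (t + 1))) + (∣ Z ∣ C (t + 2)) * (∣ ∁ Z ∣ C (k ∸ (t + 2)))
    ≡⟨ cong₂ _+_
      (cong₂ _*_ (trans (cong (_C (t + 1)) Z≡) c1) (cong (_C (k ∸ (t + 1))) cz))
      (trans (cong₂ _*_ (trans (cong (_C (t + 2)) Z≡) (nCn≡1 (t + 2))) (cong (_C (k ∸ (t + 2))) cz)) (*-identityˡ _)) ⟩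
  (t + 2) * ((n ∸ (t + 2)) C (k ∸ (t + 1))) + (n ∸ (t + 2)) C (k ∸ (t + 2)) ∎
  where
  open ≡-Reasoning
  cz : ∣ ∁ Z ∣ ≡ n ∸ (t + 2)
  cz = trans (∣∁p∣≡n∸∣p∣ Z) (cong (n ∸_) Z≡)
  c1 : (t + 2) C (t + 1) ≡ t + 2
  c1 = trans (nCk≡nC[n∸k] (+-monoʳ-≤ t (n≤1+n 1))) (trans (cong ((t + 2) C_) ([m+n]∸[m+o]≡n∸o t 2 1)) (nC1≡n (t + 2)))
  rest : ∀ {F i} → ∣ F ∣ ≡ k → ∣ F ∩ Z ∣ ≡ i → ∣ F ─ Z ∣ ≡ k ∸ i
  rest {F} {i} e f = trans (sym (m+n∸m≡n i ∣ F ─ Z ∣))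
    (cong (_∸ i) (trans (cong (_+ ∣ F ─ Z ∣) (sym f)) (trans (∣p∩q∣+∣p─q∣≡∣p∣ F Z) e)))
  to : ∀ F → Mem (𝓐 k t Z) F → Split Z (t + 1) (k ∸ (t + 1)) F ⊎ Split Z (t + 2) (k ∸ (t + 2)) F
  to F (e , le) with ∣ F ∩ Z ∣ ≟ t + 1
  ... | yes p = inj₁ (p , rest {F} e p)
  ... | no ¬p = inj₂ (q , rest {F} e q)
    where
    q : ∣ F ∩ Z ∣ ≡ t + 2
    q = ≤-antisym (subst (∣ F ∩ Z ∣ ≤_) Z≡ (∣p∩q∣≤∣q∣ F Z))
          (subst (_≤ ∣ F ∩ Z ∣) (sym (+-suc t 1)) (≤∧≢⇒< le (¬p ∘ sym)))
  from : ∀ i → t + 1 ≤ i → i ≤ k → ∀ F → Split Z i (k ∸ i) F → Mem (𝓐 k t Z) F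
  from i le i≤k F (a , b) =
    trans (sym (∣p∩q∣+∣p─q∣≡∣p∣ F Z)) (trans (cong₂ _+_ a b) (m+[n∸m]≡n i≤k)) , subst (t + 1 ≤_) (sym a) le

∣[1⋯]∣ : ∀ n j → j ≤ n → ∣ [1⋯_] {n} j ∣ ≡ j
∣[1⋯]∣ zero zero z≤n = refl
∣[1⋯]∣ (suc n) zero z≤n = ∣[1⋯]∣ n zero z≤n
∣[1⋯]∣ (suc n) (suc j) (s≤s le) = cong suc (∣[1⋯]∣ n j le)

[1⋯]-mono : ∀ {i j} → i ≤ j → [1⋯_] {n} i ⊆ [1⋯ j ]
[1⋯]-mono {i = i} {j} i≤j x∈ = ∈-comprehension⁺ (λ x → toℕ x <? j) (<-≤-trans (∈-comprehension⁻ (λ x → toℕ x <? i) x∈) i≤j)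

-- Covers

Cov : ℕ → Pred (Subset n) 0ℓ → Pred (Subset n) 0ℓ
Cov t P V = ∀ B → P B → t ≤ ∣ V ∩ B ∣

∣∩∣-monoˡ : {V W : Subset n} (B : Subset n) → V ⊆ W → ∣ V ∩ B ∣ ≤ ∣ W ∩ B ∣
∣∩∣-monoˡ {V = V} B V⊆W = p⊆q⇒∣p∣≤∣q∣ λ x∈ → let (a , b) = x∈p∩q⁻ V B x∈ in x∈p∩q⁺ (V⊆W a , b)

∣∩∣-monoʳ : {V W : Subset n} (B : Subset n) → V ⊆ W → ∣ B ∩ V ∣ ≤ ∣ B ∩ W ∣
∣∩∣-monoʳ {V = V} B V⊆W = p⊆q⇒∣p∣≤∣q∣ λ x∈ → let (a , b) = x∈p∩q⁻ B V x∈ in x∈p∩q⁺ (a , V⊆W b)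

∣∩∣-comm : (V W : Subset n) → ∣ V ∩ W ∣ ≡ ∣ W ∩ V ∣
∣∩∣-comm V W = cong ∣_∣ (∩-comm V W)

Cov-mono : ∀ {t} {P : Pred (Subset n) 0ℓ} {V W} → V ⊆ W → Cov t P V → Cov t P W
Cov-mono V⊆W cov B pB = ≤-trans (cov B pB) (∣∩∣-monoˡ B V⊆W)

module _ {t : ℕ} {P : Pred (Subset n) 0ℓ} (P? : Decidable P) where

  cov-or-witness : ∀ V → Cov t P V ⊎ ∃[ B ] (P B × ∣ V ∩ B ∣ < t)
  cov-or-witness V with anySubset? (λ B → P? B ×-dec (∣ V ∩ B ∣ <? t))
  ... | yes w = inj₂ w
  ... | no ∄ = inj₁ λ B pB → ≮⇒≥ λ lt → ∄ (B , pB , lt)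

  cov? : Decidable (Cov t P)
  cov? V with cov-or-witness V
  ... | inj₁ c = yes c
  ... | inj₂ (B , pB , lt) = no λ c → <⇒≱ lt (c B pB)

  ¬cov⇒witness : ∀ V → ¬ Cov t P V → ∃[ B ] (P B × ∣ V ∩ B ∣ < t)
  ¬cov⇒witness V ¬c with cov-or-witness V
  ... | inj₁ c = contradiction c ¬c
  ... | inj₂ w = w

smallest : {R : Pred (Subset n) 0ℓ} → Decidable R → ∀ V → R V → ∃[ W ] (R W × (∀ U → R U → ∣ W ∣ ≤ ∣ U ∣))
smallest {R = R} R? V rV = go V rV (<-wellFounded ∣ V ∣)
  where
  go : ∀ V → R V → Acc _<_ ∣ V ∣ → ∃[ W ] (R W × (∀ U → R U → ∣ W ∣ ≤ ∣ U ∣))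
  go V rV (acc rs) with anySubset? (λ U → R? U ×-dec (∣ U ∣ <? ∣ V ∣))
  ... | yes (U , rU , lt) = go U rU (rs lt)
  ... | no ∄ = V , rV , λ U rU → ≮⇒≥ λ lt → ∄ (U , rU , lt)

-- Branching

module _ {Q : Pred (Subset n) 0ℓ} (Q? : Decidable Q) where

  above? : ∀ V → Decidable (λ A → Q A × V ⊆ A)
  above? V A = Q? A ×-dec (V ⊆? A)

  #⊇ : Subset n → ℕ
  #⊇ V = # (above? V)

  module _ {t l : ℕ} where

    -- A member meeting B in t elements misses at most |B| ∸ t elements of B,
    -- so it contains one of any |B| ∸ t + 1 elements of B ─ V.
    branch : ∀ {V B c} → (∀ A → Q A → t ≤ ∣ A ∩ B ∣) → ∣ V ∩ B ∣ < t → ∣ B ∣ ≤ t + l →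
      (∀ x → x ∉ V → #⊇ (V ∪ ⁅ x ⁆) ≤ c) → #⊇ V ≤ suc l * c
    branch {V} {B} {c} meets V∩B<t B≤ step with t ≤? ∣ B ∣
    ... | no t≰B = ≤-trans (≤-reflexive (#-none (above? V) λ { A (qA , _) →
            t≰B (≤-trans (meets A qA) (∣p∩q∣≤∣q∣ A B)) })) z≤n
    ... | yes t≤B = ≤-trans
            (#-⋃-≤ (above? V) (λ x A → above? (V ∪ ⁅ x ⁆) A ×-dec ¬? (x ∈? V)) (elements P) cover bound)
            (*-monoˡ-≤ c (≤-trans (≤-reflexive (trans (length-elements P) ∣P∣≡)) (s≤s (m≤n+o⇒m∸n≤o ∣ B ∣ t B≤))))
      where
      room : suc (∣ B ∣ ∸ t) ≤ ∣ B ─ V ∣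
      room = +-cancelˡ-≤ ∣ B ∩ V ∣ _ _ (begin
        ∣ B ∩ V ∣ + suc (∣ B ∣ ∸ t)  ≡⟨ +-suc ∣ B ∩ V ∣ _ ⟩
        suc ∣ B ∩ V ∣ + (∣ B ∣ ∸ t)  ≤⟨ +-monoˡ-≤ (∣ B ∣ ∸ t) (subst (_< t) (∣∩∣-comm V B) V∩B<t) ⟩
        t + (∣ B ∣ ∸ t)              ≡⟨ m+[n∸m]≡n t≤B ⟩
        ∣ B ∣                        ≡⟨ sym (∣p∩q∣+∣p─q∣≡∣p∣ B V) ⟩
        ∣ B ∩ V ∣ + ∣ B ─ V ∣        ∎)
        where open ≤-Reasoning
      chosen = subsetOfSize (B ─ V) room
      P = proj₁ chosen
      P⊆ : P ⊆ B ─ V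
      P⊆ = proj₁ (proj₂ chosen)
      ∣P∣≡ : ∣ P ∣ ≡ suc (∣ B ∣ ∸ t)
      ∣P∣≡ = proj₂ (proj₂ chosen)
      hit : ∀ A → Q A → ∃[ x ] (x ∈ P × x ∈ A)
      hit A qA with nonempty? (P ∩ A)
      ... | yes (x , x∈) = x , x∈p∩q⁻ P A x∈
      ... | no empty = contradiction (begin-strict
          ∣ B ∣                           <⟨ s≤s (≤-reflexive (sym (m+[n∸m]≡n t≤B))) ⟩
          suc (t + (∣ B ∣ ∸ t))           ≡⟨ sym (+-suc t _) ⟩
          t + suc (∣ B ∣ ∸ t)             ≡⟨ cong (t +_) (sym ∣P∣≡) ⟩
          t + ∣ P ∣                       ≤⟨ +-mono-≤ (subst (t ≤_) (∣∩∣-comm A B) (meets A qA))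
                                               (p⊆q⇒∣p∣≤∣q∣ λ {x} x∈P → x∈p∧x∉q⇒x∈p─q (proj₁ (∈─⁻ B V (P⊆ x∈P)))
                                                 λ x∈A → empty (x , x∈p∩q⁺ (x∈P , x∈A))) ⟩
          ∣ B ∩ A ∣ + ∣ B ─ A ∣           ≡⟨ ∣p∩q∣+∣p─q∣≡∣p∣ B A ⟩
          ∣ B ∣                           ∎) (<-irrefl refl)
        where open ≤-Reasoning
      cover : ∀ A → Q A × V ⊆ A → Any (λ x → (Q A × (V ∪ ⁅ x ⁆) ⊆ A) × x ∉ V) (elements P)
      cover A (qA , V⊆A) with hit A qA
      ... | x , x∈P , x∈A = lose (∈-elements x∈P) ((qA , ∪-least V⊆A (⁅x⁆⊆ x∈A)) , proj₂ (∈─⁻ B V (P⊆ x∈P)))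
      bound : ∀ x → # (λ A → above? (V ∪ ⁅ x ⁆) A ×-dec ¬? (x ∈? V)) ≤ c
      bound x with x ∈? V
      ... | yes x∈V = ≤-trans (≤-reflexive (#-none (λ A → above? (V ∪ ⁅ x ⁆) A ×-dec no (λ ¬x → ¬x x∈V)) λ { A (_ , ¬x) → ¬x x∈V })) z≤n
      ... | no x∉V = ≤-trans (#-mono (λ A → above? (V ∪ ⁅ x ⁆) A ×-dec yes x∉V) (above? (V ∪ ⁅ x ⁆)) λ A → proj₁) (step x x∉V)

    -- The branching step, repeated e times. A blocking set is demanded only for those V′ that lie
    -- in a member, because the minimality of such a member is what will supply it.
    branches : ∀ e {v c V} → ∣ V ∣ ≡ v →
      (∀ V′ → v ≤ ∣ V′ ∣ → ∣ V′ ∣ < v + e → ∃[ A ] (Q A × V′ ⊆ A) →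
        ∃[ B ] ((∀ A → Q A → t ≤ ∣ A ∩ B ∣) × ∣ V′ ∩ B ∣ < t × ∣ B ∣ ≤ t + l)) →
      (∀ V′ → ∣ V′ ∣ ≡ v + e → #⊇ V′ ≤ c) → #⊇ V ≤ suc l ^ e * c
    branches zero {v} {c} {V} refl w leaf = ≤-trans (leaf V (sym (+-identityʳ _))) (≤-reflexive (sym (*-identityˡ c)))
    branches (suc e) {v} {c} {V} refl w leaf with anySubset? (above? V)
    ... | no ∄ = ≤-trans (≤-reflexive (#-none (above? V) λ A q → ∄ (A , q))) z≤n
    ... | yes (A , qA) with w V ≤-refl (m<m+n ∣ V ∣ (s≤s z≤n)) (A , qA)
    ... | B , meets , small , B≤ = ≤-trans
        (branch meets small B≤ λ x x∉V → branches e (x∉p⇒∣p∪⁅x⁆∣≡ V x∉V)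
          (λ V′ lo hi → w V′ (<⇒≤ lo) (subst (∣ V′ ∣ <_) (sym (+-suc ∣ V ∣ e)) hi))
          (λ V′ eq → leaf V′ (trans eq (sym (+-suc ∣ V ∣ e)))))
        (≤-reflexive (sym (*-assoc (suc l) (suc l ^ e) c)))

  module _ {t : ℕ} where

    -- A member has t points in `W`, hence contains one of the C(|W|, t) t-subsets of `W`: these are
    -- the starting points of the branching.
    branchFrom : ∀ {W c} → (∀ A → Q A → t ≤ ∣ A ∩ W ∣) → (∀ U → ∣ U ∣ ≡ t → #⊇ U ≤ c) → # Q? ≤ (∣ W ∣ C t) * c
    branchFrom {W} {c} meets bound = ≤-trans
      (#-⋃-≤ Q? (λ U A → above? U A ×-dec (∣ U ∣ ≟ t)) (subsetsOfSize W t) cover bound′)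
      (≤-reflexive (cong (_* c) (length-subsetsOfSize W t)))
      where
      cover : ∀ A → Q A → Any (λ U → (Q A × U ⊆ A) × ∣ U ∣ ≡ t) (subsetsOfSize W t)
      cover A qA with subsetOfSize (A ∩ W) (meets A qA)
      ... | U , U⊆ , eq = lose (∈-subsetsOfSize (λ x∈ → p∩q⊆q A W (U⊆ x∈)) eq)
                            ((qA , λ x∈ → p∩q⊆p A W (U⊆ x∈)) , eq)
      bound′ : ∀ U → # (λ A → above? U A ×-dec (∣ U ∣ ≟ t)) ≤ c
      bound′ U with ∣ U ∣ ≟ t
      ... | yes eq = ≤-trans (#-mono (λ A → above? U A ×-dec yes eq) (above? U) λ A → proj₁) (bound U eq)
      ... | no ¬eq = ≤-trans (≤-reflexive (#-none (λ A → above? U A ×-dec no ¬eq) λ { A (_ , eq) → ¬eq eq })) z≤n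

-- Dual pairs of families of minimal covers

Generates : Pred (Subset n) 0ℓ → Family n → Set
Generates 𝒮 𝓕 = ∀ F → F ∈ᶠ 𝓕 → ∃[ A ] (𝒮 A × A ⊆ F)

-- Together with `cross` below, this says that `𝒮` consists of the inclusion-minimal t-covers of `𝒯`
-- with at most k points, all of them larger than t. No family of k-sets is mentioned, so each
-- result on `𝒮` has a mirror image through `swapDual`.
record Half (n k t : ℕ) (𝒮 𝒯 : Pred (Subset n) 0ℓ) : Set where
  field
    dec     : Decidable 𝒮
    upper   : ∀ {A} → 𝒮 A → ∣ A ∣ ≤ k
    lower   : ∀ {A} → 𝒮 A → t < ∣ A ∣
    minimal : ∀ {A V} → 𝒮 A → V ⊆ A → ∣ V ∣ < ∣ A ∣ → ∃[ B ] (𝒯 B × ∣ V ∩ B ∣ < t)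
    contains : ∀ {V} → ∣ V ∣ ≤ k → Cov t 𝒯 V → ∃[ A ] (𝒮 A × A ⊆ V)

record Dual (n k t : ℕ) (𝒮 𝒯 : Pred (Subset n) 0ℓ) : Set where
  field
    left  : Half n k t 𝒮 𝒯
    right : Half n k t 𝒯 𝒮
    cross : ∀ {A B} → 𝒮 A → 𝒯 B → t ≤ ∣ A ∩ B ∣

swapDual : ∀ {n k t 𝒮 𝒯} → Dual n k t 𝒮 𝒯 → Dual n k t 𝒯 𝒮
swapDual {t = t} d = record
  { left = right ; right = left ; cross = λ {A} {B} a b → subst (t ≤_) (∣∩∣-comm B A) (cross b a) }
  where open Dual d

-- Bounds on the levels of a dual pair

Level : (t p : ℕ) → Pred (Subset n) 0ℓ → Pred (Subset n) 0ℓ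
Level t p 𝒮 A = 𝒮 A × ∣ A ∣ ≡ t + p

level? : ∀ t p {𝒮 : Pred (Subset n) 0ℓ} → Decidable 𝒮 → Decidable (Level t p 𝒮)
level? t p 𝒮? A = 𝒮? A ×-dec (∣ A ∣ ≟ t + p)

module Levels {n k t : ℕ} {𝒮 𝒯 : Pred (Subset n) 0ℓ} (dual : Dual n k t 𝒮 𝒯) where
  open Dual dual
  private
    𝒮? = Half.dec left
    𝒯? = Half.dec right
    module S = Half left
    module T = Half right

  #level : ℕ → ℕ
  #level p = # (level? t p 𝒮?)

  -- d is the excess over t of the covering number of level q of 𝒯:
  -- below size t + d one can branch along that level, with only q + 1 choices.
  #level-≤ : ∀ {p q d d′ W} → ∣ W ∣ ≡ t + d′ → d ≤ p → (∀ A → Level t p 𝒮 A → t ≤ ∣ A ∩ W ∣) →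
    (∀ V → ∣ V ∣ < t + d → ¬ Cov t (Level t q 𝒯) V) →
    #level p ≤ ((t + d′) C t) * (suc q ^ d * suc (k ∸ t) ^ (p ∸ d))
  #level-≤ {p} {q} {d} {d′} {W} ∣W∣ d≤p meets noCov =
    subst (λ z → #level p ≤ (z C t) * (suc q ^ d * suc (k ∸ t) ^ (p ∸ d))) ∣W∣ (branchFrom (level? t p 𝒮?) meets λ U ∣U∣≡t →
    -- From size t up to t + d no set covers level q of `𝒯`; its members have t + q points, which
    -- gives q + 1 choices each time.
    branches (level? t p 𝒮?) d ∣U∣≡t
      (λ V _ V< _ → let (B , (tB , ∣B∣) , lt) = ¬cov⇒witness (level? t q 𝒯?) V (noCov V V<) in
        B , (λ A sA → cross (proj₁ sA) tB) , lt , ≤-reflexive ∣B∣)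
      -- From size t + d up to t + p the blocker comes from the minimality of a member lying above;
      -- it has at most k points, which gives k - t + 1 choices. A set of full size t + p lies in at
      -- most one member of the level.
      λ V ∣V∣ → subst (#⊇ (level? t p 𝒮?) V ≤_) (*-identityʳ _) (branches (level? t p 𝒮?) (p ∸ d) ∣V∣
        (λ { V′ _ V′< (A , (sA , ∣A∣) , V′⊆A) →
          let (B , tB , lt) = S.minimal {A = A} {V = V′} sA V′⊆A (subst (∣ V′ ∣ <_) (trans eq (sym ∣A∣)) V′<) in
          B , (λ A′ sA′ → cross (proj₁ sA′) tB) , lt , ≤-trans (T.upper tB) (m≤n+m∸n k t) })
        (λ V′ ∣V′∣ → #-unique (above? (level? t p 𝒮?) V′) V′ λ { A ((_ , ∣A∣) , V′⊆A) →
          sym (⊆∧∣∣≤⇒≡ V′⊆A (≤-reflexive (trans ∣A∣ (trans (sym eq) (sym ∣V′∣))))) })))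
    where
    eq : (t + d) + (p ∸ d) ≡ t + p
    eq = trans (+-assoc t d _) (cong (t +_) (m+[n∸m]≡n d≤p))

-- d and d′ are the excesses over t of the covering numbers of level q of `𝒯` and of level p of `𝒮`.
-- They enter crosswise: the binomial of either bound belongs to the power in the other, so the
-- product splits into a factor in d and a factor in d′.
record LevelBounds {n k t : ℕ} {𝒮 𝒯 : Pred (Subset n) 0ℓ} (dual : Dual n k t 𝒮 𝒯) (p q : ℕ) : Set where
  field
    d d′  : ℕ
    d≤p   : d ≤ p
    d′≤q  : d′ ≤ q
    #𝒮≤  : Levels.#level dual p ≤ ((t + d′) C t) * (suc q ^ d * suc (k ∸ t) ^ (p ∸ d))
    #𝒯≤  : Levels.#level (swapDual dual) q ≤ ((t + d) C t) * (suc p ^ d′ * suc (k ∸ t) ^ (q ∸ d′))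

-- Each member of one level covers the other level. So smallest covers exist, and they exceed t by
-- at most p and q respectively.
levelBounds : ∀ {n k t 𝒮 𝒯} (dual : Dual n k t 𝒮 𝒯) {p q A B} →
  Level t p 𝒮 A → Level t q 𝒯 B → LevelBounds dual p q
levelBounds {n} {k} {t} {𝒮} {𝒯} dual {p} {q} {A₀} {B₀} lA@(sA , ∣A∣) lB@(tB , ∣B∣) =
  assemble (smallest (cov? {t = t} (level? t q (Half.dec right))) A₀ covA)
           (smallest (cov? {t = t} (level? t p (Half.dec left))) B₀ covB)
  where
  open Dual dual
  covA : Cov t (Level t q 𝒯) A₀
  covA B (tB′ , _) = cross sA tB′
  covB : Cov t (Level t p 𝒮) B₀
  covB A (sA′ , _) = subst (t ≤_) (∣∩∣-comm A B₀) (cross sA′ tB)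
  assemble : ∃[ W ] (Cov t (Level t q 𝒯) W × (∀ U → Cov t (Level t q 𝒯) U → ∣ W ∣ ≤ ∣ U ∣)) →
             ∃[ W ] (Cov t (Level t p 𝒮) W × (∀ U → Cov t (Level t p 𝒮) U → ∣ W ∣ ≤ ∣ U ∣)) → LevelBounds dual p q
  assemble (W , covW , leastW) (W′ , covW′ , leastW′) = record
    { d = ∣ W ∣ ∸ t ; d′ = ∣ W′ ∣ ∸ t ; d≤p = d≤p ; d′≤q = d′≤q
    ; #𝒮≤ = Levels.#level-≤ dual {W = W′} (sym e′) d≤p
        (λ A sA′ → subst (t ≤_) (∣∩∣-comm W′ A) (covW′ A sA′))
        (λ V V< c → <⇒≱ (subst (∣ V ∣ <_) e V<) (leastW V c))
    ; #𝒯≤ = Levels.#level-≤ (swapDual dual) {W = W} (sym e) d′≤q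
        (λ B tB′ → subst (t ≤_) (∣∩∣-comm W B) (covW B tB′))
        (λ V V< c → <⇒≱ (subst (∣ V ∣ <_) e′ V<) (leastW′ V c))
    }
    where
    d≤p = m≤n+o⇒m∸n≤o ∣ W ∣ t (subst (∣ W ∣ ≤_) ∣A∣ (leastW A₀ covA))
    d′≤q = m≤n+o⇒m∸n≤o ∣ W′ ∣ t (subst (∣ W′ ∣ ≤_) ∣B∣ (leastW′ B₀ covB))
    e : t + (∣ W ∣ ∸ t) ≡ ∣ W ∣
    e = m+[n∸m]≡n (≤-trans (covW B₀ lB) (∣p∩q∣≤∣p∣ W B₀))
    e′ : t + (∣ W′ ∣ ∸ t) ≡ ∣ W′ ∣
    e′ = m+[n∸m]≡n (≤-trans (covW′ A₀ lA) (∣p∩q∣≤∣p∣ W′ A₀))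

Σ< : ℕ → (ℕ → ℕ) → ℕ
Σ< zero    f = 0
Σ< (suc r) f = Σ< r f + f r

module _ {n k t : ℕ} {𝒮 𝒯 : Pred (Subset n) 0ℓ} (dual : Dual n k t 𝒮 𝒯) where
  open Dual dual
  private
    𝒮? = Half.dec left

    Below : ℕ → Pred (Subset n) 0ℓ
    Below r F = ∣ F ∣ ≡ k × ∃[ A ] ((𝒮 A × ∣ A ∣ ≤ t + r) × A ⊆ F)

    below? : ∀ r → Decidable (Below r)
    below? r F = (∣ F ∣ ≟ k) ×-dec anySubset? (λ A → (𝒮? A ×-dec (∣ A ∣ ≤? t + r)) ×-dec (A ⊆? F))

    At : ℕ → Pred (Subset n) 0ℓ
    At p F = ∣ F ∣ ≡ k × ∃[ A ] (Level t p 𝒮 A × A ⊆ F)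

    at? : ∀ p → Decidable (At p)
    at? p F = (∣ F ∣ ≟ k) ×-dec anySubset? (λ A → level? t p 𝒮? A ×-dec (A ⊆? F))

    #at : ∀ p → # (at? p) ≤ Levels.#level dual p * ((n ∸ (t + p)) C (k ∸ (t + p)))
    #at p = #-⋃-≤ (at? p) (λ A F → containing? A k F ×-dec level? t p 𝒮? A) (filter (level? t p 𝒮?) (allSubsets n))
      (λ { F (∣F∣ , A , lA , A⊆F) → lose (∈-filter⁺ (level? t p 𝒮?) (∈-allSubsets A) lA) ((∣F∣ , λ {x} → A⊆F {x}) , lA) })
      bound
      where
      bound : ∀ A → # (λ F → containing? A k F ×-dec level? t p 𝒮? A) ≤ (n ∸ (t + p)) C (k ∸ (t + p))
      bound A with level? t p 𝒮? A
      ... | yes lA@(sA , ∣A∣) = ≤-trans (#-mono (λ F → containing? A k F ×-dec yes lA) (containing? A k) λ F → proj₁)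
              (≤-reflexive (trans (#-containing A (Half.upper left sA)) (cong (λ z → (n ∸ z) C (k ∸ z)) ∣A∣)))
      ... | no ¬lA = ≤-trans (≤-reflexive (#-none (λ F → containing? A k F ×-dec no ¬lA) λ { F (_ , lA) → ¬lA lA })) z≤n

    #below : ∀ r → # (below? r) ≤ Σ< r λ p → Levels.#level dual (suc p) * ((n ∸ (t + suc p)) C (k ∸ (t + suc p)))
    #below zero = ≤-reflexive (#-none (below? 0) λ { F (_ , A , (sA , le) , _) →
      <⇒≱ (Half.lower left sA) (subst (∣ A ∣ ≤_) (+-identityʳ t) le) })
    #below (suc r) = ≤-trans (#-⊎ (below? (suc r)) (below? r) (at? (suc r)) split) (+-mono-≤ (#below r) (#at (suc r)))
      where
      split : ∀ F → Below (suc r) F → Below r F ⊎ At (suc r) F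
      split F (∣F∣ , A , (sA , le) , A⊆F) with ∣ A ∣ ≟ t + suc r
      ... | yes eq = inj₂ (∣F∣ , A , (sA , eq) , λ {x} → A⊆F {x})
      ... | no ¬eq = inj₁ (∣F∣ , A , (sA , ≤-pred (subst (suc ∣ A ∣ ≤_) (+-suc t r) (≤∧≢⇒< le ¬eq))) , λ {x} → A⊆F {x})

  -- Members of 𝓕 are sorted by the size t + p of a member of `𝒮` inside them; `lower` gives p ≥ 1
  -- and `upper` gives p ≤ k - t.
  size-≤-Σ : t ≤ k → (𝓕 : Family n) → Uniform k 𝓕 → Generates 𝒮 𝓕 →
    size 𝓕 ≤ Σ< (k ∸ t) λ p → Levels.#level dual (suc p) * ((n ∸ (t + suc p)) C (k ∸ (t + suc p)))
  size-≤-Σ t≤k 𝓕 unif gen = ≤-trans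
    (#-mono (mem? 𝓕) (below? (k ∸ t)) λ F F∈ → let (A , sA , A⊆F) = gen F F∈ in
      unif F F∈ , A , (sA , subst (∣ A ∣ ≤_) (sym (m+[n∸m]≡n t≤k)) (Half.upper left sA)) , λ {x} → A⊆F {x})
    (#below (k ∸ t))

-- Elementary inequalities for binomial coefficients and powers

absorb : ∀ n k → suc k * (suc n C suc k) ≡ suc n * (n C k)
absorb zero zero = refl
absorb zero (suc k) = trans (cong (suc (suc k) *_) (k>n⇒nCk≡0 (s≤s (s≤s (z≤n {k}))))) (trans (*-zeroʳ (suc (suc k)))
  (sym (cong (1 *_) (k>n⇒nCk≡0 (s≤s (z≤n {k}))))))
absorb (suc n) zero = trans (*-identityˡ _) (trans (nC1≡n (suc (suc n))) (sym (*-identityʳ _)))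
absorb (suc n) (suc k) = begin
  suc (suc k) * (suc (suc n) C suc (suc k))
    ≡⟨ cong (suc (suc k) *_) (sym (nCk+nC[k+1]≡[n+1]C[k+1] (suc n) (suc k))) ⟩
  suc (suc k) * ((suc n C suc k) + (suc n C suc (suc k)))
    ≡⟨ e₁ k (suc n C suc k) (suc n C suc (suc k)) ⟩
  (suc n C suc k) + (suc k * (suc n C suc k) + suc (suc k) * (suc n C suc (suc k)))
    ≡⟨ cong ((suc n C suc k) +_) (cong₂ _+_ (absorb n k) (absorb n (suc k))) ⟩
  (suc n C suc k) + (suc n * (n C k) + suc n * (n C suc k))
    ≡⟨ cong ((suc n C suc k) +_) (sym (*-distribˡ-+ (suc n) (n C k) (n C suc k))) ⟩
  (suc n C suc k) + suc n * ((n C k) + (n C suc k))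
    ≡⟨ cong (λ z → (suc n C suc k) + suc n * z) (nCk+nC[k+1]≡[n+1]C[k+1] n k) ⟩
  suc (suc n) * (suc n C suc k) ∎
  where
  open ≡-Reasoning
  e₁ : ∀ k x y → suc (suc k) * (x + y) ≡ x + (suc k * x + suc (suc k) * y)
  e₁ = solve-∀

[t+d]Ct≡[t+d]Cd : ∀ t d → (t + d) C t ≡ (t + d) C d
[t+d]Ct≡[t+d]Cd t d = trans (nCk≡nC[n∸k] (m≤m+n t d)) (cong ((t + d) C_) (m+n∸m≡n t d))

absorb′ : ∀ t d → suc d * ((t + suc d) C suc d) ≡ (t + suc d) * ((t + d) C d)
absorb′ t d = subst (λ z → suc d * (z C suc d) ≡ z * ((t + d) C d)) (sym (+-suc t d)) (absorb (t + d) d)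

-- (1 + 1/x)ᵈ ≤ 1 + u + u² for u = d/x ≤ 1.
[1+1/x]^d : ∀ x d → d ≤ x → (x * x) * suc x ^ d ≤ x ^ d * (x * x + d * x + d * d)
[1+1/x]^d x zero _ = ≤-reflexive (e x)
  where
  e : ∀ x → (x * x) * 1 ≡ 1 * (x * x + 0 * x + 0 * 0)
  e = solve-∀
[1+1/x]^d x (suc d) d<x = begin
  (x * x) * (suc x * suc x ^ d)               ≡⟨ e₁ x (suc x ^ d) ⟩
  suc x * ((x * x) * suc x ^ d)               ≤⟨ *-monoʳ-≤ (suc x) ([1+1/x]^d x d (<⇒≤ d<x)) ⟩
  suc x * (x ^ d * (x * x + d * x + d * d))   ≡⟨ e₂ x d (x ^ d) ⟩
  x ^ d * (x * (x * x + suc d * x + d * d + d) + d * d)  ≤⟨ *-monoʳ-≤ (x ^ d) (+-monoʳ-≤ (x * (x * x + suc d * x + d * d + d)) (*-monoʳ-≤ d (<⇒≤ d<x))) ⟩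
  x ^ d * (x * (x * x + suc d * x + d * d + d) + d * x)  ≤⟨ *-monoʳ-≤ (x ^ d) (m≤m+n _ x) ⟩
  x ^ d * (x * (x * x + suc d * x + d * d + d) + d * x + x)  ≡⟨ e₃ x d (x ^ d) ⟩
  (x * x ^ d) * (x * x + suc d * x + suc d * suc d) ∎
  where
  open ≤-Reasoning
  e₁ : ∀ x p → (x * x) * (suc x * p) ≡ suc x * ((x * x) * p)
  e₁ = solve-∀
  e₂ : ∀ x d p → suc x * (p * (x * x + d * x + d * d)) ≡ p * (x * (x * x + suc d * x + d * d + d) + d * d)
  e₂ = solve-∀
  e₃ : ∀ x d p → p * (x * (x * x + suc d * x + d * d + d) + d * x + x) ≡ (x * p) * (x * x + suc d * x + suc d * suc d)
  e₃ = solve-∀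

-- For u ≤ 1 the sum 1 + u + u² is at most 3.
[x+1]^d≤3x^d : ∀ x d → d ≤ suc x → suc (suc x) ^ d ≤ 3 * suc x ^ d
[x+1]^d≤3x^d x d d≤ = *-cancelˡ-≤ (y * y) (begin
  (y * y) * suc y ^ d                   ≤⟨ [1+1/x]^d y d d≤ ⟩
  y ^ d * (y * y + d * y + d * d)       ≤⟨ *-monoʳ-≤ (y ^ d) (+-mono-≤ (+-monoʳ-≤ (y * y) (*-monoˡ-≤ y d≤)) (*-mono-≤ d≤ d≤)) ⟩
  y ^ d * (y * y + y * y + y * y)       ≡⟨ e y (y ^ d) ⟩
  (y * y) * (3 * y ^ d) ∎)
  where
  open ≤-Reasoning
  y = suc x
  e : ∀ y p → p * (y * y + y * y + y * y) ≡ (y * y) * (3 * p)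
  e = solve-∀

-- For u ≤ 1/3 the sum 1 + u + u² is at most 13/9, below 3/2.
2[x+1]^d≤3x^d : ∀ x d → 3 * d ≤ suc x → 2 * suc (suc x) ^ d ≤ 3 * suc x ^ d
2[x+1]^d≤3x^d x d 3d≤ = *-cancelˡ-≤ (9 * (y * y)) (begin
  (9 * (y * y)) * (2 * suc y ^ d)                         ≡⟨ e₁ y (suc y ^ d) ⟩
  18 * ((y * y) * suc y ^ d)                              ≤⟨ *-monoʳ-≤ 18 ([1+1/x]^d y d (≤-trans (m≤m+n d (2 * d)) 3d≤)) ⟩
  18 * (y ^ d * (y * y + d * y + d * d))                  ≡⟨ e₂ y d (y ^ d) ⟩
  y ^ d * (18 * (y * y) + 6 * ((3 * d) * y) + 2 * ((3 * d) * (3 * d)))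
    ≤⟨ *-monoʳ-≤ (y ^ d) (+-mono-≤ (+-monoʳ-≤ (18 * (y * y)) (*-monoʳ-≤ 6 (*-monoˡ-≤ y 3d≤))) (*-monoʳ-≤ 2 (*-mono-≤ 3d≤ 3d≤))) ⟩
  y ^ d * (18 * (y * y) + 6 * (y * y) + 2 * (y * y))      ≤⟨ m≤m+n _ (y ^ d * (y * y)) ⟩
  y ^ d * (18 * (y * y) + 6 * (y * y) + 2 * (y * y)) + y ^ d * (y * y)  ≡⟨ e₃ y (y ^ d) ⟩
  (9 * (y * y)) * (3 * y ^ d) ∎)
  where
  open ≤-Reasoning
  y = suc x
  e₁ : ∀ y p → (9 * (y * y)) * (2 * p) ≡ 18 * ((y * y) * p)
  e₁ = solve-∀
  e₂ : ∀ y d p → 18 * (p * (y * y + d * y + d * d)) ≡ p * (18 * (y * y) + 6 * ((3 * d) * y) + 2 * ((3 * d) * (3 * d)))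
  e₂ = solve-∀
  e₃ : ∀ y p → p * (18 * (y * y) + 6 * (y * y) + 2 * (y * y)) + p * (y * y) ≡ (9 * (y * y)) * (3 * p)
  e₃ = solve-∀

q+3≤3^[q+1] : ∀ q → suc (suc (suc q)) ≤ 3 ^ suc q
q+3≤3^[q+1] zero = ≤-refl
q+3≤3^[q+1] (suc q) = ≤-trans (s≤s (q+3≤3^[q+1] q)) (m<m+n (3 ^ suc q) {2 * 3 ^ suc q}
  (≤-trans (s≤s z≤n) (≤-trans (q+3≤3^[q+1] q) (m≤m+n (3 ^ suc q) (1 * 3 ^ suc q)))))

[q+2]2^q≤3·3^q : ∀ q → suc (suc q) * 2 ^ q ≤ 3 * 3 ^ q
[q+2]2^q≤3·3^q zero = s≤s (s≤s z≤n)
[q+2]2^q≤3·3^q (suc q) = begin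
  suc (suc (suc q)) * (2 * 2 ^ q)      ≤⟨ m≤m+n _ (q * 2 ^ q) ⟩
  suc (suc (suc q)) * (2 * 2 ^ q) + q * 2 ^ q ≡⟨ e q (2 ^ q) ⟩
  3 * (suc (suc q) * 2 ^ q)            ≤⟨ *-monoʳ-≤ 3 ([q+2]2^q≤3·3^q q) ⟩
  3 * (3 * 3 ^ q) ∎
  where
  open ≤-Reasoning
  e : ∀ q p → suc (suc (suc q)) * (2 * p) + q * p ≡ 3 * (suc (suc q) * p)
  e = solve-∀

module SmallRange (t M : ℕ) (t+2≤M : t + 2 ≤ M) where

  private
    t≤M : t ≤ M
    t≤M = ≤-trans (m≤m+n t 2) t+2≤M
    t+1≤M : t + 1 ≤ M
    t+1≤M = ≤-trans (+-monoʳ-≤ t (n≤1+n 1)) t+2≤M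
    open ≤-Reasoning

    -- Raising d by one multiplies the left side by t(q + 1)/(d + 1) + (q + 1), which is at most t +
    -- (q + 1) ≤ 2M as long as q ≤ d.
    stepD : ∀ d q {X} → suc q ≤ M → suc q ≤ suc d →
      ((t + d) C d) * suc q ^ d ≤ X → ((t + suc d) C suc d) * suc q ^ suc d ≤ (2 * M) * X
    stepD d q {X} q≤M q≤d h = *-cancelˡ-≤ (suc d) (begin
      suc d * (((t + suc d) C suc d) * (suc q * suc q ^ d))    ≡⟨ e₁ (suc d) ((t + suc d) C suc d) (suc q) (suc q ^ d) ⟩
      (suc d * ((t + suc d) C suc d)) * (suc q * suc q ^ d)    ≡⟨ cong (_* (suc q * suc q ^ d)) (absorb′ t d) ⟩
      ((t + suc d) * ((t + d) C d)) * (suc q * suc q ^ d)      ≡⟨ e₂ t (suc d) ((t + d) C d) (suc q) (suc q ^ d) ⟩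
      (t * suc q + suc d * suc q) * (((t + d) C d) * suc q ^ d) ≤⟨ *-mono-≤ (+-mono-≤ (*-mono-≤ t≤M q≤d) (*-monoʳ-≤ (suc d) q≤M)) h ⟩
      (M * suc d + suc d * M) * X                               ≡⟨ e₃ M (suc d) X ⟩
      suc d * ((2 * M) * X) ∎)
      where
      e₁ : ∀ d c q p → d * (c * (q * p)) ≡ (d * c) * (q * p)
      e₁ = solve-∀
      e₂ : ∀ t d c q p → ((t + d) * c) * (q * p) ≡ (t * q + d * q) * (c * p)
      e₂ = solve-∀
      e₃ : ∀ M d X → (M * d + d * M) * X ≡ d * ((2 * M) * X)
      e₃ = solve-∀

  -- Double induction: while q + 2 ≤ d + 1, lowering d saves a factor 2M; otherwise lowering q saves
  -- at most a factor 3, because the exponent d + 1 does not exceed the base q + 1. The pair (0, 0)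
  -- is left out, as it would require 2(t + 1) ≤ M.
  binomial-power-≤ : ∀ d q → 0 < d + q → suc (suc q) ≤ M →
    ((t + suc d) C suc d) * suc (suc q) ^ suc d ≤ M ^ suc d * 2 ^ d * 3 ^ q
  binomial-power-≤ zero (suc q) _ q≤ = begin
    ((t + 1) C 1) * (suc (suc (suc q)) * 1)   ≡⟨ cong₂ _*_ (nC1≡n (t + 1)) (*-identityʳ _) ⟩
    (t + 1) * suc (suc (suc q))               ≤⟨ *-mono-≤ t+1≤M (q+3≤3^[q+1] q) ⟩
    M * 3 ^ suc q                             ≡⟨ cong (_* 3 ^ suc q) (e M) ⟩
    M ^ 1 * 2 ^ 0 * 3 ^ suc q ∎
    where
    e : ∀ M → M ≡ M * 1 * 1
    e = solve-∀
  binomial-power-≤ (suc zero) zero _ q≤ = begin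
    ((t + 2) C 2) * 4        ≡⟨ e₁ ((t + 2) C 2) ⟩
    2 * (2 * ((t + 2) C 2))  ≡⟨ cong (2 *_) (absorb′ t 1) ⟩
    2 * ((t + 2) * ((t + 1) C 1)) ≡⟨ cong (λ z → 2 * ((t + 2) * z)) (nC1≡n (t + 1)) ⟩
    2 * ((t + 2) * (t + 1))  ≤⟨ *-monoʳ-≤ 2 (*-mono-≤ t+2≤M t+1≤M) ⟩
    2 * (M * M)              ≡⟨ e₂ M ⟩
    M ^ 2 * 2 ^ 1 * 3 ^ 0 ∎
    where
    e₁ : ∀ c → c * 4 ≡ 2 * (2 * c)
    e₁ = solve-∀
    e₂ : ∀ M → 2 * (M * M) ≡ M * (M * 1) * 2 * 1
    e₂ = solve-∀
  binomial-power-≤ (suc (suc d)) zero _ q≤ = ≤-trans (stepD (suc (suc d)) 1 q≤ (s≤s (s≤s z≤n)) (binomial-power-≤ (suc d) zero (s≤s z≤n) q≤))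
    (≤-reflexive (e M (M ^ suc (suc d)) (2 ^ suc d)))
    where
    e : ∀ M p s → (2 * M) * (p * s * 1) ≡ (M * p) * (2 * s) * 1
    e = solve-∀
  binomial-power-≤ (suc d) (suc q) _ q≤ with suc (suc (suc q)) ≤? suc (suc d)
  ... | yes q≤d = ≤-trans (stepD (suc d) (suc (suc q)) q≤ q≤d (binomial-power-≤ d (suc q) (≤-trans (s≤s z≤n) (m≤n+m (suc q) d)) q≤))
    (≤-reflexive (e M (M ^ suc d) (2 ^ d) (3 ^ suc q)))
    where
    e : ∀ M p s u → (2 * M) * (p * s * u) ≡ (M * p) * (2 * s) * u
    e = solve-∀
  ... | no q≰d = begin
    c * suc (suc (suc q)) ^ suc (suc d)   ≤⟨ *-monoʳ-≤ c ([x+1]^d≤3x^d (suc q) (suc (suc d)) (≤-pred (≰⇒> q≰d))) ⟩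
    c * (3 * suc (suc q) ^ suc (suc d))   ≡⟨ e₁ c (suc (suc q) ^ suc (suc d)) ⟩
    3 * (c * suc (suc q) ^ suc (suc d))   ≤⟨ *-monoʳ-≤ 3 (binomial-power-≤ (suc d) q (s≤s z≤n) (≤-trans (n≤1+n _) q≤)) ⟩
    3 * (M ^ suc (suc d) * 2 ^ suc d * 3 ^ q) ≡⟨ e₂ (M ^ suc (suc d) * 2 ^ suc d) (3 ^ q) ⟩
    M ^ suc (suc d) * 2 ^ suc d * 3 ^ suc q ∎
    where
    c = (t + suc (suc d)) C suc (suc d)
    e₁ : ∀ c p → c * (3 * p) ≡ 3 * (c * p)
    e₁ = solve-∀
    e₂ : ∀ c p → 3 * (c * p) ≡ c * (3 * p)
    e₂ = solve-∀

  bracket : ∀ {m d p q} → m ≤ M → suc (suc q) ≤ M → 0 < p + q → d ≤ suc p →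
    ((t + d) C t) * (suc (suc q) ^ d * m ^ (suc p ∸ d)) ≤ M ^ suc p * 2 ^ p * 3 ^ q
  bracket {m} {zero} {p} {q} m≤M q≤M pq d≤p = begin
    ((t + 0) C t) * (1 * m ^ suc p)   ≡⟨ cong₂ _*_ (trans (cong (_C t) (+-identityʳ t)) (nCn≡1 t)) (*-identityˡ (m ^ suc p)) ⟩
    1 * m ^ suc p                     ≡⟨ *-identityˡ _ ⟩
    m ^ suc p                         ≤⟨ ^-monoˡ-≤ (suc p) m≤M ⟩
    M ^ suc p                         ≤⟨ ≤-reflexive (e (M ^ suc p)) ⟩
    M ^ suc p * 1 * 1                 ≤⟨ *-mono-≤ (*-monoʳ-≤ (M ^ suc p) (m^n>0 2 p)) (m^n>0 3 q) ⟩
    M ^ suc p * 2 ^ p * 3 ^ q ∎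
    where
    e : ∀ x → x ≡ x * 1 * 1
    e = solve-∀
  bracket {m} {suc d} {p} {q} m≤M q≤M pq (s≤s d≤p) with 0 <? d + q
  ... | yes dq = begin
    ((t + suc d) C t) * (suc (suc q) ^ suc d * m ^ (p ∸ d))       ≡⟨ cong (_* (suc (suc q) ^ suc d * m ^ (p ∸ d))) ([t+d]Ct≡[t+d]Cd t (suc d)) ⟩
    ((t + suc d) C suc d) * (suc (suc q) ^ suc d * m ^ (p ∸ d))   ≡⟨ sym (*-assoc ((t + suc d) C suc d) (suc (suc q) ^ suc d) _) ⟩
    ((t + suc d) C suc d) * suc (suc q) ^ suc d * m ^ (p ∸ d)     ≤⟨ *-mono-≤ (binomial-power-≤ d q dq q≤M) (^-monoˡ-≤ (p ∸ d) m≤M) ⟩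
    M ^ suc d * 2 ^ d * 3 ^ q * M ^ (p ∸ d)                       ≡⟨ e (M ^ suc d) (2 ^ d) (3 ^ q) (M ^ (p ∸ d)) ⟩
    (M ^ suc d * M ^ (p ∸ d)) * 2 ^ d * 3 ^ q                     ≡⟨ cong (λ z → z * 2 ^ d * 3 ^ q) (trans (sym (^-distribˡ-+-* M (suc d) (p ∸ d))) (cong (λ z → M ^ suc z) (m+[n∸m]≡n d≤p))) ⟩
    M ^ suc p * 2 ^ d * 3 ^ q                                     ≤⟨ *-monoˡ-≤ (3 ^ q) (*-monoʳ-≤ (M ^ suc p) (^-monoʳ-≤ 2 d≤p)) ⟩
    M ^ suc p * 2 ^ p * 3 ^ q ∎
    where
    e : ∀ a b c d → a * b * c * d ≡ (a * d) * b * c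
    e = solve-∀
  bracket {m} {suc (suc d)} {p} {q} m≤M q≤M pq (s≤s d≤p) | no ¬dq = contradiction (s≤s z≤n) ¬dq
  bracket {m} {suc zero} {p} {suc q} m≤M q≤M pq (s≤s d≤p) | no ¬dq = contradiction (s≤s z≤n) ¬dq
  -- The pair left out of `binomial-power-≤`. Its surplus factor 2 fits into the power of 2 because
  -- p + q > 0 makes p positive here.
  bracket {m} {suc zero} {suc p} {zero} m≤M q≤M pq (s≤s d≤p) | no ¬dq = begin
    ((t + 1) C t) * (2 * m ^ suc p)  ≡⟨ cong (_* (2 * m ^ suc p)) (trans ([t+d]Ct≡[t+d]Cd t 1) (nC1≡n (t + 1))) ⟩
    (t + 1) * (2 * m ^ suc p)        ≤⟨ *-mono-≤ t+1≤M (*-monoʳ-≤ 2 (^-monoˡ-≤ (suc p) m≤M)) ⟩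
    M * (2 * M ^ suc p)              ≤⟨ m≤m*n _ (2 ^ p) {{m^n≢0 2 p}} ⟩
    M * (2 * M ^ suc p) * 2 ^ p      ≡⟨ e M (M ^ suc p) (2 ^ p) ⟩
    M ^ suc (suc p) * 2 ^ suc p * 1 ∎
    where
    e : ∀ M x y → M * (2 * x) * y ≡ (M * x) * (2 * y) * 1
    e = solve-∀

^-distribʳ-* : ∀ e a b → (a * b) ^ e ≡ a ^ e * b ^ e
^-distribʳ-* zero a b = refl
^-distribʳ-* (suc e) a b = trans (cong ((a * b) *_) (^-distribʳ-* e a b)) (interchange a b (a ^ e) (b ^ e))
  where
  interchange : ∀ a b x y → (a * b) * (x * y) ≡ (a * x) * (b * y)
  interchange = solve-∀

module LargeRange (t m r N : ℕ) (3t+3≤m : 3 * (t + 1) ≤ m) (10mr≤N : 10 * (m * r) ≤ N) (120tr≤N : 120 * (t * r) ≤ N) where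

  private
    open ≤-Reasoning

    -- Raising d by one now costs N/(8r): for q + 1 ≤ 3(d + 1) the factor t(q + 1)/(d + 1) + (q + 1)
    -- is at most 3t + m, and the hypotheses on `N` give 24tr ≤ N/5 and 8mr ≤ 4N/5.
    stepD : ∀ d q {X} → suc q ≤ m → suc q ≤ 3 * suc d →
      ((t + d) C d) * suc q ^ d ≤ X → (((t + suc d) C suc d) * suc q ^ suc d) * (8 * r) ≤ N * X
    stepD d q {X} q≤m q≤d h = *-cancelˡ-≤ (5 * suc d) (begin
      (5 * suc d) * ((((t + suc d) C suc d) * (suc q * suc q ^ d)) * (8 * r))
        ≡⟨ e₁ (suc d) ((t + suc d) C suc d) (suc q) (suc q ^ d) r ⟩
      (suc d * ((t + suc d) C suc d)) * (suc q * suc q ^ d * (40 * r))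
        ≡⟨ cong (_* (suc q * suc q ^ d * (40 * r))) (absorb′ t d) ⟩
      ((t + suc d) * ((t + d) C d)) * (suc q * suc q ^ d * (40 * r))
        ≡⟨ e₂ t (suc d) ((t + d) C d) (suc q) (suc q ^ d) r ⟩
      (40 * (t * r) * suc q + (4 * suc d) * (10 * (suc q * r))) * (((t + d) C d) * suc q ^ d)
        ≤⟨ *-mono-≤ (+-mono-≤ (*-monoʳ-≤ (40 * (t * r)) q≤d) (*-monoʳ-≤ (4 * suc d) (*-monoʳ-≤ 10 (*-monoˡ-≤ r q≤m)))) h ⟩
      (40 * (t * r) * (3 * suc d) + (4 * suc d) * (10 * (m * r))) * X
        ≡⟨ cong (λ z → (z + (4 * suc d) * (10 * (m * r))) * X) (e₃ (t * r) (suc d)) ⟩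
      (suc d * (120 * (t * r)) + (4 * suc d) * (10 * (m * r))) * X
        ≤⟨ *-monoˡ-≤ X (+-mono-≤ (*-monoʳ-≤ (suc d) 120tr≤N) (*-monoʳ-≤ (4 * suc d) 10mr≤N)) ⟩
      (suc d * N + (4 * suc d) * N) * X
        ≡⟨ e₄ (suc d) N X ⟩
      (5 * suc d) * (N * X) ∎)
      where
      e₁ : ∀ d c q p r → (5 * d) * ((c * (q * p)) * (8 * r)) ≡ (d * c) * (q * p * (40 * r))
      e₁ = solve-∀
      e₂ : ∀ t d c q p r → ((t + d) * c) * (q * p * (40 * r)) ≡ (40 * (t * r) * q + (4 * d) * (10 * (q * r))) * (c * p)
      e₂ = solve-∀
      e₃ : ∀ x d → 40 * x * (3 * d) ≡ d * (120 * x)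
      e₃ = solve-∀
      e₄ : ∀ d N X → (d * N + (4 * d) * N) * X ≡ (5 * d) * (N * X)
      e₄ = solve-∀

  -- The same induction at other prices: N/(8r) for a unit of d while q + 2 ≤ 3(d + 1), otherwise
  -- 3/2 for a unit of q. The start at d = 0 rests on 3(t + 1) ≤ m.
  binomial-power-≤ : ∀ d q → suc (suc q) ≤ m →
    ((t + suc d) C suc d) * suc (suc q) ^ suc d * ((8 * r) ^ d * 2 ^ q) ≤ m * N ^ d * 3 ^ q
  binomial-power-≤ zero q q≤m = begin
    ((t + 1) C 1) * (suc (suc q) * 1) * (1 * 2 ^ q)   ≡⟨ cong (λ z → z * (suc (suc q) * 1) * (1 * 2 ^ q)) (nC1≡n (t + 1)) ⟩
    (t + 1) * (suc (suc q) * 1) * (1 * 2 ^ q)         ≡⟨ e₁ t (suc (suc q)) (2 ^ q) ⟩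
    (t + 1) * (suc (suc q) * 2 ^ q)                   ≤⟨ *-monoʳ-≤ (t + 1) ([q+2]2^q≤3·3^q q) ⟩
    (t + 1) * (3 * 3 ^ q)                             ≡⟨ e₂ t (3 ^ q) ⟩
    3 * (t + 1) * 3 ^ q                               ≤⟨ *-monoˡ-≤ (3 ^ q) 3t+3≤m ⟩
    m * 3 ^ q                                         ≡⟨ cong (_* 3 ^ q) (sym (*-identityʳ m)) ⟩
    m * 1 * 3 ^ q ∎
    where
    e₁ : ∀ t q p → (t + 1) * (q * 1) * (1 * p) ≡ (t + 1) * (q * p)
    e₁ = solve-∀
    e₂ : ∀ t p → (t + 1) * (3 * p) ≡ 3 * (t + 1) * p
    e₂ = solve-∀
  binomial-power-≤ (suc d) q q≤m with suc (suc q) ≤? 3 * suc (suc d)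
  ... | yes q≤3d = begin
    c * suc (suc q) ^ suc (suc d) * ((8 * r) ^ suc d * 2 ^ q)       ≡⟨ e₁ (c * suc (suc q) ^ suc (suc d)) (8 * r) ((8 * r) ^ d) (2 ^ q) ⟩
    (c * suc (suc q) ^ suc (suc d) * (8 * r)) * ((8 * r) ^ d * 2 ^ q) ≤⟨ *-monoˡ-≤ ((8 * r) ^ d * 2 ^ q) (stepD (suc d) (suc q) q≤m q≤3d ≤-refl) ⟩
    (N * (c′ * suc (suc q) ^ suc d)) * ((8 * r) ^ d * 2 ^ q)          ≡⟨ *-assoc N (c′ * suc (suc q) ^ suc d) _ ⟩
    N * (c′ * suc (suc q) ^ suc d * ((8 * r) ^ d * 2 ^ q))            ≤⟨ *-monoʳ-≤ N (binomial-power-≤ d q q≤m) ⟩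
    N * (m * N ^ d * 3 ^ q)                                           ≡⟨ e₂ N m (N ^ d) (3 ^ q) ⟩
    m * N ^ suc d * 3 ^ q ∎
    where
    c = (t + suc (suc d)) C suc (suc d)
    c′ = (t + suc d) C suc d
    e₁ : ∀ x y z w → x * (y * z * w) ≡ (x * y) * (z * w)
    e₁ = solve-∀
    e₂ : ∀ N m x y → N * (m * x * y) ≡ m * (N * x) * y
    e₂ = solve-∀
  binomial-power-≤ (suc d) zero q≤m | no q≰ = contradiction (s≤s (s≤s z≤n)) q≰
  binomial-power-≤ (suc d) (suc q) q≤m | no q≰ = begin
    c * x ^ suc (suc d) * (z * (2 * 2 ^ q))      ≡⟨ e₁ c (x ^ suc (suc d)) z (2 ^ q) ⟩
    c * (2 * x ^ suc (suc d)) * (z * 2 ^ q)      ≤⟨ *-monoˡ-≤ (z * 2 ^ q) (*-monoʳ-≤ c (2[x+1]^d≤3x^d (suc q) (suc (suc d)) (≤-pred (≰⇒> q≰)))) ⟩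
    c * (3 * y ^ suc (suc d)) * (z * 2 ^ q)      ≡⟨ e₂ c (y ^ suc (suc d)) z (2 ^ q) ⟩
    3 * (c * y ^ suc (suc d) * (z * 2 ^ q))      ≤⟨ *-monoʳ-≤ 3 (binomial-power-≤ (suc d) q (≤-trans (n≤1+n _) q≤m)) ⟩
    3 * (m * N ^ suc d * 3 ^ q)                  ≡⟨ e₃ (m * N ^ suc d) (3 ^ q) ⟩
    m * N ^ suc d * 3 ^ suc q ∎
    where
    c = (t + suc (suc d)) C suc (suc d)
    x = suc (suc (suc q))
    y = suc (suc q)
    z = (8 * r) ^ suc d
    e₁ : ∀ c x z w → c * x * (z * (2 * w)) ≡ c * (2 * x) * (z * w)
    e₁ = solve-∀
    e₂ : ∀ c x z w → c * (3 * x) * (z * w) ≡ 3 * (c * x * (z * w))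
    e₂ = solve-∀
    e₃ : ∀ c x → 3 * (c * x) ≡ c * (3 * x)
    e₃ = solve-∀

  private
    8mr≤N : m * (8 * r) ≤ N
    8mr≤N = ≤-trans (≤-trans (m≤m+n (m * (8 * r)) (2 * (m * r))) (≤-reflexive (e m r))) 10mr≤N
      where
      e : ∀ m r → m * (8 * r) + 2 * (m * r) ≡ 10 * (m * r)
      e = solve-∀

  bracket : ∀ {d p q} → suc (suc q) ≤ m → d ≤ suc p →
    ((t + d) C t) * (suc (suc q) ^ d * m ^ (suc p ∸ d)) * ((8 * r) ^ p * 2 ^ q) ≤ m * N ^ p * 3 ^ q
  bracket {zero} {p} {q} q≤m d≤p = begin
    ((t + 0) C t) * (1 * m ^ suc p) * ((8 * r) ^ p * 2 ^ q)   ≡⟨ cong (λ z → z * (1 * m ^ suc p) * ((8 * r) ^ p * 2 ^ q)) (trans (cong (_C t) (+-identityʳ t)) (nCn≡1 t)) ⟩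
    1 * (1 * (m * m ^ p)) * ((8 * r) ^ p * 2 ^ q)   ≡⟨ e m (m ^ p) ((8 * r) ^ p) (2 ^ q) ⟩
    m * (m ^ p * (8 * r) ^ p) * 2 ^ q               ≡⟨ cong (λ z → m * z * 2 ^ q) (sym (^-distribʳ-* p m (8 * r))) ⟩
    m * (m * (8 * r)) ^ p * 2 ^ q                   ≤⟨ *-mono-≤ (*-monoʳ-≤ m (^-monoˡ-≤ p 8mr≤N)) (^-monoˡ-≤ q (n≤1+n 2)) ⟩
    m * N ^ p * 3 ^ q ∎
    where
    e : ∀ m x y z → 1 * (1 * (m * x)) * (y * z) ≡ m * (x * y) * z
    e = solve-∀
  bracket {suc d} {p} {q} q≤m (s≤s d≤p) = begin
    ((t + suc d) C t) * (suc (suc q) ^ suc d * m ^ (p ∸ d)) * ((8 * r) ^ p * 2 ^ q)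
      ≡⟨ cong₂ (λ z w → z * (suc (suc q) ^ suc d * m ^ (p ∸ d)) * (w * 2 ^ q)) ([t+d]Ct≡[t+d]Cd t (suc d))
           (trans (cong ((8 * r) ^_) (sym (m+[n∸m]≡n d≤p))) (^-distribˡ-+-* (8 * r) d (p ∸ d))) ⟩
    c * (x * m ^ (p ∸ d)) * ((8 * r) ^ d * (8 * r) ^ (p ∸ d) * 2 ^ q)
      ≡⟨ e₁ c x (m ^ (p ∸ d)) ((8 * r) ^ d) ((8 * r) ^ (p ∸ d)) (2 ^ q) ⟩
    c * x * ((8 * r) ^ d * 2 ^ q) * (m ^ (p ∸ d) * (8 * r) ^ (p ∸ d))
      ≡⟨ cong (c * x * ((8 * r) ^ d * 2 ^ q) *_) (sym (^-distribʳ-* (p ∸ d) m (8 * r))) ⟩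
    c * x * ((8 * r) ^ d * 2 ^ q) * (m * (8 * r)) ^ (p ∸ d)
      ≤⟨ *-mono-≤ (binomial-power-≤ d q q≤m) (^-monoˡ-≤ (p ∸ d) 8mr≤N) ⟩
    m * N ^ d * 3 ^ q * N ^ (p ∸ d)
      ≡⟨ e₂ m (N ^ d) (3 ^ q) (N ^ (p ∸ d)) ⟩
    m * (N ^ d * N ^ (p ∸ d)) * 3 ^ q
      ≡⟨ cong (λ z → m * z * 3 ^ q) (trans (sym (^-distribˡ-+-* N d (p ∸ d))) (cong (N ^_) (m+[n∸m]≡n d≤p))) ⟩
    m * N ^ p * 3 ^ q ∎
    where
    c = (t + suc d) C suc d
    x = suc (suc q) ^ suc d
    e₁ : ∀ c x a b e g → c * (x * a) * (b * e * g) ≡ c * x * (b * g) * (a * e)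
    e₁ = solve-∀
    e₂ : ∀ m a b c → m * a * b * c ≡ m * (a * c) * b
    e₂ = solve-∀

-- Geometric sums

private
  -- The sum of A^i B^(R - 1 - i) over i < R, that is (B^R - A^R)/(B - A) without division.
  geo : ℕ → ℕ → ℕ → ℕ
  geo A B zero    = 0
  geo A B (suc R) = B * geo A B R + A ^ R

  geo-identity : ∀ A c R → c * geo A (A + c) R + A ^ R ≡ (A + c) ^ R
  geo-identity A c zero = cong (_+ 1) (*-zeroʳ c)
  geo-identity A c (suc R) = trans (e A c (geo A (A + c) R) (A ^ R)) (cong ((A + c) *_) (geo-identity A c R))
    where
    e : ∀ A c g x → c * ((A + c) * g + x) + A * x ≡ (A + c) * (c * g + x)
    e = solve-∀

-- A sequence dominated from index 1 on by a geometric progression of ratio A / (A + c).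
geometric-sum-≤ : ∀ (a : ℕ → ℕ) {A c β γ Q} R → .{{NonZero (A + c)}} →
  (∀ p → p < R → a (suc p) * β * (A + c) ^ suc p ≤ γ * A ^ suc p) → a 0 * β ≤ Q →
  (Σ< (suc R) a * β + γ) * c ≤ Q * c + γ * (A + c)
geometric-sum-≤ a {A} {c} {β} {γ} {Q} R dom first = *-cancelʳ-≤ _ _ (B ^ suc R) {{m^n≢0 B (suc R)}} (begin
  ((Σ< (suc R) a * β + γ) * c) * B ^ suc R        ≡⟨ e₁ (Σ< (suc R) a * β + γ) c (B ^ suc R) ⟩
  ((Σ< (suc R) a * β + γ) * B ^ suc R) * c        ≤⟨ *-monoˡ-≤ c (partial R ≤-refl) ⟩
  (Q * B ^ suc R + γ * B * geo A B (suc R)) * c   ≡⟨ e₂ Q (B ^ suc R) γ B (geo A B (suc R)) c ⟩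
  Q * c * B ^ suc R + γ * B * (c * geo A B (suc R)) ≤⟨ +-monoʳ-≤ (Q * c * B ^ suc R) (*-monoʳ-≤ (γ * B)
       (≤-trans (m≤m+n _ (A ^ suc R)) (≤-reflexive (geo-identity A c (suc R))))) ⟩
  Q * c * B ^ suc R + γ * B * B ^ suc R           ≡⟨ sym (*-distribʳ-+ (B ^ suc R) (Q * c) (γ * B)) ⟩
  (Q * c + γ * B) * B ^ suc R ∎)
  where
  open ≤-Reasoning
  B = A + c
  e₁ : ∀ x c y → (x * c) * y ≡ (x * y) * c
  e₁ = solve-∀
  e₂ : ∀ Q x γ B g c → (Q * x + γ * B * g) * c ≡ Q * c * x + γ * B * (c * g)
  e₂ = solve-∀
  partial : ∀ R′ → R′ ≤ R → (Σ< (suc R′) a * β + γ) * B ^ suc R′ ≤ Q * B ^ suc R′ + γ * B * geo A B (suc R′)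
  partial zero _ = begin
    (a 0 * β + γ) * (B * 1)              ≡⟨ e₃ (a 0 * β) γ B ⟩
    a 0 * β * (B * 1) + γ * B * 1        ≤⟨ +-monoˡ-≤ (γ * B * 1) (*-monoˡ-≤ (B * 1) first) ⟩
    Q * (B * 1) + γ * B * 1              ≡⟨ cong (λ z → Q * (B * 1) + γ * B * z) (sym (cong (_+ 1) (*-zeroʳ B))) ⟩
    Q * (B * 1) + γ * B * (B * 0 + 1) ∎
    where
    e₃ : ∀ x γ B → (x + γ) * (B * 1) ≡ x * (B * 1) + γ * B * 1
    e₃ = solve-∀
  partial (suc R′) R′<R = begin
    ((Σ< (suc R′) a + a (suc R′)) * β + γ) * (B * X)           ≡⟨ e₄ (Σ< (suc R′) a) (a (suc R′)) β γ B X ⟩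
    B * ((Σ< (suc R′) a * β + γ) * X) + B * (a (suc R′) * β * X) ≤⟨ +-mono-≤ (*-monoʳ-≤ B (partial R′ (<⇒≤ R′<R))) (*-monoʳ-≤ B (dom R′ R′<R)) ⟩
    B * (Q * X + γ * B * g) + B * (γ * A ^ suc R′)              ≡⟨ e₅ B Q X γ g (A ^ suc R′) ⟩
    Q * (B * X) + γ * B * (B * g + A ^ suc R′) ∎
    where
    X = B ^ suc R′
    g = geo A B (suc R′)
    e₄ : ∀ s a β γ B X → ((s + a) * β + γ) * (B * X) ≡ B * ((s * β + γ) * X) + B * (a * β * X)
    e₄ = solve-∀
    e₅ : ∀ B Q X γ g y → B * (Q * X + γ * B * g) + B * (γ * y) ≡ Q * (B * X) + γ * B * (B * g + y)
    e₅ = solve-∀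

-- The one-dimensional bound is applied to each column and then to the column sums. With B = A + c,
-- column 0 contains the exceptional term and sums to at most Q + YA/c; column q ≥ 1 sums to at most
-- Y(A/B)^q · B/c. The `Y` on the left stands for the (0, 0) term of the full series Y(B/c)², which
-- `Q` replaces.
double-geometric-sum-≤ : ∀ (a b : ℕ → ℕ) {A c Y Q} R → .{{NonZero (A + c)}} →
  (∀ p q → p ≤ R → q ≤ R → 0 < p + q → a p * b q * (A + c) ^ (p + q) ≤ Y * A ^ (p + q)) → a 0 * b 0 ≤ Q →
  (Σ< (suc R) a * Σ< (suc R) b + Y) * (c * c) ≤ Q * (c * c) + Y * ((A + c) * (A + c))
double-geometric-sum-≤ a b {A} {c} {Y} {Q} R dom first = +-cancelʳ-≤ (Y * B * c) _ _ (begin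
  (sa * sb + Y) * (c * c) + Y * B * c                ≡⟨ e₁ sa sb Y c B ⟩
  (sb * (sa * c) + Y * B) * c + Y * c * c            ≤⟨ +-monoˡ-≤ (Y * c * c) (geometric-sum-≤ b {A} {c} {sa * c} {Y * B} {Q * c + Y * A} R outer
                                                          (≤-trans (≤-reflexive (e₄ (b 0) sa c)) inner₀)) ⟩
  (Q * c + Y * A) * c + Y * B * B + Y * c * c        ≡⟨ e₂ Q c Y A ⟩
  Q * (c * c) + Y * (B * B) + Y * B * c ∎)
  where
  open ≤-Reasoning
  B = A + c
  sa = Σ< (suc R) a
  sb = Σ< (suc R) b
  e₁ : ∀ sa sb Y c B → (sa * sb + Y) * (c * c) + Y * B * c ≡ (sb * (sa * c) + Y * B) * c + Y * c * c
  e₁ = solve-∀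
  e₂ : ∀ Q c Y A → (Q * c + Y * A) * c + Y * (A + c) * (A + c) + Y * c * c ≡ Q * (c * c) + Y * ((A + c) * (A + c)) + Y * (A + c) * c
  e₂ = solve-∀
  e₄ : ∀ b s c → b * (s * c) ≡ (s * b) * c
  e₄ = solve-∀
  inner₀ : (sa * b 0) * c ≤ Q * c + Y * A
  inner₀ = +-cancelʳ-≤ (Y * c) _ _ (begin
    (sa * b 0) * c + Y * c     ≡⟨ sym (*-distribʳ-+ c (sa * b 0) Y) ⟩
    (sa * b 0 + Y) * c         ≤⟨ geometric-sum-≤ a {A} {c} {b 0} {Y} {Q} R
                                    (λ p p<R → subst (λ z → a (suc p) * b 0 * B ^ z ≤ Y * A ^ z) (+-identityʳ (suc p)) (dom (suc p) 0 p<R z≤n (s≤s z≤n))) first ⟩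
    Q * c + Y * (A + c)        ≡⟨ e₃ Q c Y A ⟩
    Q * c + Y * A + Y * c ∎)
    where
    e₃ : ∀ Q c Y A → Q * c + Y * (A + c) ≡ Q * c + Y * A + Y * c
    e₃ = solve-∀
  inner : ∀ q → q < R → sa * (b (suc q) * B ^ suc q) * c ≤ (Y * A ^ suc q) * B
  inner q q<R = +-cancelʳ-≤ ((Y * A ^ suc q) * c) _ _ (begin
    sa * β * c + γ * c   ≡⟨ sym (*-distribʳ-+ c (sa * β) γ) ⟩
    (sa * β + γ) * c     ≤⟨ geometric-sum-≤ a {A} {c} {β} {γ} {γ} R (λ p p<R → each (suc p) p<R) (subst₂ _≤_ (*-identityʳ _) (*-identityʳ _) (each 0 z≤n)) ⟩
    γ * c + γ * B        ≡⟨ +-comm (γ * c) (γ * B) ⟩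
    γ * B + γ * c ∎)
    where
    β = b (suc q) * B ^ suc q
    γ = Y * A ^ suc q
    each : ∀ p → p ≤ R → a p * β * B ^ p ≤ γ * A ^ p
    each p p≤R = begin
      a p * (b (suc q) * B ^ suc q) * B ^ p     ≡⟨ e₅ (a p) (b (suc q)) (B ^ suc q) (B ^ p) ⟩
      a p * b (suc q) * (B ^ p * B ^ suc q)     ≡⟨ cong (a p * b (suc q) *_) (sym (^-distribˡ-+-* B p (suc q))) ⟩
      a p * b (suc q) * B ^ (p + suc q)         ≤⟨ dom p (suc q) p≤R q<R (≤-trans (s≤s z≤n) (m≤n+m (suc q) p)) ⟩
      Y * A ^ (p + suc q)                       ≡⟨ cong (Y *_) (^-distribˡ-+-* A p (suc q)) ⟩
      Y * (A ^ p * A ^ suc q)                   ≡⟨ e₆ Y (A ^ p) (A ^ suc q) ⟩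
      Y * A ^ suc q * A ^ p ∎
      where
      e₅ : ∀ a b x y → a * (b * x) * y ≡ a * b * (y * x)
      e₅ = solve-∀
      e₆ : ∀ Y x y → Y * (x * y) ≡ Y * y * x
      e₆ = solve-∀
  outer : ∀ q → q < R → b (suc q) * (sa * c) * B ^ suc q ≤ Y * B * A ^ suc q
  outer q q<R = ≤-trans (≤-reflexive (e₇ (b (suc q)) sa c (B ^ suc q)))
    (≤-trans (inner q q<R) (≤-reflexive (e₈ Y (A ^ suc q) B)))
    where
    e₇ : ∀ b s c x → b * (s * c) * x ≡ s * (b * x) * c
    e₇ = solve-∀
    e₈ : ∀ Y x B → (Y * x) * B ≡ Y * B * x
    e₈ = solve-∀

-- The number of k-sets through a given (t + p + 1)-set, when N = n − t and r = k − t.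
degree : ℕ → ℕ → ℕ → ℕ
degree N r p = (N ∸ suc p) C (r ∸ suc p)

-- By `absorb`, consecutive degrees have the ratio (r - p - 1)/(N - p - 1).
degree-step : ∀ N r p x y → suc p < r → r ≤ N → x * (r ∸ suc p) ≤ y * (N ∸ suc p) → x * degree N r (suc p) ≤ y * degree N r p
degree-step N r p x y p<r r≤N h with N ∸ suc p in eqN | r ∸ suc p in eqr
... | N′ | zero = contradiction (m∸n≡0⇒m≤n eqr) (<⇒≱ p<r)
... | zero | suc r′ = contradiction (m∸n≡0⇒m≤n eqN) (<⇒≱ (<-≤-trans p<r r≤N))
... | suc N′ | suc r′ = *-cancelˡ-≤ (suc r′) (begin
  suc r′ * (x * ((N ∸ suc (suc p)) C (r ∸ suc (suc p))))  ≡⟨ cong₂ (λ a b → suc r′ * (x * (a C b))) (pre {N} eqN) (pre {r} eqr) ⟩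
  suc r′ * (x * (N′ C r′))          ≡⟨ e₁ (suc r′) x (N′ C r′) ⟩
  x * suc r′ * (N′ C r′)            ≤⟨ *-monoˡ-≤ (N′ C r′) h ⟩
  y * suc N′ * (N′ C r′)            ≡⟨ *-assoc y (suc N′) (N′ C r′) ⟩
  y * (suc N′ * (N′ C r′))          ≡⟨ cong (y *_) (sym (absorb N′ r′)) ⟩
  y * (suc r′ * (suc N′ C suc r′))  ≡⟨ e₂ y (suc r′) (suc N′ C suc r′) ⟩
  suc r′ * (y * (suc N′ C suc r′)) ∎)
  where
  open ≤-Reasoning
  pre : ∀ {a b} → a ∸ suc p ≡ suc b → a ∸ suc (suc p) ≡ b
  pre {a} {b} eq = trans (cong (a ∸_) (+-comm 1 (suc p))) (trans (sym (∸-+-assoc a (suc p) 1)) (cong (_∸ 1) eq))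
  e₁ : ∀ a x c → a * (x * c) ≡ x * a * c
  e₁ = solve-∀
  e₂ : ∀ y a c → y * (a * c) ≡ a * (y * c)
  e₂ = solve-∀

degree-decay : ∀ N r x y → r ≤ N → (∀ p → p < r → x * (r ∸ p) ≤ y * (N ∸ p)) → ∀ p → p < r → degree N r p * x ^ p ≤ degree N r 0 * y ^ p
degree-decay N r x y r≤N h zero p<r = ≤-refl
degree-decay N r x y r≤N h (suc p) p<r = begin
  degree N r (suc p) * (x * x ^ p)    ≡⟨ e₁ (degree N r (suc p)) x (x ^ p) ⟩
  x * degree N r (suc p) * x ^ p      ≤⟨ *-monoˡ-≤ (x ^ p) (degree-step N r p x y p<r r≤N (h (suc p) p<r)) ⟩
  y * degree N r p * x ^ p            ≡⟨ *-assoc y (degree N r p) (x ^ p) ⟩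
  y * (degree N r p * x ^ p)          ≤⟨ *-monoʳ-≤ y (degree-decay N r x y r≤N h p (<⇒≤ p<r)) ⟩
  y * (degree N r 0 * y ^ p)          ≡⟨ e₂ y (degree N r 0) (y ^ p) ⟩
  degree N r 0 * (y * y ^ p) ∎
  where
  open ≤-Reasoning
  e₁ : ∀ d x z → d * (x * z) ≡ x * d * z
  e₁ = solve-∀
  e₂ : ∀ y d z → y * (d * z) ≡ d * (y * z)
  e₂ = solve-∀

-- β(r - p) = βr - βp ≤ N - p, because β ≥ 1.
decay-ratio : ∀ {N r β} → 0 < β → β * r ≤ N → ∀ p → p < r → β * (r ∸ p) ≤ 1 * (N ∸ p)
decay-ratio {N} {r} {suc β} _ βr≤N p p<r = begin
  suc β * (r ∸ p)          ≡⟨ *-distribˡ-∸ (suc β) r p ⟩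
  suc β * r ∸ suc β * p    ≤⟨ ∸-mono βr≤N (m≤m+n p (β * p)) ⟩
  N ∸ p                    ≡⟨ sym (*-identityˡ _) ⟩
  1 * (N ∸ p) ∎
  where open ≤-Reasoning

decay-ratio′ : ∀ {N r} → r ≤ N → ∀ p → p < r → N * (r ∸ p) ≤ r * (N ∸ p)
decay-ratio′ {N} {r} r≤N p p<r = begin
  N * (r ∸ p)      ≡⟨ *-distribˡ-∸ N r p ⟩
  N * r ∸ N * p    ≤⟨ ∸-mono (≤-reflexive (*-comm N r)) (*-monoˡ-≤ p r≤N) ⟩
  r * N ∸ r * p    ≡⟨ sym (*-distribˡ-∸ r N p) ⟩
  r * (N ∸ p) ∎
  where open ≤-Reasoning

-- The product bound

module Product {n k t : ℕ} {𝒮 𝒯 : Pred (Subset n) 0ℓ} (dual : Dual n k t 𝒮 𝒯) (t<k : t < k) where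
  private
    N r m : ℕ
    N = n ∸ t
    r = k ∸ t
    m = suc (k ∸ t)
    D : ℕ → ℕ
    D = degree N r
    -- Indices are shifted by one, the lowest possible level being t + 1.
    s₊ t₊ : ℕ → ℕ
    s₊ p = Levels.#level dual (suc p)
    t₊ q = Levels.#level (swapDual dual) (suc q)
    open ≤-Reasoning

    open Dual dual

    bracket : ℕ → ℕ → ℕ → ℕ
    bracket d p q = ((t + d) C t) * (suc (suc q) ^ d * m ^ (suc p ∸ d))

    -- An empty level makes the product vanish. Otherwise `levelBounds` applies, and each binomial
    -- moves to the bracket with its own covering number.
    levels-≤ : ∀ p q {x x′ y y′} → (∀ d → d ≤ suc p → bracket d p q * x ≤ y) → (∀ d → d ≤ suc q → bracket d q p * x′ ≤ y′) →
      s₊ p * t₊ q * (x * x′) ≤ y * y′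
    levels-≤ p q {x} {x′} {y} {y′} br br′ with anySubset? (level? t (suc p) (Half.dec left)) | anySubset? (level? t (suc q) (Half.dec right))
    ... | no ∄ | _ = ≤-trans (≤-reflexive (cong (λ z → z * t₊ q * (x * x′)) (#-none (level? t (suc p) (Half.dec left)) λ A lA → ∄ (A , lA)))) z≤n
    ... | yes _ | no ∄ = ≤-trans (≤-reflexive (trans (cong (λ z → s₊ p * z * (x * x′)) (#-none (level? t (suc q) (Half.dec right)) λ B lB → ∄ (B , lB)))
            (cong (_* (x * x′)) (*-zeroʳ (s₊ p))))) z≤n
    ... | yes (A , lA) | yes (B , lB) = begin
        s₊ p * t₊ q * (x * x′)      ≤⟨ *-monoˡ-≤ (x * x′) (*-mono-≤ #𝒮≤ #𝒯≤) ⟩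
        (((t + d′) C t) * u) * (((t + d) C t) * v) * (x * x′)  ≡⟨ e ((t + d′) C t) u ((t + d) C t) v x x′ ⟩
        (bracket d p q * x) * (bracket d′ q p * x′)            ≤⟨ *-mono-≤ (br d d≤p) (br′ d′ d′≤q) ⟩
        y * y′ ∎
      where
      open LevelBounds (levelBounds dual lA lB)
      u = suc (suc q) ^ d * m ^ (suc p ∸ d)
      v = suc (suc p) ^ d′ * m ^ (suc q ∸ d′)
      e : ∀ a u b v x y → (a * u) * (b * v) * (x * y) ≡ (b * u * x) * (a * v * y)
      e = solve-∀

  -- The brackets give M²(6M)^(p + q), as each of them carries the power of 2 in one index and the
  -- power of 3 in the other. The degrees lose a factor β per step, so the common ratio is 6M/β.
  smallTerm : ∀ {M β} → t + 2 ≤ M → m ≤ M → r ≤ N → 0 < β → β * r ≤ N → ∀ p q → p < r → q < r → 0 < p + q →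
    (s₊ p * D p) * (t₊ q * D q) * β ^ (p + q) ≤ ((M * D 0) * (M * D 0)) * (6 * M) ^ (p + q)
  smallTerm {M} {β} t+2≤M m≤M r≤N β>0 βr≤N p q p<r q<r pq = begin
    (s₊ p * D p) * (t₊ q * D q) * β ^ (p + q)            ≡⟨ cong ((s₊ p * D p) * (t₊ q * D q) *_) (^-distribˡ-+-* β p q) ⟩
    (s₊ p * D p) * (t₊ q * D q) * (β ^ p * β ^ q)        ≡⟨ e₁ (s₊ p) (D p) (t₊ q) (D q) (β ^ p) (β ^ q) ⟩
    (s₊ p * t₊ q) * ((D p * β ^ p) * (D q * β ^ q))      ≤⟨ *-mono-≤ st (*-mono-≤ (dec p p<r) (dec q q<r)) ⟩
    (M ^ suc p * 2 ^ p * 3 ^ q) * (M ^ suc q * 2 ^ q * 3 ^ p) * (D 0 * D 0)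
      ≡⟨ e₂ M (M ^ p) (2 ^ p) (3 ^ q) (M ^ q) (2 ^ q) (3 ^ p) (D 0) ⟩
    ((M * D 0) * (M * D 0)) * ((2 ^ p * 3 ^ p * M ^ p) * (2 ^ q * 3 ^ q * M ^ q))
      ≡⟨ cong (((M * D 0) * (M * D 0)) *_) (trans (cong₂ _*_ (pow p) (pow q)) (sym (^-distribˡ-+-* (6 * M) p q))) ⟩
    ((M * D 0) * (M * D 0)) * (6 * M) ^ (p + q) ∎
    where
    open SmallRange t M t+2≤M using () renaming (bracket to small)
    st : s₊ p * t₊ q ≤ (M ^ suc p * 2 ^ p * 3 ^ q) * (M ^ suc q * 2 ^ q * 3 ^ p)
    st = ≤-trans (≤-reflexive (sym (*-identityʳ _))) (levels-≤ p q {1} {1}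
      (λ d d≤ → ≤-trans (≤-reflexive (*-identityʳ _)) (small {m} {d} {p} {q} m≤M (≤-trans (s≤s q<r) m≤M) pq d≤))
      (λ d d≤ → ≤-trans (≤-reflexive (*-identityʳ _)) (small {m} {d} {q} {p} m≤M (≤-trans (s≤s p<r) m≤M) (subst (0 <_) (+-comm p q) pq) d≤)))
    dec : ∀ p → p < r → D p * β ^ p ≤ D 0
    dec p p<r = ≤-trans (degree-decay N r β 1 r≤N (decay-ratio β>0 βr≤N) p p<r) (≤-reflexive (trans (cong (D 0 *_) (^-zeroˡ p)) (*-identityʳ _)))
    pow : ∀ p → 2 ^ p * 3 ^ p * M ^ p ≡ (6 * M) ^ p
    pow p = trans (cong (_* M ^ p) (sym (^-distribʳ-* p 2 3))) (sym (^-distribʳ-* p 6 M))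
    e₁ : ∀ s d t d′ x y → (s * d) * (t * d′) * (x * y) ≡ (s * t) * ((d * x) * (d′ * y))
    e₁ = solve-∀
    e₂ : ∀ M a b c d e f D → (M * a * b * c) * (M * d * e * f) * (D * D) ≡ ((M * D) * (M * D)) * ((b * f * a) * (e * c * d))
    e₂ = solve-∀

  -- The brackets give m²(N/(8r) · 3/2)^(p + q) and the degrees give (r/N)^(p + q): `N` and `r`
  -- cancel, which leaves the ratio 3/16.
  largeTerm : 3 * (t + 1) ≤ m → 10 * (m * r) ≤ N → 120 * (t * r) ≤ N → r ≤ N → 0 < N → ∀ p q → p < r → q < r →
    (s₊ p * D p) * (t₊ q * D q) * 16 ^ (p + q) ≤ ((m * D 0) * (m * D 0)) * 3 ^ (p + q)
  largeTerm 3t 10mr 120tr r≤N N>0 p q p<r q<r = *-cancelʳ-≤ _ _ (N ^ (p + q)) {{m^n≢0 N (p + q) {{>-nonZero N>0}}}} (begin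
    (s₊ p * D p) * (t₊ q * D q) * 16 ^ (p + q) * N ^ (p + q)
      ≡⟨ cong₂ (λ z w → (s₊ p * D p) * (t₊ q * D q) * z * w) (trans (^-distribˡ-+-* 16 p q) (cong₂ _*_ (^-distribʳ-* p 8 2) (^-distribʳ-* q 8 2))) (^-distribˡ-+-* N p q) ⟩
    (s₊ p * D p) * (t₊ q * D q) * ((8 ^ p * 2 ^ p) * (8 ^ q * 2 ^ q)) * (N ^ p * N ^ q)
      ≡⟨ e₁ (s₊ p) (D p) (t₊ q) (D q) (8 ^ p) (2 ^ p) (8 ^ q) (2 ^ q) (N ^ p) (N ^ q) ⟩
    (s₊ p * t₊ q) * ((8 ^ p * 2 ^ p) * (8 ^ q * 2 ^ q)) * ((D p * N ^ p) * (D q * N ^ q))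
      ≤⟨ *-monoʳ-≤ ((s₊ p * t₊ q) * ((8 ^ p * 2 ^ p) * (8 ^ q * 2 ^ q))) (*-mono-≤ (dec p p<r) (dec q q<r)) ⟩
    (s₊ p * t₊ q) * ((8 ^ p * 2 ^ p) * (8 ^ q * 2 ^ q)) * ((D 0 * r ^ p) * (D 0 * r ^ q))
      ≡⟨ e₂ (s₊ p * t₊ q) (8 ^ p) (2 ^ p) (8 ^ q) (2 ^ q) (D 0) (r ^ p) (r ^ q) ⟩
    (s₊ p * t₊ q) * (((8 ^ p * r ^ p) * 2 ^ q) * ((8 ^ q * r ^ q) * 2 ^ p)) * (D 0 * D 0)
      ≡⟨ cong₂ (λ z w → (s₊ p * t₊ q) * ((z * 2 ^ q) * (w * 2 ^ p)) * (D 0 * D 0)) (sym (^-distribʳ-* p 8 r)) (sym (^-distribʳ-* q 8 r)) ⟩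
    (s₊ p * t₊ q) * (((8 * r) ^ p * 2 ^ q) * ((8 * r) ^ q * 2 ^ p)) * (D 0 * D 0)
      ≤⟨ *-monoˡ-≤ (D 0 * D 0) (levels-≤ p q (λ d → large {d} {p} {q} (s≤s q<r)) (λ d → large {d} {q} {p} (s≤s p<r))) ⟩
    (m * N ^ p * 3 ^ q) * (m * N ^ q * 3 ^ p) * (D 0 * D 0)
      ≡⟨ e₃ m (N ^ p) (3 ^ q) (N ^ q) (3 ^ p) (D 0) ⟩
    ((m * D 0) * (m * D 0)) * (3 ^ p * 3 ^ q) * (N ^ p * N ^ q)
      ≡⟨ cong₂ (λ z w → ((m * D 0) * (m * D 0)) * z * w) (sym (^-distribˡ-+-* 3 p q)) (sym (^-distribˡ-+-* N p q)) ⟩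
    ((m * D 0) * (m * D 0)) * 3 ^ (p + q) * N ^ (p + q) ∎)
    where
    open LargeRange t m r N 3t 10mr 120tr using () renaming (bracket to large)
    dec : ∀ p → p < r → D p * N ^ p ≤ D 0 * r ^ p
    dec = degree-decay N r N r r≤N (decay-ratio′ r≤N)
    e₁ : ∀ s d t d′ a b a′ b′ x y → (s * d) * (t * d′) * ((a * b) * (a′ * b′)) * (x * y) ≡ (s * t) * ((a * b) * (a′ * b′)) * ((d * x) * (d′ * y))
    e₁ = solve-∀
    e₂ : ∀ s a b a′ b′ d x y → s * ((a * b) * (a′ * b′)) * ((d * x) * (d * y)) ≡ s * (((a * x) * b′) * ((a′ * y) * b)) * (d * d)
    e₂ = solve-∀
    e₃ : ∀ m a b c e d → (m * a * b) * (m * c * e) * (d * d) ≡ ((m * d) * (m * d)) * (e * b) * (a * c)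
    e₃ = solve-∀

  module _ (𝓕 𝓖 : Family n) (u𝓕 : Uniform k 𝓕) (u𝓖 : Uniform k 𝓖)
           (gen𝓕 : Generates 𝒮 𝓕) (gen𝓖 : Generates 𝒯 𝓖)
           {Q : ℕ} (Q≥ : s₊ 0 * t₊ 0 ≤ Q) where

    private
      R = r ∸ 1
      r≡ : r ≡ suc R
      r≡ = sym (m+[n∸m]≡n (m<n⇒0<n∸m t<k))
      ∸≡ : ∀ x p → x ∸ (t + suc p) ≡ (x ∸ t) ∸ suc p
      ∸≡ x p = sym (∸-+-assoc x t (suc p))

      Σ-cong : ∀ {f g : ℕ → ℕ} → (∀ p → f p ≡ g p) → ∀ R → Σ< R f ≡ Σ< R g
      Σ-cong h zero = refl
      Σ-cong h (suc R) = cong₂ _+_ (Σ-cong h R) (h R)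

      size≤ : ∀ {𝒮 𝒯 : Pred (Subset n) 0ℓ} (dual : Dual n k t 𝒮 𝒯) (𝓕 : Family n) → Uniform k 𝓕 → Generates 𝒮 𝓕 →
        size 𝓕 ≤ Σ< (suc R) λ p → Levels.#level dual (suc p) * D p
      size≤ dual 𝓕 u gen = ≤-trans (size-≤-Σ dual (<⇒≤ t<k) 𝓕 u gen)
        (≤-reflexive (trans (Σ-cong (λ p → cong (Levels.#level dual (suc p) *_) (cong₂ _C_ (∸≡ n p) (∸≡ k p))) r)
          (cong (λ z → Σ< z (λ p → Levels.#level dual (suc p) * D p)) r≡)))

      <r : ∀ {p} → p ≤ R → p < r
      <r {p} p≤ = subst (p <_) (sym r≡) (s≤s p≤)

      first : (s₊ 0 * D 0) * (t₊ 0 * D 0) ≤ Q * (D 0 * D 0)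
      first = ≤-trans (≤-reflexive (e (s₊ 0) (D 0) (t₊ 0))) (*-monoˡ-≤ (D 0 * D 0) Q≥)
        where
        e : ∀ s d t → (s * d) * (t * d) ≡ s * t * (d * d)
        e = solve-∀

      via : ∀ {A c Y} → .{{NonZero (A + c)}} →
        (∀ p q → p < r → q < r → 0 < p + q → (s₊ p * D p) * (t₊ q * D q) * (A + c) ^ (p + q) ≤ Y * A ^ (p + q)) →
        (size 𝓕 * size 𝓖 + Y) * (c * c) ≤ Q * (D 0 * D 0) * (c * c) + Y * ((A + c) * (A + c))
      via {A} {c} {Y} h = ≤-trans
        (*-monoˡ-≤ (c * c) (+-monoˡ-≤ Y (*-mono-≤ (size≤ dual 𝓕 u𝓕 gen𝓕) (size≤ (swapDual dual) 𝓖 u𝓖 gen𝓖))))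
        (double-geometric-sum-≤ (λ p → s₊ p * D p) (λ q → t₊ q * D q) {A} {c} {Y} R (λ p q p≤ q≤ → h p q (<r p≤) (<r q≤)) first)

    small-product : ∀ {M c β} → t + 2 ≤ M → m ≤ M → r ≤ N → 6 * M + c ≡ β → β * r ≤ N →
      (size 𝓕 * size 𝓖 + (M * D 0) * (M * D 0)) * (c * c) ≤ Q * (D 0 * D 0) * (c * c) + (M * D 0) * (M * D 0) * (β * β)
    small-product {suc M} {c} t+2≤M m≤M r≤N refl βr≤N =
      via {6 * suc M} {c} (smallTerm {suc M} t+2≤M m≤M r≤N (s≤s z≤n) βr≤N)
    small-product {zero} t+2≤M m≤M = contradiction m≤M λ ()

    -- Here c = 16 - 3 = 13, and (16/13)² = 256/169 is the sum of the double series of ratio 3/16.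
    large-product : 3 * (t + 1) ≤ m → 10 * (m * r) ≤ N → 120 * (t * r) ≤ N → r ≤ N → 0 < N →
      (size 𝓕 * size 𝓖 + (m * D 0) * (m * D 0)) * 169 ≤ Q * (D 0 * D 0) * 169 + (m * D 0) * (m * D 0) * 256
    large-product 3t 10mr 120tr r≤N N>0 = via {3} {13} λ p q p<r q<r _ → largeTerm 3t 10mr 120tr r≤N N>0 p q p<r q<r

-- The dual pair of a cross t-intersecting pair

-- Testing the removal of single points is enough, since a set containing a cover is a cover.
MinCov : (k t : ℕ) → Pred (Subset n) 0ℓ → Pred (Subset n) 0ℓ
MinCov k t P V = Cov t P V × ∣ V ∣ ≤ k × (∀ x → x ∈ V → ¬ Cov t P (V - x))

minCov? : ∀ k t {P : Pred (Subset n) 0ℓ} → Decidable P → Decidable (MinCov k t P)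
minCov? k t P? V = cov? P? V ×-dec (∣ V ∣ ≤? k) ×-dec Finₚ.all? λ x → (x ∈? V) →-dec ¬? (cov? P? (V - x))

descend : ∀ {k t} {P : Pred (Subset n) 0ℓ} → Decidable P → ∀ {V} → ∣ V ∣ ≤ k → Cov t P V → ∃[ A ] (MinCov k t P A × A ⊆ V)
descend {k = k} {t} P? {V} V≤k cov with smallest (λ U → cov? {t = t} P? U ×-dec (U ⊆? V)) V (cov , id)
... | W , (covW , W⊆V) , least = W , (covW , ≤-trans (p⊆q⇒∣p∣≤∣q∣ W⊆V) V≤k , irreducible) , W⊆V
  where
  irreducible : ∀ x → x ∈ W → ¬ Cov t _ (W - x)
  irreducible x x∈W c = <⇒≱ (x∈p⇒∣p-x∣<∣p∣ x∈W) (least (W - x) (c , λ y∈ → W⊆V (proj₁ (∈-⁻ W y∈))))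

⊆⇒⊆- : {V A : Subset n} → V ⊆ A → ∣ V ∣ < ∣ A ∣ → ∃[ x ] (x ∈ A × V ⊆ A - x)
⊆⇒⊆- {V = V} {A} V⊆A V<A with ∣p∣<∣q∣⇒∃ V A V<A
... | x , x∈A , x∉V = x , x∈A , λ y∈V → x∈p∧x≢y⇒x∈p-y (V⊆A y∈V) λ { refl → x∉V y∈V }

⊆-⋂ : {V : Subset n} (xs : List (Subset n)) → (∀ {G} → G ∈ˡ xs → V ⊆ G) → V ⊆ ⋂ xs
⊆-⋂ [] h _ = ∈⊤
⊆-⋂ (G ∷ xs) h x∈ = x∈p∩q⁺ (h (here refl) x∈ , ⊆-⋂ xs (h ∘ there) x∈)

⊆-⋂ᶠ : {V : Subset n} (𝓖 : Family n) → (∀ G → G ∈ᶠ 𝓖 → V ⊆ G) → V ⊆ ⋂ᶠ 𝓖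
⊆-⋂ᶠ 𝓖 h = ⊆-⋂ (members 𝓖) λ {G} G∈ → h G (proj₂ (∈-filter⁻ (mem? 𝓖) {xs = allSubsets _} G∈))

-- A cover with at most t points lies in every member of 𝓖, hence in an intersection with fewer than
-- t points, although it has at least t points itself. An empty family has intersection [n], and
-- `t ≤ n` excludes it.
cover-large : ∀ {t} (𝓖 : Family n) → t ≤ n → ∣ ⋂ᶠ 𝓖 ∣ < t → ∀ {V} → Cov t (Mem 𝓖) V → t < ∣ V ∣
cover-large {n} {t} 𝓖 t≤n nontriv {V} cov with anySubset? (mem? 𝓖)
... | no ∄ = contradiction t≤n (<⇒≱ (≤-<-trans
        (subst (_≤ ∣ ⋂ᶠ 𝓖 ∣) (∣⊤∣≡n n) (p⊆q⇒∣p∣≤∣q∣ (⊆-⋂ᶠ {V = ⊤} 𝓖 λ G G∈ → contradiction (G , G∈) ∄))) nontriv))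
... | yes (G₀ , G₀∈) with t <? ∣ V ∣
...   | yes t<V = t<V
...   | no t≮V = contradiction (≤-trans (cov G₀ G₀∈) (∣p∩q∣≤∣p∣ V G₀))
          (<⇒≱ (≤-<-trans (p⊆q⇒∣p∣≤∣q∣ (⊆-⋂ᶠ 𝓖 λ G G∈ x∈V →
            p∩q⊆q V G (subst (_ ∈_) (sym (⊆∧∣∣≤⇒≡ (p∩q⊆p V G) (≤-trans (≮⇒≥ t≮V) (cov G G∈)))) x∈V))) nontriv))

module FromFamilies {k t : ℕ} (t≤n : t ≤ n) (𝓕 𝓖 : Family n) (u𝓕 : Uniform k 𝓕) (u𝓖 : Uniform k 𝓖)
  (cross : CrossIntersecting t 𝓕 𝓖) (nontriv𝓕 : ∣ ⋂ᶠ 𝓕 ∣ < t) (nontriv𝓖 : ∣ ⋂ᶠ 𝓖 ∣ < t) where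

  𝒮 𝒯 : Pred (Subset n) 0ℓ
  𝒮 = MinCov k t (Mem 𝓖)
  𝒯 = MinCov k t 𝒮

  𝒮? : Decidable 𝒮
  𝒮? = minCov? k t (mem? 𝓖)

  gen𝓕 : Generates 𝒮 𝓕
  gen𝓕 F F∈ = descend (mem? 𝓖) (≤-reflexive (u𝓕 F F∈)) λ G G∈ → cross F G F∈ G∈

  gen𝓖 : Generates 𝒯 𝓖
  gen𝓖 G G∈ = descend 𝒮? (≤-reflexive (u𝓖 G G∈)) λ A sA → subst (t ≤_) (∣∩∣-comm A G) (proj₁ sA G G∈)

  private
    cov𝒮⇒cov𝓕 : ∀ {V} → Cov t 𝒮 V → Cov t (Mem 𝓕) V
    cov𝒮⇒cov𝓕 {V} c F F∈ = let (A , sA , A⊆F) = gen𝓕 F F∈ in ≤-trans (c A sA) (∣∩∣-monoʳ V A⊆F)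

    cov𝒯⇒cov𝓖 : ∀ {V} → Cov t 𝒯 V → Cov t (Mem 𝓖) V
    cov𝒯⇒cov𝓖 {V} c G G∈ = let (B , tB , B⊆G) = gen𝓖 G G∈ in ≤-trans (c B tB) (∣∩∣-monoʳ V B⊆G)

    min⁻ : ∀ {P : Pred (Subset n) 0ℓ} (P? : Decidable P) {A V} → MinCov k t P A → V ⊆ A → ∣ V ∣ < ∣ A ∣ → ∃[ B ] (P B × ∣ V ∩ B ∣ < t)
    min⁻ P? {A} {V} (_ , _ , irr) V⊆A V<A = let (x , x∈A , V⊆) = ⊆⇒⊆- V⊆A V<A in
      ¬cov⇒witness P? V λ c → irr x x∈A (Cov-mono V⊆ c)

  -- `𝒮` is defined through 𝓖, but `𝒯` can replace 𝓖: members of 𝓖 contain members of `𝒯`, so a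
  -- cover of `𝒯` covers 𝓖, and a set failing to cover 𝓖 fails on a member of `𝒯` as well. This
  -- makes the pair symmetric.
  dual : Dual n k t 𝒮 𝒯
  dual = record
    { left = record
      { dec = 𝒮? ; upper = λ sA → proj₁ (proj₂ sA) ; lower = λ {A} sA → cover-large 𝓖 t≤n nontriv𝓖 {A} (proj₁ sA)
      ; minimal = λ {A} {V} sA V⊆A V<A → let (G , G∈ , lt) = min⁻ (mem? 𝓖) {A} {V} sA V⊆A V<A
                                             (B , tB , B⊆G) = gen𝓖 G G∈ in B , tB , ≤-<-trans (∣∩∣-monoʳ V B⊆G) lt
      ; contains = λ {V} V≤k c → descend (mem? 𝓖) {V} V≤k (cov𝒯⇒cov𝓖 {V} c) }
    ; right = record
      { dec = minCov? k t 𝒮? ; upper = λ tB → proj₁ (proj₂ tB) ; lower = λ {B} tB → cover-large 𝓕 t≤n nontriv𝓕 {B} (cov𝒮⇒cov𝓕 {B} (proj₁ tB))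
      ; minimal = λ {B} {V} tB → min⁻ 𝒮? {B} {V} tB
      ; contains = λ {V} → descend 𝒮? {V} }
    ; cross = λ {A} {B} sA tB → subst (t ≤_) (∣∩∣-comm B A) (proj₁ tB A sA)
    }

-- Intersections of (t + 1)-sets

missOne : ∀ {t} {A B : Subset n} {x} → ∣ A ∣ ≡ suc t → t ≤ ∣ A ∩ B ∣ → x ∈ A → x ∉ B → A - x ⊆ B
missOne {A = A} {B} {x} ∣A∣ meets x∈A x∉B {y} y∈ = p∩q⊆q A B (subst (y ∈_) (sym eq) y∈)
  where
  eq : A ∩ B ≡ A - x
  eq = ⊆∧∣∣≤⇒≡ (λ z∈ → let (a , b) = x∈p∩q⁻ A B z∈ in x∈p∧x≢y⇒x∈p-y a λ { refl → x∉B b })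
    (≤-trans (≤-reflexive (suc-injective (trans (x∈p⇒suc∣p-x∣≡∣p∣ A x∈A) ∣A∣))) meets)

missTwo : ∀ {t} {A B : Subset n} {x y} → ∣ A ∣ ≡ suc t → t ≤ ∣ A ∩ B ∣ → x ∈ A → y ∈ A → x ≢ y → x ∉ B → y ∈ B
missTwo ∣A∣ meets x∈A y∈A x≢y x∉B = missOne ∣A∣ meets x∈A x∉B (x∈p∧x≢y⇒x∈p-y y∈A (x≢y ∘ sym))

distinct⇒∣∩∣≤ : ∀ {t} {A B : Subset n} → ∣ A ∣ ≡ suc t → ∣ B ∣ ≡ suc t → A ≢ B → ∣ A ∩ B ∣ ≤ t
distinct⇒∣∩∣≤ {t = t} {A} {B} ∣A∣ ∣B∣ A≢B with ∣ A ∩ B ∣ ≤? t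
... | yes le = le
... | no nle = contradiction (trans (sym (⊆∧∣∣≤⇒≡ (p∩q⊆p A B) (subst (_≤ ∣ A ∩ B ∣) (sym ∣A∣) (≰⇒> nle))))
                 (⊆∧∣∣≤⇒≡ (p∩q⊆q A B) (subst (_≤ ∣ A ∩ B ∣) (sym ∣B∣) (≰⇒> nle)))) A≢B

⊆∧∣∣≡⇒≡ : ∀ {j} {A B : Subset n} → A ⊆ B → ∣ A ∣ ≡ j → ∣ B ∣ ≡ j → A ≡ B
⊆∧∣∣≡⇒≡ A⊆B ∣A∣ ∣B∣ = ⊆∧∣∣≤⇒≡ A⊆B (≤-reflexive (trans ∣B∣ (sym ∣A∣)))

∪-minus-⊆ : {A B C : Subset n} {x : Fin n} → A - x ⊆ C → B - x ⊆ C → (A ∪ B) - x ⊆ C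
∪-minus-⊆ {A = A} {B} a b y∈ with ∈-⁻ (A ∪ B) y∈
... | y∈∪ , y≢x with x∈p∪q⁻ A B y∈∪
...   | inj₁ y∈A = a (x∈p∧x≢y⇒x∈p-y y∈A y≢x)
...   | inj₂ y∈B = b (x∈p∧x≢y⇒x∈p-y y∈B y≢x)

record Three (P : Pred (Subset n) 0ℓ) : Set where
  constructor three
  field
    {A₁ A₂ A₃} : Subset n
    p₁ : P A₁
    p₂ : P A₂
    p₃ : P A₃
    A₁≢A₂ : A₁ ≢ A₂
    A₁≢A₃ : A₁ ≢ A₃
    A₂≢A₃ : A₂ ≢ A₃

Three-map : {P Q : Pred (Subset n) 0ℓ} → (∀ {A} → P A → Q A) → Three P → Three Q
Three-map f (three a b c x y z) = three (f a) (f b) (f c) x y z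

module _ {P : Pred (Subset n) 0ℓ} (P? : Decidable P) where

  private
    listed : ∀ {x} → x ∈ˡ filter P? (allSubsets n) → P x
    listed x∈ = proj₂ (∈-filter⁻ P? {xs = allSubsets n} x∈)

    unique : Unique (filter P? (allSubsets n))
    unique = Uniqueₚ.filter⁺ P? (allSubsets-unique n)

  #≥1 : 1 ≤ # P? → ∃[ A ] P A
  #≥1 le with filter P? (allSubsets n) in eq
  ... | A ∷ _ = A , listed (subst (A ∈ˡ_) (sym eq) (here refl))

  #≥2 : 2 ≤ # P? → ∃[ A ] ∃[ B ] (P A × P B × A ≢ B)
  #≥2 le with filter P? (allSubsets n) in eq
  #≥2 (s≤s ()) | _ ∷ []
  #≥2 le | A ∷ B ∷ _ with subst Unique eq unique
  ... | (A≢B ∷ _) ∷ _ = A , B , listed (subst (A ∈ˡ_) (sym eq) (here refl)) , listed (subst (B ∈ˡ_) (sym eq) (there (here refl))) , A≢B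

  #≥3 : 3 ≤ # P? → Three P
  #≥3 le with filter P? (allSubsets n) in eq
  #≥3 (s≤s ()) | _ ∷ []
  #≥3 (s≤s (s≤s ())) | _ ∷ _ ∷ []
  #≥3 le | A ∷ B ∷ C ∷ _ with subst Unique eq unique
  ... | (A≢B ∷ A≢C ∷ _) ∷ (B≢C ∷ _) ∷ _ = three
    (listed (subst (A ∈ˡ_) (sym eq) (here refl))) (listed (subst (B ∈ˡ_) (sym eq) (there (here refl))))
    (listed (subst (C ∈ˡ_) (sym eq) (there (there (here refl))))) A≢B A≢C B≢C

-- If x ∈ X were outside `B`, then `B` would contain every `Aᵢ - x`. Three distinct (t + 1)-sets
-- through `X` have a union of t + 3 points, so `B` would have t + 2 points.
star-forces : ∀ {t} {X B : Subset n} → ∣ X ∣ ≡ t → Three (λ A → (∣ A ∣ ≡ suc t × t ≤ ∣ A ∩ B ∣) × X ⊆ A) → ∣ B ∣ ≡ suc t → X ⊆ B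
star-forces {t = t} {X} {B} ∣X∣ (three {A₁} {A₂} {A₃} ((s₁ , m₁) , X₁) ((s₂ , m₂) , X₂) ((s₃ , m₃) , X₃) ne₁₂ ne₁₃ ne₂₃) ∣B∣ {x} x∈X with x ∈? B
... | yes x∈B = x∈B
... | no x∉B = contradiction (begin-strict
    suc t                       <⟨ ≤-refl ⟩
    suc (suc t)                 ≤⟨ ≤-pred (begin
        suc (suc (suc t))         ≤⟨ +-cancelʳ-≤ t _ _ (begin
            suc (suc (suc t)) + t   ≡⟨ e t ⟩
            suc (suc t) + suc t     ≡⟨ cong₂ _+_ (sym sz) (sym s₃) ⟩
            ∣ A₁ ∪ A₂ ∣ + ∣ A₃ ∣     ≡⟨ sym (∣p∪q∣+∣p∩q∣≡∣p∣+∣q∣ (A₁ ∪ A₂) A₃) ⟩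
            ∣ U ∣ + ∣ (A₁ ∪ A₂) ∩ A₃ ∣ ≤⟨ +-monoʳ-≤ ∣ U ∣ small ⟩
            ∣ U ∣ + t ∎) ⟩
        ∣ U ∣                     ≡⟨ sym (x∈p⇒suc∣p-x∣≡∣p∣ U (x∈p∪q⁺ (inj₂ (X₃ x∈X)))) ⟩
        suc ∣ U - x ∣ ∎) ⟩
    ∣ U - x ∣                   ≤⟨ p⊆q⇒∣p∣≤∣q∣ (∪-minus-⊆ {A = A₁ ∪ A₂} {A₃} (∪-minus-⊆ {A = A₁} {A₂} (missOne s₁ m₁ (X₁ x∈X) x∉B) (missOne s₂ m₂ (X₂ x∈X) x∉B)) (missOne s₃ m₃ (X₃ x∈X) x∉B)) ⟩
    ∣ B ∣                       ≡⟨ ∣B∣ ⟩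
    suc t ∎) (<-irrefl refl)
  where
  open ≤-Reasoning
  U = (A₁ ∪ A₂) ∪ A₃
  e : ∀ t → suc (suc (suc t)) + t ≡ suc (suc t) + suc t
  e = solve-∀
  X≡ : ∀ {A A′} → ∣ A ∣ ≡ suc t → ∣ A′ ∣ ≡ suc t → X ⊆ A → X ⊆ A′ → A ≢ A′ → X ≡ A ∩ A′
  X≡ s s′ XA XA′ ne = ⊆∧∣∣≤⇒≡ (∩-greatest XA XA′) (≤-trans (distinct⇒∣∩∣≤ s s′ ne) (≤-reflexive (sym ∣X∣)))
  sz : ∣ A₁ ∪ A₂ ∣ ≡ suc (suc t)
  sz = +-cancelʳ-≡ t _ _ (trans (cong (∣ A₁ ∪ A₂ ∣ +_) (trans (sym ∣X∣) (cong ∣_∣ (X≡ s₁ s₂ X₁ X₂ ne₁₂))))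
    (trans (∣p∪q∣+∣p∩q∣≡∣p∣+∣q∣ A₁ A₂) (trans (cong₂ _+_ s₁ s₂) (+-suc (suc t) t))))
  small : ∣ (A₁ ∪ A₂) ∩ A₃ ∣ ≤ t
  small = ≤-trans (p⊆q⇒∣p∣≤∣q∣ sub) (≤-reflexive ∣X∣)
    where
    sub : (A₁ ∪ A₂) ∩ A₃ ⊆ X
    sub y∈ with x∈p∩q⁻ (A₁ ∪ A₂) A₃ y∈
    ... | y∈∪ , y∈A₃ with x∈p∪q⁻ A₁ A₂ y∈∪
    ...   | inj₁ y∈A₁ = subst (_ ∈_) (sym (X≡ s₁ s₃ X₁ X₃ ne₁₃)) (x∈p∩q⁺ (y∈A₁ , y∈A₃))
    ...   | inj₂ y∈A₂ = subst (_ ∈_) (sym (X≡ s₂ s₃ X₂ X₃ ne₂₃)) (x∈p∩q⁺ (y∈A₂ , y∈A₃))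

-- Each Aᵢ is `Z` without one point zᵢ. If z₂ or z₃ lies in `G`, it joins the t points of `G` in A₂
-- or A₃. Not both can be outside `G`, because A₁ contains both and has at most one point outside
-- `G`.
triangle-forces : ∀ {t} {Z G : Subset n} → ∣ Z ∣ ≡ suc (suc t) → Three (λ A → (∣ A ∣ ≡ suc t × t ≤ ∣ A ∩ G ∣) × A ⊆ Z) → suc t ≤ ∣ G ∩ Z ∣
triangle-forces {t = t} {Z} {G} ∣Z∣ (three {A₁} {A₂} {A₃} ((s₁ , m₁) , Z₁) ((s₂ , m₂) , Z₂) ((s₃ , m₃) , Z₃) ne₁₂ ne₁₃ ne₂₃)
  with ∣p∣<∣q∣⇒∃ A₂ Z (≤-reflexive (trans (cong suc s₂) (sym ∣Z∣))) | ∣p∣<∣q∣⇒∃ A₃ Z (≤-reflexive (trans (cong suc s₃) (sym ∣Z∣)))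
... | z₂ , z₂∈Z , z₂∉ | z₃ , z₃∈Z , z₃∉ = finish (z₂ ∈? G)
  where
  inOther : ∀ {A A′ z} → ∣ A ∣ ≡ suc t → ∣ A′ ∣ ≡ suc t → A ⊆ Z → A′ ⊆ Z → A ≢ A′ → z ∈ Z → z ∉ A → z ∈ A′
  inOther {A} {A′} {z} s s′ AZ AZ′ ne z∈Z z∉A with z ∈? A′
  ... | yes z∈A′ = z∈A′
  ... | no z∉A′ = contradiction (trans (eq s AZ z∉A) (sym (eq s′ AZ′ z∉A′))) ne
    where
    eq : ∀ {A} → ∣ A ∣ ≡ suc t → A ⊆ Z → z ∉ A → A ≡ Z - z
    eq s AZ z∉ = ⊆∧∣∣≡⇒≡ (λ y∈ → x∈p∧x≢y⇒x∈p-y (AZ y∈) λ { refl → z∉ y∈ }) s (suc-injective (trans (x∈p⇒suc∣p-x∣≡∣p∣ Z z∈Z) ∣Z∣))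
  inside-G : ∀ {A z} → t ≤ ∣ A ∩ G ∣ → A ⊆ Z → z ∈ Z → z ∉ A → z ∈ G → suc t ≤ ∣ G ∩ Z ∣
  inside-G {A} {z} m AZ z∈Z z∉A z∈G = ≤-<-trans m (p⊂q⇒∣p∣<∣q∣
    ((λ y∈ → let (a , b) = x∈p∩q⁻ A G y∈ in x∈p∩q⁺ (b , AZ a)) , z , x∈p∩q⁺ (z∈G , z∈Z) , λ z∈ → z∉A (proj₁ (x∈p∩q⁻ A G z∈))))
  finish : Dec (z₂ ∈ G) → suc t ≤ ∣ G ∩ Z ∣
  finish (yes z₂∈G) = inside-G m₂ Z₂ z₂∈Z z₂∉ z₂∈G
  finish (no z₂∉G) = inside-G m₃ Z₃ z₃∈Z z₃∉
    (missTwo s₁ m₁ (inOther s₂ s₁ Z₂ Z₁ (ne₁₂ ∘ sym) z₂∈Z z₂∉) (inOther s₃ s₁ Z₃ Z₁ (ne₁₃ ∘ sym) z₃∈Z z₃∉)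
      (λ { refl → z₃∉ (inOther s₂ s₃ Z₂ Z₃ ne₂₃ z₂∈Z z₂∉) }) z₂∉G)

∣P∣≡2⇒pair : ∀ {n} (P : Subset n) → ∣ P ∣ ≡ 2 → ∃[ p ] ∃[ q ] (p ∈ P × q ∈ P × (∀ x → x ∈ P → x ≡ p ⊎ x ≡ q))
∣P∣≡2⇒pair {n} P ∣P∣ with ∣p∣<∣q∣⇒∃ ∅ P (subst₂ _<_ (sym (∣⊥∣≡0 n)) (sym ∣P∣) (s≤s z≤n))
... | p , p∈ , _ with ∣p∣<∣q∣⇒∃ ⁅ p ⁆ P (subst₂ _<_ (sym (∣⁅x⁆∣≡1 p)) (sym ∣P∣) ≤-refl)
... | q , q∈ , q∉ = p , q , p∈ , q∈ , only
  where
  eq : ⁅ p ⁆ ∪ ⁅ q ⁆ ≡ P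
  eq = ⊆∧∣∣≡⇒≡ (∪-least (⁅x⁆⊆ p∈) (⁅x⁆⊆ q∈)) (trans (x∉p⇒∣p∪⁅x⁆∣≡ ⁅ p ⁆ q∉) (cong suc (∣⁅x⁆∣≡1 p))) ∣P∣
  only : ∀ x → x ∈ P → x ≡ p ⊎ x ≡ q
  only x x∈ with x∈p∪q⁻ ⁅ p ⁆ ⁅ q ⁆ (subst (x ∈_) (sym eq) x∈)
  ... | inj₁ a = inj₁ (x∈⁅y⁆⇒x≡y p a)
  ... | inj₂ b = inj₂ (x∈⁅y⁆⇒x≡y q b)

-- The sizes of the first levels

module FirstLevel {n k t : ℕ} {𝒮 𝒯 : Pred (Subset n) 0ℓ} (dual : Dual n k t 𝒮 𝒯) where
  open Dual dual
  private
    m : ℕ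
    m = suc (k ∸ t)

  𝒮₁ 𝒯₁ : Pred (Subset n) 0ℓ
  𝒮₁ = Level t 1 𝒮
  𝒯₁ = Level t 1 𝒯

  𝒮₁? : Decidable 𝒮₁
  𝒮₁? = level? t 1 (Half.dec left)

  ∣𝒮₁∣ : ∀ {A} → 𝒮₁ A → ∣ A ∣ ≡ suc t
  ∣𝒮₁∣ (_ , eq) = trans eq (+-comm t 1)

  ∣𝒯₁∣ : ∀ {B} → 𝒯₁ B → ∣ B ∣ ≡ suc t
  ∣𝒯₁∣ (_ , eq) = trans eq (+-comm t 1)

  meets : ∀ {A B} → 𝒮₁ A → 𝒯₁ B → t ≤ ∣ A ∩ B ∣
  meets (sA , _) (tB , _) = cross sA tB

  #⊇full≤1 : ∀ {V} → ∣ V ∣ ≡ suc t → #⊇ 𝒮₁? V ≤ 1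
  #⊇full≤1 {V} ∣V∣ = #-unique (above? 𝒮₁? V) V λ { A (s₁ , V⊆A) → sym (⊆∧∣∣≡⇒≡ V⊆A ∣V∣ (∣𝒮₁∣ s₁)) }

  #⊇≤m : ∀ {U} → ∣ U ∣ ≡ t → #⊇ 𝒮₁? U ≤ m
  #⊇≤m {U} ∣U∣ = ≤-trans (branches 𝒮₁? {t} {k ∸ t} 1 {t} {1} ∣U∣
    (λ { V lo hi (A , sA , V⊆A) →
      let (B , tB , lt) = Half.minimal left {A} {V} (proj₁ sA) V⊆A (subst (∣ V ∣ <_) (sym (proj₂ sA)) hi)
      in B , (λ A′ sA′ → cross (proj₁ sA′) tB) , lt , ≤-trans (Half.upper right tB) (m≤n+m∸n k t) })
    (λ V ∣V∣ → #⊇full≤1 (trans ∣V∣ (+-comm t 1))))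
    (≤-reflexive (trans (*-identityʳ _) (*-identityʳ m)))

  #𝒮₁≤[t+1]m : ∀ {B} → 𝒯₁ B → # 𝒮₁? ≤ (t + 1) * m
  #𝒮₁≤[t+1]m {B} tB = ≤-trans (branchFrom 𝒮₁? {W = B} (λ A sA → meets sA tB) λ U → #⊇≤m)
    (≤-reflexive (cong (_* m) (trans (cong (_C t) (proj₂ tB)) (trans ([t+d]Ct≡[t+d]Cd t 1) (nC1≡n (t + 1))))))

  -- With R = B₁ ∩ B₂, counting inside `A` gives 2t ≤ |A ∩ B₁| + |A ∩ B₂| ≤ (t + 1) + |A ∩ R|. So R,
  -- which has fewer than t points, has exactly t - 1, and all of them are in `A`.
  far-core : ∀ {B₁ B₂ A} → 𝒯₁ B₁ → 𝒯₁ B₂ → ∣ B₁ ∩ B₂ ∣ < t → 𝒮₁ A → (B₁ ∩ B₂ ⊆ A) × suc ∣ B₁ ∩ B₂ ∣ ≡ t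
  far-core {B₁} {B₂} {A} t₁ t₂ far sA =
    (λ x∈ → p∩q⊆p A R (subst (_ ∈_) (sym (⊆∧∣∣≤⇒≡ (p∩q⊆q A R) (≤-pred (≤-trans far big)))) x∈)) ,
    ≤-antisym far (≤-trans big (s≤s (∣p∩q∣≤∣q∣ A R)))
    where
    R = B₁ ∩ B₂
    big : t ≤ suc ∣ A ∩ R ∣
    big = +-cancelˡ-≤ t _ _ (begin
      t + t                                   ≤⟨ +-mono-≤ (meets sA t₁) (meets sA t₂) ⟩
      ∣ A ∩ B₁ ∣ + ∣ A ∩ B₂ ∣                 ≡⟨ sym (∣p∪q∣+∣p∩q∣≡∣p∣+∣q∣ (A ∩ B₁) (A ∩ B₂)) ⟩
      ∣ (A ∩ B₁) ∪ (A ∩ B₂) ∣ + ∣ (A ∩ B₁) ∩ (A ∩ B₂) ∣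
        ≤⟨ +-mono-≤ (p⊆q⇒∣p∣≤∣q∣ (∪-least (p∩q⊆p A B₁) (p∩q⊆p A B₂))) (p⊆q⇒∣p∣≤∣q∣ sub) ⟩
      ∣ A ∣ + ∣ A ∩ R ∣                       ≡⟨ cong (_+ ∣ A ∩ R ∣) (∣𝒮₁∣ sA) ⟩
      suc t + ∣ A ∩ R ∣                       ≡⟨ sym (+-suc t _) ⟩
      t + suc ∣ A ∩ R ∣ ∎)
      where
      open ≤-Reasoning
      sub : (A ∩ B₁) ∩ (A ∩ B₂) ⊆ A ∩ R
      sub x∈ with x∈p∩q⁻ (A ∩ B₁) (A ∩ B₂) x∈
      ... | a , b = x∈p∩q⁺ (p∩q⊆p A B₁ a , x∈p∩q⁺ (p∩q⊆q A B₁ a , p∩q⊆q A B₂ b))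

  -- Members arise from R by adding two points. A set with at most t points that met both `B₁` and
  -- `B₂` in t points would lie in R, which is too small. So one of the two blocks it and leaves two
  -- choices at each of the two steps.
  far⇒#𝒮₁≤4 : ∀ {B₁ B₂} → 𝒯₁ B₁ → 𝒯₁ B₂ → ∣ B₁ ∩ B₂ ∣ < t → # 𝒮₁? ≤ 4
  far⇒#𝒮₁≤4 {B₁} {B₂} t₁ t₂ far with anySubset? 𝒮₁?
  ... | no ∄ = ≤-trans (≤-reflexive (#-none 𝒮₁? λ A sA → ∄ (A , sA))) z≤n
  ... | yes (A₀ , s₀) = ≤-trans (#-mono 𝒮₁? (above? 𝒮₁? R) λ A sA → sA , proj₁ (far-core t₁ t₂ far sA))
      (branches 𝒮₁? {t} {1} 2 {∣ R ∣} {1} refl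
        (λ V lo hi _ → miss V (≤-pred (subst (∣ V ∣ <_) ∣R∣+2 hi)))
        (λ V ∣V∣ → #⊇full≤1 (trans ∣V∣ ∣R∣+2)))
    where
    R = B₁ ∩ B₂
    ∣R∣+2 : ∣ R ∣ + 2 ≡ suc t
    ∣R∣+2 = trans (+-comm ∣ R ∣ 2) (cong suc (proj₂ (far-core t₁ t₂ far s₀)))
    miss : ∀ V → ∣ V ∣ ≤ t → ∃[ B ] ((∀ A → 𝒮₁ A → t ≤ ∣ A ∩ B ∣) × ∣ V ∩ B ∣ < t × ∣ B ∣ ≤ t + 1)
    miss V V≤t with ∣ V ∩ B₁ ∣ <? t | ∣ V ∩ B₂ ∣ <? t
    ... | yes lt | _ = B₁ , (λ A sA → meets sA t₁) , lt , ≤-reflexive (proj₂ t₁)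
    ... | no _ | yes lt = B₂ , (λ A sA → meets sA t₂) , lt , ≤-reflexive (proj₂ t₂)
    ... | no ge₁ | no ge₂ = contradiction (≤-trans (≮⇒≥ ge₁) (≤-trans (∣p∩q∣≤∣p∣ V B₁) (p⊆q⇒∣p∣≤∣q∣ (∩-greatest (into ge₁) (into ge₂))))) (<⇒≱ far)
      where
      into : ∀ {B} → ¬ (∣ V ∩ B ∣ < t) → V ⊆ B
      into {B} ge x∈ = p∩q⊆q V B (subst (_ ∈_) (sym (⊆∧∣∣≤⇒≡ (p∩q⊆p V B) (≤-trans V≤t (≮⇒≥ ge)))) x∈)

  -- At most m members contain X = B₁ ∩ B₂. One that misses x ∈ X contains `B₁ - x` and `B₂ - x`,
  -- hence equals `(B₁ ∪ B₂) - x`; there are at most t of these.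
  adjacent⇒#𝒮₁≤m+t : ∀ {B₁ B₂} → 𝒯₁ B₁ → 𝒯₁ B₂ → ∣ B₁ ∩ B₂ ∣ ≡ t → # 𝒮₁? ≤ m + t
  adjacent⇒#𝒮₁≤m+t {B₁} {B₂} t₁ t₂ adj = ≤-trans
    (#-⊎ 𝒮₁? (above? 𝒮₁? X) (λ A → 𝒮₁? A ×-dec ¬? (X ⊆? A)) λ A sA → case X ⊆? A of λ { (yes p) → inj₁ (sA , λ {x} → p {x}) ; (no p) → inj₂ (sA , p) })
    (+-mono-≤ (#⊇≤m adj) (≤-trans
      (#-⋃-≤ (λ A → 𝒮₁? A ×-dec ¬? (X ⊆? A)) (λ x A → 𝒮₁? A ×-dec (¬? (x ∈? A) ×-dec (x ∈? X))) (elements X)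
        (λ { A (sA , ¬sub) → let (x , x∈X , x∉A) = ⊈⇒∃ X A ¬sub in lose (∈-elements x∈X) (sA , x∉A , x∈X) })
        (λ x → #-unique (λ A → 𝒮₁? A ×-dec (¬? (x ∈? A) ×-dec (x ∈? X))) ((B₁ ∪ B₂) - x) (λ { A (sA , x∉A , x∈X) → sym (determined sA x∉A x∈X) })))
      (≤-reflexive (trans (*-identityʳ _) (trans (length-elements X) adj)))))
    where
    X = B₁ ∩ B₂
    ∣∪∣ : ∣ B₁ ∪ B₂ ∣ ≡ suc (suc t)
    ∣∪∣ = +-cancelʳ-≡ t _ _ (trans (cong (∣ B₁ ∪ B₂ ∣ +_) (sym adj)) (trans (∣p∪q∣+∣p∩q∣≡∣p∣+∣q∣ B₁ B₂)
      (trans (cong₂ _+_ (∣𝒯₁∣ t₁) (∣𝒯₁∣ t₂)) (+-suc (suc t) t))))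
    determined : ∀ {A x} → 𝒮₁ A → x ∉ A → x ∈ X → (B₁ ∪ B₂) - x ≡ A
    determined {A} {x} sA x∉A x∈X = ⊆∧∣∣≡⇒≡
      (∪-minus-⊆ {A = B₁} {B₂} (missOne (∣𝒯₁∣ t₁) (subst (t ≤_) (∣∩∣-comm A B₁) (meets sA t₁)) (p∩q⊆p B₁ B₂ x∈X) x∉A)
                               (missOne (∣𝒯₁∣ t₂) (subst (t ≤_) (∣∩∣-comm A B₂) (meets sA t₂)) (p∩q⊆q B₁ B₂ x∈X) x∉A))
      (suc-injective (trans (x∈p⇒suc∣p-x∣≡∣p∣ (B₁ ∪ B₂) (p⊆p∪q B₂ (p∩q⊆p B₁ B₂ x∈X))) ∣∪∣)) (∣𝒮₁∣ sA)

  two⇒#𝒮₁≤m+t : ∀ {B₁ B₂} → 2 ≤ t → t + 2 ≤ k → 𝒯₁ B₁ → 𝒯₁ B₂ → B₁ ≢ B₂ → # 𝒮₁? ≤ m + t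
  two⇒#𝒮₁≤m+t {B₁} {B₂} 2≤t t+2≤k t₁ t₂ ne with ∣ B₁ ∩ B₂ ∣ ≟ t
  ... | yes adj = adjacent⇒#𝒮₁≤m+t t₁ t₂ adj
  ... | no ¬adj = ≤-trans (far⇒#𝒮₁≤4 t₁ t₂ (≤∧≢⇒< (distinct⇒∣∩∣≤ (∣𝒯₁∣ t₁) (∣𝒯₁∣ t₂) ne) ¬adj))
      (+-mono-≤ {2} {m} {2} {t} (≤-trans (m+n≤o⇒m≤o∸n 2 (≤-trans (≤-reflexive (+-comm 2 t)) t+2≤k)) (n≤1+n _)) 2≤t)

  private
    Through : Fin n → Fin n → Pred (Subset n) 0ℓ
    Through p q A = 𝒮₁ A × p ∈ A × q ∈ A

    through? : ∀ p q → Decidable (Through p q)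
    through? p q A = 𝒮₁? A ×-dec (p ∈? A) ×-dec (q ∈? A)

  -- Here |B₁ ∩ B₂| = t − 1, and the members of 𝒮₁ are among the four sets
  -- (B₁ ∩ B₂) ∪ {p, q} with p ∈ B₁ ─ B₂, q ∈ B₂ ─ B₁; B₃ excludes one of them.
  far⇒#𝒮₁≤3 : ∀ {B₁ B₂ B₃} → 𝒯₁ B₁ → 𝒯₁ B₂ → 𝒯₁ B₃ → B₁ ≢ B₃ → B₂ ≢ B₃ → ∣ B₁ ∩ B₂ ∣ < t → # 𝒮₁? ≤ 3
  far⇒#𝒮₁≤3 {B₁} {B₂} {B₃} t₁ t₂ t₃ ne₁ ne₂ far with anySubset? 𝒮₁?
  ... | no ∄ = ≤-trans (≤-reflexive (#-none 𝒮₁? λ A sA → ∄ (A , sA))) z≤n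
  ... | yes (A₀ , s₀) = go (∣P∣≡2⇒pair (B₁ ─ B₂) (diff B₁ B₂ (∣𝒯₁∣ t₁) ∣R∣+1))
                           (∣P∣≡2⇒pair (B₂ ─ B₁) (diff B₂ B₁ (∣𝒯₁∣ t₂) (trans (cong suc (∣∩∣-comm B₂ B₁)) ∣R∣+1)))
    where
    R = B₁ ∩ B₂
    ∣R∣+1 : suc ∣ R ∣ ≡ t
    ∣R∣+1 = proj₂ (far-core t₁ t₂ far s₀)
    R⊆ : ∀ {A} → 𝒮₁ A → R ⊆ A
    R⊆ sA = proj₁ (far-core t₁ t₂ far sA)
    diff : ∀ B B′ → ∣ B ∣ ≡ suc t → suc ∣ B ∩ B′ ∣ ≡ t → ∣ B ─ B′ ∣ ≡ 2
    diff B B′ ∣B∣ e = +-cancelˡ-≡ ∣ B ∩ B′ ∣ _ _ (trans (∣p∩q∣+∣p─q∣≡∣p∣ B B′) (trans ∣B∣ (trans (cong suc (sym e)) (+-comm 2 _))))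
    hits : ∀ {A B B′} → B ∩ B′ ≡ R → t ≤ ∣ A ∩ B ∣ → ∃[ x ] (x ∈ B ─ B′ × x ∈ A)
    hits {A} {B} {B′} eq le with ∣p∣<∣q∣⇒∃ (B ∩ B′) (A ∩ B) (≤-trans (≤-reflexive (trans (cong (suc ∘ ∣_∣) eq) ∣R∣+1)) le)
    ... | x , x∈ , x∉ = x , x∈p∧x∉q⇒x∈p─q (p∩q⊆q A B x∈) (λ x∈B′ → x∉ (x∈p∩q⁺ (p∩q⊆q A B x∈ , x∈B′))) , p∩q⊆p A B x∈
    #through≤1 : ∀ {p q} → p ∈ B₁ ─ B₂ → q ∈ B₂ ─ B₁ → # (through? p q) ≤ 1
    #through≤1 {p} {q} p∈ q∈ = #-unique (through? p q) V λ { A (sA , p∈A , q∈A) →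
        sym (⊆∧∣∣≡⇒≡ (∪-least (∪-least (R⊆ sA) (⁅x⁆⊆ p∈A)) (⁅x⁆⊆ q∈A)) ∣V∣ (∣𝒮₁∣ sA)) }
      where
      V = (R ∪ ⁅ p ⁆) ∪ ⁅ q ⁆
      p∉R : p ∉ R
      p∉R = proj₂ (∈─⁻ B₁ B₂ p∈) ∘ p∩q⊆q B₁ B₂
      q∉B₁ : q ∉ B₁
      q∉B₁ = proj₂ (∈─⁻ B₂ B₁ q∈)
      ∣V∣ : ∣ V ∣ ≡ suc t
      ∣V∣ = trans (x∉p⇒∣p∪⁅x⁆∣≡ (R ∪ ⁅ p ⁆) (q∉B₁ ∘ ∪-least (p∩q⊆p B₁ B₂) (⁅x⁆⊆ (proj₁ (∈─⁻ B₁ B₂ p∈)))))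
              (cong suc (trans (x∉p⇒∣p∪⁅x⁆∣≡ R p∉R) ∣R∣+1))
    three-remain : ∀ {p p′ q q′} → p ∈ B₁ ─ B₂ → p′ ∈ B₁ ─ B₂ → (∀ x → x ∈ B₁ ─ B₂ → x ≡ p ⊎ x ≡ p′) →
      q ∈ B₂ ─ B₁ → q′ ∈ B₂ ─ B₁ → (∀ x → x ∈ B₂ ─ B₁ → x ≡ q ⊎ x ≡ q′) → ¬ (∃[ A ] Through p q A) → # 𝒮₁? ≤ 3
    three-remain {p} {p′} {q} {q′} p∈ p′∈ ps q∈ q′∈ qs ∄ = ≤-trans
      (#-⊎ 𝒮₁? (through? p q′) (λ A → through? p′ q A ⊎-dec through? p′ q′ A) split)
      (+-mono-≤ (#through≤1 p∈ q′∈) (≤-trans (#-⊎ (λ A → through? p′ q A ⊎-dec through? p′ q′ A) (through? p′ q) (through? p′ q′) (λ A x → x))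
        (+-mono-≤ (#through≤1 p′∈ q∈) (#through≤1 p′∈ q′∈))))
      where
      split : ∀ A → 𝒮₁ A → Through p q′ A ⊎ (Through p′ q A ⊎ Through p′ q′ A)
      split A sA with hits {A} refl (meets sA t₁) | hits {A} (∩-comm B₂ B₁) (meets sA t₂)
      ... | x , x∈ , x∈A | y , y∈ , y∈A with ps x x∈ | qs y y∈
      ... | inj₁ refl | inj₁ refl = contradiction (A , sA , x∈A , y∈A) ∄
      ... | inj₁ refl | inj₂ refl = inj₁ (sA , x∈A , y∈A)
      ... | inj₂ refl | inj₁ refl = inj₂ (inj₁ (sA , x∈A , y∈A))
      ... | inj₂ refl | inj₂ refl = inj₂ (inj₂ (sA , x∈A , y∈A))
    Pair : Subset n → Set
    Pair P = ∃[ p ] ∃[ p′ ] (p ∈ P × p′ ∈ P × (∀ x → x ∈ P → x ≡ p ⊎ x ≡ p′))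
    go : Pair (B₁ ─ B₂) → Pair (B₂ ─ B₁) → # 𝒮₁? ≤ 3
    go (p , p′ , p∈ , p′∈ , ps) (q , q′ , q∈ , q′∈ , qs)
      with anySubset? (through? p q) | anySubset? (through? p q′) | anySubset? (through? p′ q) | anySubset? (through? p′ q′)
    ... | no ∄ | _ | _ | _ = three-remain p∈ p′∈ ps q∈ q′∈ qs ∄
    ... | yes _ | no ∄ | _ | _ = three-remain p∈ p′∈ ps q′∈ q∈ (λ x x∈ → [ inj₂ , inj₁ ]′ (qs x x∈)) ∄
    ... | yes _ | yes _ | no ∄ | _ = three-remain p′∈ p∈ (λ x x∈ → [ inj₂ , inj₁ ]′ (ps x x∈)) q∈ q′∈ qs ∄
    ... | yes _ | yes _ | yes _ | no ∄ = three-remain p′∈ p∈ (λ x x∈ → [ inj₂ , inj₁ ]′ (ps x x∈)) q′∈ q∈ (λ x x∈ → [ inj₂ , inj₁ ]′ (qs x x∈)) ∄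
    ... | yes (A₁ , a₁) | yes (A₂ , a₂) | yes (A₃ , a₃) | yes (A₄ , a₄) = contradiction impossible λ ()
      where
      all : ∀ x y → x ∈ B₁ ─ B₂ → y ∈ B₂ ─ B₁ → ∃[ A ] Through x y A
      all x y x∈ y∈ with ps x x∈ | qs y y∈
      ... | inj₁ refl | inj₁ refl = A₁ , a₁
      ... | inj₁ refl | inj₂ refl = A₂ , a₂
      ... | inj₂ refl | inj₁ refl = A₃ , a₃
      ... | inj₂ refl | inj₂ refl = A₄ , a₄
      impossible : 1 ≤ 0
      impossible with R ⊆? B₃
      -- If `B₃` misses r ∈ R, all four members lie in `B₃` up to r. They exhaust B₁ ∪ B₂, which has
      -- t + 3 points, so `B₃` would have at least t + 2.
      ... | no R⊈ = contradiction (begin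
          suc (suc t)                ≡⟨ suc-injective (suc-injective (sym (trans (cong suc (x∈p⇒suc∣p-x∣≡∣p∣ (B₁ ∪ B₂) (p⊆p∪q B₂ (p∩q⊆p B₁ B₂ r∈))))
                                          (+-cancelʳ-≡ ∣ R ∣ _ _ (trans (cong suc (∣p∪q∣+∣p∩q∣≡∣p∣+∣q∣ B₁ B₂))
                                            (trans (cong suc (cong₂ _+_ (∣𝒯₁∣ t₁) (∣𝒯₁∣ t₂))) (trans (cong (λ z → suc (suc t + suc z)) (sym ∣R∣+1)) (e t ∣ R ∣)))))))) ⟩
          ∣ (B₁ ∪ B₂) - r ∣          ≤⟨ p⊆q⇒∣p∣≤∣q∣ (∪-minus-⊆ {A = B₁} {B₂}
                                          (λ {x} → into₁ {x}) (λ {x} → into₂ {x})) ⟩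
          ∣ B₃ ∣                     ≡⟨ ∣𝒯₁∣ t₃ ⟩
          suc t ∎) (<-irrefl refl)
        where
        open ≤-Reasoning
        e : ∀ t z → suc (suc t + suc (suc z)) ≡ suc (suc (suc (suc t))) + z
        e = solve-∀
        w = ⊈⇒∃ R B₃ R⊈
        r = proj₁ w
        r∈ : r ∈ R
        r∈ = proj₁ (proj₂ w)
        r∉ : r ∉ B₃
        r∉ = proj₂ (proj₂ w)
        via : ∀ {A x} → 𝒮₁ A → x ∈ A → x ≢ r → x ∈ B₃
        via sA x∈A x≢r = missOne (∣𝒮₁∣ sA) (meets sA t₃) (R⊆ sA r∈) r∉ (x∈p∧x≢y⇒x∈p-y x∈A x≢r)
        into₁ : B₁ - r ⊆ B₃
        into₁ {x} x∈ with ∈-⁻ B₁ x∈ | x ∈? B₂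
        ... | x∈B₁ , x≢r | yes x∈B₂ = via s₀ (R⊆ s₀ (x∈p∩q⁺ (x∈B₁ , x∈B₂))) x≢r
        ... | x∈B₁ , x≢r | no x∉B₂ = let (A , sA , x∈A , _) = all x q (x∈p∧x∉q⇒x∈p─q x∈B₁ x∉B₂) q∈ in via sA x∈A x≢r
        into₂ : B₂ - r ⊆ B₃
        into₂ {x} x∈ with ∈-⁻ B₂ x∈ | x ∈? B₁
        ... | x∈B₂ , x≢r | yes x∈B₁ = via s₀ (R⊆ s₀ (x∈p∩q⁺ (x∈B₁ , x∈B₂))) x≢r
        ... | x∈B₂ , x≢r | no x∉B₁ = let (A , sA , _ , x∈A) = all p x p∈ (x∈p∧x∉q⇒x∈p─q x∈B₂ x∉B₁) in via sA x∈A x≢r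
      -- Otherwise `B₁` and `B₂` have points x and y outside `B₃`, and the member through both of
      -- them misses `B₃` twice.
      ... | yes R⊆B₃ with ⊈⇒∃ B₁ B₃ (λ sub → ne₁ (⊆∧∣∣≡⇒≡ sub (∣𝒯₁∣ t₁) (∣𝒯₁∣ t₃))) | ⊈⇒∃ B₂ B₃ (λ sub → ne₂ (⊆∧∣∣≡⇒≡ sub (∣𝒯₁∣ t₂) (∣𝒯₁∣ t₃)))
      ...   | x , x∈B₁ , x∉ | y , y∈B₂ , y∉ with all x y
              (x∈p∧x∉q⇒x∈p─q x∈B₁ λ x∈B₂ → x∉ (R⊆B₃ (x∈p∩q⁺ (x∈B₁ , x∈B₂)))) (x∈p∧x∉q⇒x∈p─q y∈B₂ λ y∈B₁ → y∉ (R⊆B₃ (x∈p∩q⁺ (y∈B₁ , y∈B₂))))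
      ...     | A , sA , x∈A , y∈A = contradiction (missTwo (∣𝒮₁∣ sA) (meets sA t₃) x∈A y∈A
                (λ { refl → x∉ (R⊆B₃ (x∈p∩q⁺ (x∈B₁ , y∈B₂))) }) x∉) y∉

-- Classification of the first levels

module _ {n t : ℕ} where

  -- `far` keeps a third member, which lowers the bound on the opposite level from four to three.
  data Shape (P : Pred (Subset n) 0ℓ) : Set where
    star     : ∀ X → ∣ X ∣ ≡ t → Three (λ A → P A × X ⊆ A) → Shape P
    triangle : ∀ Z → ∣ Z ∣ ≡ suc (suc t) → Three (λ A → P A × A ⊆ Z) → Shape P
    far      : ∀ {A₁ A₂ A₃} → P A₁ → P A₂ → P A₃ → A₁ ≢ A₃ → A₂ ≢ A₃ → ∣ A₁ ∩ A₂ ∣ < t → Shape P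

  -- If all pairs meet in t points, either A₁ ∩ A₂ lies in A₃, or A₃ misses a point x of it; then A₃
  -- contains `A₁ - x` and `A₂ - x` and is `(A₁ ∪ A₂) - x`.
  shape : ∀ {P : Pred (Subset n) 0ℓ} → (∀ {A} → P A → ∣ A ∣ ≡ suc t) → Three P → Shape P
  shape size (three {A₁} {A₂} {A₃} p₁ p₂ p₃ ne₁₂ ne₁₃ ne₂₃)
    with ∣ A₁ ∩ A₂ ∣ ≟ t | ∣ A₁ ∩ A₃ ∣ ≟ t | ∣ A₂ ∩ A₃ ∣ ≟ t
  ... | no ¬e | _ | _ = far p₁ p₂ p₃ ne₁₃ ne₂₃ (≤∧≢⇒< (distinct⇒∣∩∣≤ (size p₁) (size p₂) ne₁₂) ¬e)
  ... | yes _ | no ¬e | _ = far p₁ p₃ p₂ ne₁₂ (ne₂₃ ∘ sym) (≤∧≢⇒< (distinct⇒∣∩∣≤ (size p₁) (size p₃) ne₁₃) ¬e)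
  ... | yes _ | yes _ | no ¬e = far p₂ p₃ p₁ (ne₁₂ ∘ sym) (ne₁₃ ∘ sym) (≤∧≢⇒< (distinct⇒∣∩∣≤ (size p₂) (size p₃) ne₂₃) ¬e)
  ... | yes e₁₂ | yes e₁₃ | yes e₂₃ with (A₁ ∩ A₂) ⊆? A₃
  ...   | yes X⊆ = star (A₁ ∩ A₂) e₁₂ (three (p₁ , λ {x} → p∩q⊆p A₁ A₂ {x}) (p₂ , λ {x} → p∩q⊆q A₁ A₂ {x}) (p₃ , λ {x} → X⊆ {x}) ne₁₂ ne₁₃ ne₂₃)
  ...   | no X⊈ with ⊈⇒∃ (A₁ ∩ A₂) A₃ X⊈
  ...     | x , x∈ , x∉ = triangle (A₁ ∪ A₂) ∣∪∣
              (three (p₁ , λ {y} → p⊆p∪q A₂ {y}) (p₂ , λ {y} → q⊆p∪q A₁ A₂ {y}) (p₃ , λ {y} → A₃⊆ {y}) ne₁₂ ne₁₃ ne₂₃)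
    where
    ∣∪∣ : ∣ A₁ ∪ A₂ ∣ ≡ suc (suc t)
    ∣∪∣ = +-cancelʳ-≡ t _ _ (trans (cong (∣ A₁ ∪ A₂ ∣ +_) (sym e₁₂)) (trans (∣p∪q∣+∣p∩q∣≡∣p∣+∣q∣ A₁ A₂)
      (trans (cong₂ _+_ (size p₁) (size p₂)) (+-suc (suc t) t))))
    eq : (A₁ ∪ A₂) - x ≡ A₃
    eq = ⊆∧∣∣≡⇒≡ (∪-minus-⊆ {A = A₁} {A₂} (missOne (size p₁) (≤-reflexive (sym e₁₃)) (p∩q⊆p A₁ A₂ x∈) x∉)
                                            (missOne (size p₂) (≤-reflexive (sym e₂₃)) (p∩q⊆q A₁ A₂ x∈) x∉))
      (suc-injective (trans (x∈p⇒suc∣p-x∣≡∣p∣ (A₁ ∪ A₂) (p⊆p∪q A₂ (p∩q⊆p A₁ A₂ x∈))) ∣∪∣)) (size p₃)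
    A₃⊆ : A₃ ⊆ A₁ ∪ A₂
    A₃⊆ y∈ = proj₁ (∈-⁻ (A₁ ∪ A₂) (subst (_ ∈_) (sym eq) y∈))

module _ {n k t : ℕ} {𝒮 𝒯 : Pred (Subset n) 0ℓ} (dual : Dual n k t 𝒮 𝒯) where
  private
    module S = FirstLevel dual
    module T = FirstLevel (swapDual dual)

  data Classified (M : ℕ) : Set where
    few  : Levels.#level dual 1 * Levels.#level (swapDual dual) 1 ≤ (t + 1) * M → Classified M
    star : ∀ X → ∣ X ∣ ≡ t → Three (λ A → S.𝒮₁ A × X ⊆ A) → Three (λ B → S.𝒯₁ B × X ⊆ B) → Classified M
    triangle : ∀ Z → ∣ Z ∣ ≡ suc (suc t) → Three (λ A → S.𝒮₁ A × A ⊆ Z) → Three (λ B → S.𝒯₁ B × B ⊆ Z) → Classified M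

  star-forced : Three S.𝒮₁ → ∀ {X} → ∣ X ∣ ≡ t → Three (λ B → S.𝒯₁ B × X ⊆ B) → Three (λ A → S.𝒮₁ A × X ⊆ A)
  star-forced three𝒮 {X} ∣X∣ bs = Three-map (λ {A} sA → sA , λ {x} → star-forces ∣X∣
    (Three-map (λ { {B} (tB , X⊆B) → (S.∣𝒯₁∣ tB , T.meets tB sA) , λ {x} → X⊆B {x} }) bs) (S.∣𝒮₁∣ sA) {x}) three𝒮

  triangle-forced : Three S.𝒮₁ → ∀ {Z} → ∣ Z ∣ ≡ suc (suc t) → Three (λ B → S.𝒯₁ B × B ⊆ Z) → Three (λ A → S.𝒮₁ A × A ⊆ Z)
  triangle-forced three𝒮 {Z} ∣Z∣ bs = Three-map (λ {A} sA → sA , λ {x} → inZ sA {x}) three𝒮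
    where
    inZ : ∀ {A} → S.𝒮₁ A → A ⊆ Z
    inZ {A} sA x∈ = p∩q⊆q A Z (subst (_ ∈_) (sym (⊆∧∣∣≤⇒≡ (p∩q⊆p A Z) (≤-trans (≤-reflexive (S.∣𝒮₁∣ sA))
      (triangle-forces ∣Z∣ (Three-map (λ { {B} (tB , B⊆Z) → (S.∣𝒯₁∣ tB , T.meets tB sA) , λ {x} → B⊆Z {x} }) bs))))) x∈)

module _ {n k t : ℕ} {𝒮 𝒯 : Pred (Subset n) 0ℓ} (dual : Dual n k t 𝒮 𝒯) (2≤t : 2 ≤ t) (t+2≤k : t + 2 ≤ k)
  {M : ℕ} (m≤M : suc (k ∸ t) ≤ M) (t+2≤M : t + 2 ≤ M) where
  private
    module S = FirstLevel dual
    module T = FirstLevel (swapDual dual)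
    s u m : ℕ
    s = # S.𝒮₁?
    u = # T.𝒮₁?
    m = suc (k ∸ t)
    open ≤-Reasoning

    2[m+t]≤ : 2 * (m + t) ≤ (t + 1) * M
    2[m+t]≤ with m≤n⇒∃[o]m+o≡n 2≤t
    ... | (e , refl) = begin
      2 * (m + (2 + e))                          ≡⟨ e₁ m e ⟩
      2 * m + (4 + 2 * e)                        ≤⟨ +-mono-≤ (*-monoʳ-≤ 2 m≤M) (≤-trans (m≤m+n (4 + 2 * e) (3 * e + e * e)) (≤-reflexive (e₂ e))) ⟩
      2 * M + (1 + e) * (2 + e + 2)              ≤⟨ +-monoʳ-≤ (2 * M) (*-monoʳ-≤ (1 + e) t+2≤M) ⟩
      2 * M + (1 + e) * M                        ≡⟨ e₃ e M ⟩
      (2 + e + 1) * M ∎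
      where
      e₁ : ∀ m e → 2 * (m + (2 + e)) ≡ 2 * m + (4 + 2 * e)
      e₁ = solve-∀
      e₂ : ∀ e → (4 + 2 * e) + (3 * e + e * e) ≡ (1 + e) * (2 + e + 2)
      e₂ = solve-∀
      e₃ : ∀ e M → 2 * M + (1 + e) * M ≡ (2 + e + 1) * M
      e₃ = solve-∀

    9≤ : 3 * 3 ≤ (t + 1) * M
    9≤ = *-mono-≤ (+-monoˡ-≤ 1 2≤t) (≤-trans (n≤1+n 3) (≤-trans (+-monoˡ-≤ 2 2≤t) t+2≤M))

    [t+1]m≤ : (t + 1) * m ≤ (t + 1) * M
    [t+1]m≤ = *-monoʳ-≤ (t + 1) m≤M

  -- By the size of the smaller level: one member allows (t + 1)m on the other side, two allow m +
  -- t. With three on both sides, a star or a triangle on one side forces the same on the other, and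
  -- far pairs on both sides leave at most 3 · 3. All these products are at most (t + 1)M since t ≥
  -- 2.
  classify : Classified dual M
  classify with s in eqs | u in equ
  ... | 0 | _ = few (subst (λ z → z * u ≤ (t + 1) * M) (sym eqs) z≤n)
  ... | suc _ | 0 = few (≤-trans (≤-reflexive (trans (cong (s *_) equ) (*-zeroʳ s))) z≤n)
  ... | 1 | suc _ = let (A , sA) = #≥1 S.𝒮₁? (≤-reflexive (sym eqs)) in
        few (≤-trans (≤-reflexive (trans (cong (_* u) eqs) (*-identityˡ u))) (≤-trans (T.#𝒮₁≤[t+1]m sA) [t+1]m≤))
  ... | suc (suc _) | 1 = let (B , tB) = #≥1 T.𝒮₁? (≤-reflexive (sym equ)) in
        few (≤-trans (≤-reflexive (trans (cong (s *_) equ) (*-identityʳ s))) (≤-trans (S.#𝒮₁≤[t+1]m tB) [t+1]m≤))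
  ... | 2 | suc (suc _) = let (A , A′ , sA , sA′ , ne) = #≥2 S.𝒮₁? (≤-reflexive (sym eqs)) in
        few (≤-trans (≤-reflexive (cong (_* u) eqs)) (≤-trans (*-monoʳ-≤ 2 (T.two⇒#𝒮₁≤m+t 2≤t t+2≤k sA sA′ ne)) 2[m+t]≤))
  ... | suc (suc (suc _)) | 2 = let (B , B′ , tB , tB′ , ne) = #≥2 T.𝒮₁? (≤-reflexive (sym equ)) in
        few (≤-trans (≤-reflexive (trans (cong (s *_) equ) (*-comm s 2))) (≤-trans (*-monoʳ-≤ 2 (S.two⇒#𝒮₁≤m+t 2≤t t+2≤k tB tB′ ne)) 2[m+t]≤))
  ... | suc (suc (suc _)) | suc (suc (suc _)) = both (#≥3 S.𝒮₁? (≤-trans (s≤s (s≤s (s≤s z≤n))) (≤-reflexive (sym eqs))))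
                                                     (#≥3 T.𝒮₁? (≤-trans (s≤s (s≤s (s≤s z≤n))) (≤-reflexive (sym equ))))
    where
    both : Three S.𝒮₁ → Three S.𝒯₁ → Classified dual M
    both as bs with shape S.∣𝒮₁∣ as | shape S.∣𝒯₁∣ bs
    ... | star X ∣X∣ as′ | _ = star X ∣X∣ as′ (star-forced (swapDual dual) bs ∣X∣ as′)
    ... | triangle Z ∣Z∣ as′ | _ = triangle Z ∣Z∣ as′ (triangle-forced (swapDual dual) bs ∣Z∣ as′)
    ... | far _ _ _ _ _ _ | star X ∣X∣ bs′ = star X ∣X∣ (star-forced dual as ∣X∣ bs′) bs′
    ... | far _ _ _ _ _ _ | triangle Z ∣Z∣ bs′ = triangle Z ∣Z∣ (triangle-forced dual as ∣Z∣ bs′) bs′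
    ... | far a₁ a₂ a₃ x y lt | far b₁ b₂ b₃ x′ y′ lt′ =
        few (≤-trans (*-mono-≤ (S.far⇒#𝒮₁≤3 b₁ b₂ b₃ x′ y′ lt′) (T.far⇒#𝒮₁≤3 a₁ a₂ a₃ x y lt)) 9≤)

module _ {n k t : ℕ} {𝒮 𝒯 : Pred (Subset n) 0ℓ} (dual : Dual n k t 𝒮 𝒯) where
  open Dual dual

  generated-meets : ∀ {F B} → ∃[ A ] (𝒮 A × A ⊆ F) → 𝒯 B → t ≤ ∣ F ∩ B ∣
  generated-meets {F} {B} (A , sA , A⊆F) tB = ≤-trans (cross sA tB) (∣∩∣-monoˡ B A⊆F)

  triangle⇒𝓐 : ∀ {Z} → ∣ Z ∣ ≡ suc (suc t) → Three (λ B → FirstLevel.𝒯₁ dual B × B ⊆ Z) →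
    (𝓕 : Family n) → Uniform k 𝓕 → Generates 𝒮 𝓕 → ∀ F → F ∈ᶠ 𝓕 → F ∈ᶠ 𝓐 k t Z
  triangle⇒𝓐 {Z} ∣Z∣ bs 𝓕 unif gen F F∈ = unif F F∈ , subst (_≤ ∣ F ∩ Z ∣) (+-comm 1 t) (triangle-forces ∣Z∣
    (Three-map (λ { {B} (tB , B⊆Z) →
      (FirstLevel.∣𝒯₁∣ dual tB , subst (t ≤_) (∣∩∣-comm F B) (generated-meets (gen F F∈) (proj₁ tB))) , λ {x} → B⊆Z {x} }) bs))

-- Extensions of a t-set

module Extensions {n k t : ℕ} {𝒮 𝒯 : Pred (Subset n) 0ℓ} (dual : Dual n k t 𝒮 𝒯) (X : Subset n) where
  open Dual dual

  private
    extends? : Decidable (λ x → x ∉ X × 𝒮 (X ∪ ⁅ x ⁆))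
    extends? x = ¬? (x ∈? X) ×-dec Half.dec left (X ∪ ⁅ x ⁆)

  extensions : Subset n
  extensions = comprehension extends?

  ∈-extensions⁺ : ∀ {x} → x ∉ X → 𝒮 (X ∪ ⁅ x ⁆) → x ∈ extensions
  ∈-extensions⁺ x∉ s = ∈-comprehension⁺ extends? (x∉ , s)

  ∈-extensions⁻ : ∀ {x} → x ∈ extensions → x ∉ X × 𝒮 (X ∪ ⁅ x ⁆)
  ∈-extensions⁻ = ∈-comprehension⁻ extends?

  three≤∣extensions∣ : ∣ X ∣ ≡ t → Three (λ A → FirstLevel.𝒮₁ dual A × X ⊆ A) → 3 ≤ ∣ extensions ∣
  three≤∣extensions∣ ∣X∣ (three {A₁} {A₂} {A₃} (s₁ , X₁) (s₂ , X₂) (s₃ , X₃) ne₁₂ ne₁₃ ne₂₃)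
    with extra s₁ X₁ | extra s₂ X₂ | extra s₃ X₃
    where
    extra : ∀ {A} → FirstLevel.𝒮₁ dual A → X ⊆ A → ∃[ x ] (x ∉ X × X ∪ ⁅ x ⁆ ≡ A)
    extra {A} s X⊆A with ∣p∣<∣q∣⇒∃ X A (≤-reflexive (trans (cong suc ∣X∣) (sym (FirstLevel.∣𝒮₁∣ dual s))))
    ... | x , x∈A , x∉X = x , x∉X , ⊆∧∣∣≡⇒≡ (∪-least X⊆A (⁅x⁆⊆ x∈A)) (trans (x∉p⇒∣p∪⁅x⁆∣≡ X x∉X) (cong suc ∣X∣)) (FirstLevel.∣𝒮₁∣ dual s)
  ... | x , x∉ , refl | y , y∉ , refl | z , z∉ , refl = begin
    3                                ≡⟨ cong suc (sym (trans (x∉p⇒∣p∪⁅x⁆∣≡ ⁅ x ⁆ λ y∈ → ne₁₂ (cong (λ w → X ∪ ⁅ w ⁆) (sym (x∈⁅y⁆⇒x≡y x y∈)))) (cong suc (∣⁅x⁆∣≡1 x)))) ⟩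
    suc ∣ ⁅ x ⁆ ∪ ⁅ y ⁆ ∣            ≡⟨ sym (x∉p⇒∣p∪⁅x⁆∣≡ (⁅ x ⁆ ∪ ⁅ y ⁆) λ z∈ → [ (λ e → ne₁₃ (cong (λ w → X ∪ ⁅ w ⁆) (sym (x∈⁅y⁆⇒x≡y x e))))
                                                                                  , (λ e → ne₂₃ (cong (λ w → X ∪ ⁅ w ⁆) (sym (x∈⁅y⁆⇒x≡y y e)))) ]′ (x∈p∪q⁻ ⁅ x ⁆ ⁅ y ⁆ z∈)) ⟩
    ∣ (⁅ x ⁆ ∪ ⁅ y ⁆) ∪ ⁅ z ⁆ ∣      ≤⟨ p⊆q⇒∣p∣≤∣q∣ (∪-least (∪-least (⁅x⁆⊆ (∈-extensions⁺ x∉ (proj₁ s₁))) (⁅x⁆⊆ (∈-extensions⁺ y∉ (proj₁ s₂)))) (⁅x⁆⊆ (∈-extensions⁺ z∉ (proj₁ s₃)))) ⟩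
    ∣ extensions ∣ ∎
    where open ≤-Reasoning

module Star {n k t : ℕ} {𝒮 𝒯 : Pred (Subset n) 0ℓ} (dual : Dual n k t 𝒮 𝒯) (t+2≤k : t + 2 ≤ k) {X : Subset n} (∣X∣ : ∣ X ∣ ≡ t) where
  open Dual dual
  open Extensions dual X using () renaming (extensions to A; ∈-extensions⁺ to ∈A⁺; ∈-extensions⁻ to ∈A⁻)
  open Extensions (swapDual dual) X using () renaming (extensions to B; ∈-extensions⁻ to ∈B⁻)

  private
    m D₂ : ℕ
    m = suc (k ∸ t)
    D₂ = (n ∸ (t + 2)) C (k ∸ (t + 2))
    t≤k : t ≤ k
    t≤k = ≤-trans (m≤m+n t 2) t+2≤k

    -- A t-set covering `𝒯` would contain a member of `𝒮`, which has more than t points.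
    blocker : ∃[ T ] (𝒯 T × ∣ X ∩ T ∣ < t)
    blocker = ¬cov⇒witness (Half.dec right) X λ c →
      let (S , sS , S⊆X) = Half.contains left {X} (subst (_≤ k) (sym ∣X∣) t≤k) c in
      <⇒≱ (Half.lower left sS) (≤-trans (p⊆q⇒∣p∣≤∣q∣ S⊆X) (≤-reflexive ∣X∣))
    T₀ = proj₁ blocker
    t₀ : 𝒯 T₀
    t₀ = proj₁ (proj₂ blocker)
    X∩T₀< : ∣ X ∩ T₀ ∣ < t
    X∩T₀< = proj₂ (proj₂ blocker)

    -- `X ∪ ⁅ a ⁆` meets `T₀` in t points while `X` does not, so the point a makes the difference.
    A⊆T₀ : A ⊆ T₀
    A⊆T₀ {a} a∈ with a ∈? T₀
    ... | yes a∈T₀ = a∈T₀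
    ... | no a∉T₀ = contradiction (≤-trans (cross (proj₂ (∈A⁻ a∈)) t₀) (p⊆q⇒∣p∣≤∣q∣ sub)) (<⇒≱ X∩T₀<)
      where
      sub : (X ∪ ⁅ a ⁆) ∩ T₀ ⊆ X ∩ T₀
      sub y∈ with x∈p∩q⁻ (X ∪ ⁅ a ⁆) T₀ y∈
      ... | y∈∪ , y∈T₀ with x∈p∪q⁻ X ⁅ a ⁆ y∈∪
      ...   | inj₁ y∈X = x∈p∩q⁺ (y∈X , y∈T₀)
      ...   | inj₂ y∈a = contradiction (subst (_∈ T₀) (x∈⁅y⁆⇒x≡y a y∈a) y∈T₀) a∉T₀

    A⊆T₀─X : A ⊆ T₀ ─ X
    A⊆T₀─X a∈ = x∈p∧x∉q⇒x∈p─q (A⊆T₀ a∈) (proj₁ (∈A⁻ a∈))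

    -- For the same reason one extension shows that `X` meets `T₀` in at least t - 1 points, which
    -- leaves at most k - (t - 1) points of `T₀` outside `X`.
    ∣T₀─X∣≤m : 1 ≤ ∣ A ∣ → ∣ T₀ ─ X ∣ ≤ m
    ∣T₀─X∣≤m A>0 = +-cancelˡ-≤ ∣ T₀ ∩ X ∣ _ _ (begin
      ∣ T₀ ∩ X ∣ + ∣ T₀ ─ X ∣   ≡⟨ ∣p∩q∣+∣p─q∣≡∣p∣ T₀ X ⟩
      ∣ T₀ ∣                    ≤⟨ Half.upper right t₀ ⟩
      k                         ≡⟨ sym (m+[n∸m]≡n t≤k) ⟩
      t + (k ∸ t)               ≤⟨ +-monoˡ-≤ (k ∸ t) t≤ ⟩
      suc ∣ T₀ ∩ X ∣ + (k ∸ t)  ≡⟨ sym (+-suc ∣ T₀ ∩ X ∣ (k ∸ t)) ⟩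
      ∣ T₀ ∩ X ∣ + m ∎)
      where
      open ≤-Reasoning
      a₀ = ∣p∣<∣q∣⇒∃ ∅ A (subst (_< ∣ A ∣) (sym (∣⊥∣≡0 n)) A>0)
      a = proj₁ a₀
      sub : T₀ ∩ (X ∪ ⁅ a ⁆) ⊆ (T₀ ∩ X) ∪ ⁅ a ⁆
      sub y∈ with x∈p∩q⁻ T₀ (X ∪ ⁅ a ⁆) y∈
      ... | y∈T₀ , y∈∪ with x∈p∪q⁻ X ⁅ a ⁆ y∈∪
      ...   | inj₁ y∈X = x∈p∪q⁺ (inj₁ (x∈p∩q⁺ (y∈T₀ , y∈X)))
      ...   | inj₂ y∈a = x∈p∪q⁺ (inj₂ y∈a)
      t≤ : t ≤ suc ∣ T₀ ∩ X ∣
      t≤ = begin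
        t                              ≤⟨ subst (t ≤_) (∣∩∣-comm (X ∪ ⁅ a ⁆) T₀) (cross (proj₂ (∈A⁻ (proj₁ (proj₂ a₀)))) t₀) ⟩
        ∣ T₀ ∩ (X ∪ ⁅ a ⁆) ∣           ≤⟨ p⊆q⇒∣p∣≤∣q∣ sub ⟩
        ∣ (T₀ ∩ X) ∪ ⁅ a ⁆ ∣           ≤⟨ m≤m+n _ ∣ (T₀ ∩ X) ∩ ⁅ a ⁆ ∣ ⟩
        ∣ (T₀ ∩ X) ∪ ⁅ a ⁆ ∣ + ∣ (T₀ ∩ X) ∩ ⁅ a ⁆ ∣  ≡⟨ ∣p∪q∣+∣p∩q∣≡∣p∣+∣q∣ (T₀ ∩ X) ⁅ a ⁆ ⟩
        ∣ T₀ ∩ X ∣ + ∣ ⁅ a ⁆ ∣          ≡⟨ trans (cong (∣ T₀ ∩ X ∣ +_) (∣⁅x⁆∣≡1 a)) (+-comm _ 1) ⟩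
        suc ∣ T₀ ∩ X ∣ ∎

  ∣A∣≤m : ∣ A ∣ ≤ m
  ∣A∣≤m with 1 ≤? ∣ A ∣
  ... | yes A>0 = ≤-trans (p⊆q⇒∣p∣≤∣q∣ A⊆T₀─X) (∣T₀─X∣≤m A>0)
  ... | no A≯0 = ≤-trans (≤-pred (≰⇒> A≯0)) z≤n

  disjoint : ∀ {x} → x ∈ X → x ∉ A
  disjoint x∈X x∈A = proj₁ (∈A⁻ x∈A) x∈X

  module _ (𝓕 : Family n) (unif : Uniform k 𝓕) (gen : ∀ F → F ∈ᶠ 𝓕 → ∃[ S ] (𝒮 S × S ⊆ F)) where

    private
      outer : ∀ {F} → F ∈ᶠ 𝓕 → X ⊆ F → ∃[ x ] (x ∈ F × x ∈ T₀ ─ X)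
      outer {F} F∈ X⊆F with ∣p∣<∣q∣⇒∃ (X ∩ T₀) (F ∩ T₀) (<-≤-trans X∩T₀< (generated-meets dual (gen F F∈) t₀))
      ... | x , x∈ , x∉ = x , p∩q⊆p F T₀ x∈ , x∈p∧x∉q⇒x∈p─q (p∩q⊆q F T₀ x∈) λ x∈X → x∉ (x∈p∩q⁺ (x∈X , p∩q⊆q F T₀ x∈))

      missing : ∀ {F x} → F ∈ᶠ 𝓕 → x ∈ X → x ∉ F → B ≢ ∅ → (X ∪ B) - x ⊆ F
      missing {F} {x} F∈ x∈X x∉F B≢∅ {y} y∈ with ∈-⁻ (X ∪ B) y∈
      ... | y∈∪ , y≢x = go (x∈p∪q⁻ X B y∈∪)
        where
        via : ∀ {b} → b ∈ B → y ∈ X ∪ ⁅ b ⁆ → y ∈ F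
        via {b} b∈ y∈b = missOne (trans (x∉p⇒∣p∪⁅x⁆∣≡ X (proj₁ (∈B⁻ b∈))) (cong suc ∣X∣))
          (subst (t ≤_) (∣∩∣-comm F (X ∪ ⁅ b ⁆)) (generated-meets dual (gen F F∈) (proj₂ (∈B⁻ b∈))))
          (p⊆p∪q ⁅ b ⁆ x∈X) x∉F (x∈p∧x≢y⇒x∈p-y y∈b y≢x)
        go : y ∈ X ⊎ y ∈ B → y ∈ F
        go (inj₂ y∈B) = via y∈B (q⊆p∪q X ⁅ y ⁆ (x∈⁅x⁆ y))
        go (inj₁ y∈X) with nonempty? B
        ... | yes (b , b∈) = via b∈ (p⊆p∪q ⁅ b ⁆ y∈X)
        ... | no empty = contradiction (Empty-unique empty) B≢∅

      B≢∅ : 1 ≤ ∣ B ∣ → B ≢ ∅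
      B≢∅ le e = contradiction (subst (1 ≤_) (trans (cong ∣_∣ e) (∣⊥∣≡0 n)) le) λ ()

      ∣X∪B-x∣ : ∀ {x} → x ∈ X → suc ∣ (X ∪ B) - x ∣ ≡ t + ∣ B ∣
      ∣X∪B-x∣ x∈X = trans (x∈p⇒suc∣p-x∣≡∣p∣ (X ∪ B) (p⊆p∪q B x∈X))
        (trans (disjoint⇒∣∪∣≡ X B (λ y∈X y∈B → proj₁ (∈B⁻ y∈B) y∈X)) (cong (_+ ∣ B ∣) ∣X∣))

      #⊇≤D₂ : ∀ V → t + 2 ≤ ∣ V ∣ → #⊇ (mem? 𝓕) V ≤ D₂
      #⊇≤D₂ V le with subsetOfSize V le
      ... | V′ , V′⊆V , ∣V′∣ = ≤-trans
        (#-mono (above? (mem? 𝓕) V) (containing? V′ k) λ F (F∈ , V⊆F) → unif F F∈ , λ x∈ → V⊆F (V′⊆V x∈))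
        (≤-reflexive (trans (#-containing V′ (subst (_≤ k) (sym ∣V′∣) t+2≤k)) (cong (λ z → (n ∸ z) C (k ∸ z)) ∣V′∣)))

    -- Members through `X` that meet `A` are counted exactly. Those through `X` avoiding `A` contain
    -- one of at most m - |A| points of `T₀` outside X ∪ A; `X` with that point is not in `𝒮`, so it
    -- is blocked and one of m further points follows. Those missing some x ∈ X contain
    -- `(X ∪ B) - x`, which has at least t + 2 points because |B| ≥ 3.
    size≤ : 1 ≤ ∣ A ∣ → 3 ≤ ∣ B ∣ → size 𝓕 ≤ # (hitting? X A k) + ((m ∸ ∣ A ∣) * (m * D₂) + t * D₂)
    size≤ A>0 B≥3 = ≤-trans
      (#-⊎ (mem? 𝓕) (hitting? X A k) (λ F → avoids? F ⊎-dec omits? F) split)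
      (+-monoʳ-≤ (# (hitting? X A k)) (≤-trans (#-⊎ (λ F → avoids? F ⊎-dec omits? F) avoids? omits? λ F x → x) (+-mono-≤ #avoids #omits)))
      where
      avoids? : Decidable (λ F → (F ∈ᶠ 𝓕 × X ⊆ F) × Empty (F ∩ A))
      avoids? F = above? (mem? 𝓕) X F ×-dec ¬? (nonempty? (F ∩ A))
      omits? : Decidable (λ F → F ∈ᶠ 𝓕 × ¬ X ⊆ F)
      omits? F = mem? 𝓕 F ×-dec ¬? (X ⊆? F)
      split : ∀ F → F ∈ᶠ 𝓕 → Hitting X A k F ⊎ (((F ∈ᶠ 𝓕 × X ⊆ F) × Empty (F ∩ A)) ⊎ (F ∈ᶠ 𝓕 × ¬ X ⊆ F))
      split F F∈ with X ⊆? F | nonempty? (F ∩ A)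
      ... | no X⊈F | _ = inj₂ (inj₂ (F∈ , X⊈F))
      ... | yes X⊆F | yes ne = inj₁ (unif F F∈ , (λ {x} → X⊆F {x}) , ne)
      ... | yes X⊆F | no empty = inj₂ (inj₁ ((F∈ , λ {x} → X⊆F {x}) , empty))

      P = (T₀ ─ X) ─ A
      ∣P∣≤ : ∣ P ∣ ≤ m ∸ ∣ A ∣
      ∣P∣≤ = ≤-trans (≤-reflexive (sym (m+n∸m≡n ∣ A ∣ ∣ P ∣))) (∸-monoˡ-≤ ∣ A ∣ (≤-trans (≤-reflexive (trans
        (cong (λ z → ∣ z ∣ + ∣ P ∣) (⊆-antisym (∩-greatest A⊆T₀─X id) (p∩q⊆q (T₀ ─ X) A))) (∣p∩q∣+∣p─q∣≡∣p∣ (T₀ ─ X) A))) (∣T₀─X∣≤m A>0)))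
      step? : ∀ x → Decidable (λ F → (F ∈ᶠ 𝓕 × (X ∪ ⁅ x ⁆) ⊆ F) × x ∈ P)
      step? x F = above? (mem? 𝓕) (X ∪ ⁅ x ⁆) F ×-dec (x ∈? P)
      #step : ∀ x → # (step? x) ≤ m * D₂
      #step x with x ∈? P
      ... | no x∉P = ≤-trans (≤-reflexive (#-none (λ F → above? (mem? 𝓕) (X ∪ ⁅ x ⁆) F ×-dec no x∉P) λ { F (_ , x∈P) → x∉P x∈P })) z≤n
      ... | yes x∈P = ≤-trans (#-mono (λ F → above? (mem? 𝓕) (X ∪ ⁅ x ⁆) F ×-dec yes x∈P) (above? (mem? 𝓕) (X ∪ ⁅ x ⁆)) λ F → proj₁)
          (branch (mem? 𝓕) {t} {k ∸ t} (λ F F∈ → generated-meets dual (gen F F∈) (proj₁ (proj₂ blocker′))) (proj₂ (proj₂ blocker′))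
            (≤-trans (Half.upper right (proj₁ (proj₂ blocker′))) (m≤n+m∸n k t))
            λ y y∉ → #⊇≤D₂ ((X ∪ ⁅ x ⁆) ∪ ⁅ y ⁆) (≤-reflexive (sym (trans (x∉p⇒∣p∪⁅x⁆∣≡ (X ∪ ⁅ x ⁆) y∉) (trans (cong suc ∣X∪x∣) (+-comm 2 t))))))
        where
        x∉X : x ∉ X
        x∉X = proj₂ (∈─⁻ T₀ X (proj₁ (∈─⁻ (T₀ ─ X) A x∈P)))
        ∣X∪x∣ : ∣ X ∪ ⁅ x ⁆ ∣ ≡ suc t
        ∣X∪x∣ = trans (x∉p⇒∣p∪⁅x⁆∣≡ X x∉X) (cong suc ∣X∣)
        blocker′ : ∃[ T ] (𝒯 T × ∣ (X ∪ ⁅ x ⁆) ∩ T ∣ < t)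
        -- Were `X ∪ ⁅ x ⁆` a cover, the member of `𝒮` inside it would have t + 1 points and be the
        -- whole set, so x would belong to `A`.
        blocker′ = ¬cov⇒witness (Half.dec right) (X ∪ ⁅ x ⁆) λ c →
          let (S , sS , S⊆) = Half.contains left {X ∪ ⁅ x ⁆} (≤-trans (≤-reflexive (trans ∣X∪x∣ (+-comm 1 t))) (≤-trans (+-monoʳ-≤ t (n≤1+n 1)) t+2≤k)) c
              S≡ = ⊆∧∣∣≤⇒≡ S⊆ (≤-trans (≤-reflexive ∣X∪x∣) (Half.lower left sS))
          in proj₂ (∈─⁻ (T₀ ─ X) A x∈P) (∈A⁺ x∉X (subst 𝒮 S≡ sS))
      #avoids : # avoids? ≤ (m ∸ ∣ A ∣) * (m * D₂)
      #avoids = ≤-trans (#-⋃-≤ avoids? step? (elements P)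
          (λ { F ((F∈ , X⊆F) , empty) → let (x , x∈F , x∈T₀─X) = outer F∈ X⊆F
                                            x∈P = x∈p∧x∉q⇒x∈p─q x∈T₀─X λ x∈A → empty (x , x∈p∩q⁺ (x∈F , x∈A))
             in lose (∈-elements x∈P) ((F∈ , ∪-least X⊆F (⁅x⁆⊆ x∈F)) , x∈P) }) #step)
        (*-monoˡ-≤ (m * D₂) (≤-trans (≤-reflexive (length-elements P)) ∣P∣≤))

      omit? : ∀ x → Decidable (λ F → (F ∈ᶠ 𝓕 × (X ∪ B) - x ⊆ F) × x ∈ X)
      omit? x F = above? (mem? 𝓕) ((X ∪ B) - x) F ×-dec (x ∈? X)
      #omit : ∀ x → # (omit? x) ≤ D₂
      #omit x with x ∈? X
      ... | no x∉X = ≤-trans (≤-reflexive (#-none (λ F → above? (mem? 𝓕) ((X ∪ B) - x) F ×-dec no x∉X) λ { F (_ , x∈X) → x∉X x∈X })) z≤n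
      ... | yes x∈X = ≤-trans (#-mono (λ F → above? (mem? 𝓕) ((X ∪ B) - x) F ×-dec yes x∈X) (above? (mem? 𝓕) ((X ∪ B) - x)) λ F → proj₁)
          (#⊇≤D₂ ((X ∪ B) - x) (≤-pred (≤-trans (≤-trans (≤-reflexive (sym (+-suc t 2))) (+-monoʳ-≤ t B≥3)) (≤-reflexive (sym (∣X∪B-x∣ x∈X))))))
      #omits : # omits? ≤ t * D₂
      #omits = ≤-trans (#-⋃-≤ omits? omit? (elements X)
          (λ { F (F∈ , X⊈F) → let (x , x∈X , x∉F) = ⊈⇒∃ X F X⊈F in
             lose (∈-elements x∈X) ((F∈ , missing F∈ x∈X x∉F (B≢∅ (≤-trans (s≤s z≤n) B≥3))) , x∈X) }) #omit)
        (*-monoˡ-≤ D₂ (≤-reflexive (trans (length-elements X) ∣X∣)))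

    -- If |A| = m, then `A` fills `T₀ ─ X`, so members through `X` must meet it. If |B| = m, then
    -- `(X ∪ B) - x` already has k points and is the only possible member missing x.
    full⇒𝓗 : ∣ A ∣ ≡ m → ∣ B ∣ ≡ m → ∀ F → F ∈ᶠ 𝓕 → F ∈ᶠ 𝓗 k X (X ∪ B) (X ∪ A)
    full⇒𝓗 ∣A∣ ∣B∣ F F∈ with X ⊆? F
    ... | yes X⊆F = inj₁ (unif F F∈ , (λ {x} → X⊆F {x}) , hit (outer F∈ X⊆F))
      where
      A≡ : A ≡ T₀ ─ X
      A≡ = ⊆∧∣∣≤⇒≡ A⊆T₀─X (≤-trans (∣T₀─X∣≤m (≤-trans (s≤s z≤n) (≤-reflexive (sym ∣A∣)))) (≤-reflexive (sym ∣A∣)))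
      hit : ∃[ x ] (x ∈ F × x ∈ T₀ ─ X) → Nonempty (F ∩ ((X ∪ A) ─ X))
      hit (x , x∈F , x∈) = x , x∈p∩q⁺ (x∈F , x∈p∧x∉q⇒x∈p─q (q⊆p∪q X A (subst (x ∈_) (sym A≡) x∈)) (proj₂ (∈─⁻ T₀ X x∈)))
    ... | no X⊈F with ⊈⇒∃ X F X⊈F
    ...   | x , x∈X , x∉F = inj₂ (x , x∈X , sym (⊆∧∣∣≡⇒≡ (missing F∈ x∈X x∉F (B≢∅ (≤-trans (s≤s z≤n) (≤-reflexive (sym ∣B∣)))))
              (suc-injective (trans (∣X∪B-x∣ x∈X) (trans (cong (t +_) ∣B∣) (trans (+-suc t _) (cong suc (m+[n∸m]≡n t≤k)))))) (unif F F∈)))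

-- Comparison of the product bounds with the extremal sizes.
-- In each case D ≥ 1 is the number of k-sets containing a given (t + 1)-set.

-- With Y = mD the bound gives P ≤ (s/m + 87/169)Y² ≤ (430/507)Y², whereas h ≥ (19/20)Y, and 430/507
-- < 9/10 < (19/20)².
large-few : ∀ {P h m s D} → 3 * s ≤ m → 0 < m * D → 19 * (m * D) ≤ 20 * h →
  (P + (m * D) * (m * D)) * 169 ≤ (s * m) * (D * D) * 169 + (m * D) * (m * D) * 256 → P < h * h
large-few {P} {h} {m} {s} {D} 3s≤m mD>0 h≥ bound = *-cancelˡ-< 400 P (h * h) (begin-strict
  400 * P                         ≡⟨ e₁ P ⟩
  40 * (10 * P)                   ≤⟨ *-monoʳ-≤ 40 10P≤ ⟩
  40 * (9 * (Y * Y))              <⟨ m<m+n _ (*-mono-< mD>0 mD>0) ⟩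
  40 * (9 * (Y * Y)) + Y * Y      ≡⟨ e₂ Y ⟩
  (19 * Y) * (19 * Y)             ≤⟨ *-mono-≤ h≥ h≥ ⟩
  (20 * h) * (20 * h)             ≡⟨ e₃ h ⟩
  400 * (h * h) ∎)
  where
  open ≤-Reasoning
  Y = m * D
  e₁ : ∀ P → 400 * P ≡ 40 * (10 * P)
  e₁ = solve-∀
  e₂ : ∀ Y → 40 * (9 * (Y * Y)) + Y * Y ≡ (19 * Y) * (19 * Y)
  e₂ = solve-∀
  e₃ : ∀ h → (20 * h) * (20 * h) ≡ 400 * (h * h)
  e₃ = solve-∀
  e₄ : ∀ P Y → 507 * P + 507 * (Y * Y) ≡ 3 * ((P + Y * Y) * 169)
  e₄ = solve-∀
  e₅ : ∀ s m D → 3 * ((s * m) * (D * D) * 169 + (m * D) * (m * D) * 256) ≡ (3 * s) * (m * (D * D) * 169) + 768 * ((m * D) * (m * D))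
  e₅ = solve-∀
  e₆ : ∀ m D → m * (m * (D * D) * 169) + 768 * ((m * D) * (m * D)) ≡ 430 * ((m * D) * (m * D)) + 507 * ((m * D) * (m * D))
  e₆ = solve-∀
  e₇ : ∀ P → 507 * (10 * P) ≡ 10 * (507 * P)
  e₇ = solve-∀
  e₈ : ∀ Y → 10 * (430 * (Y * Y)) + 263 * (Y * Y) ≡ 507 * (9 * (Y * Y))
  e₈ = solve-∀
  507P : 507 * P ≤ 430 * (Y * Y)
  507P = +-cancelʳ-≤ (507 * (Y * Y)) _ _ (begin
    507 * P + 507 * (Y * Y)                                ≡⟨ e₄ P Y ⟩
    3 * ((P + Y * Y) * 169)                                ≤⟨ *-monoʳ-≤ 3 bound ⟩
    3 * ((s * m) * (D * D) * 169 + Y * Y * 256)            ≡⟨ e₅ s m D ⟩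
    (3 * s) * (m * (D * D) * 169) + 768 * (Y * Y)          ≤⟨ +-monoˡ-≤ (768 * (Y * Y)) (*-monoˡ-≤ (m * (D * D) * 169) 3s≤m) ⟩
    m * (m * (D * D) * 169) + 768 * (Y * Y)                ≡⟨ e₆ m D ⟩
    430 * (Y * Y) + 507 * (Y * Y) ∎)
  10P≤ : 10 * P ≤ 9 * (Y * Y)
  10P≤ = *-cancelˡ-≤ 507 (begin
    507 * (10 * P)                          ≡⟨ e₇ P ⟩
    10 * (507 * P)                          ≤⟨ *-monoʳ-≤ 10 507P ⟩
    10 * (430 * (Y * Y))                    ≤⟨ m≤m+n _ (263 * (Y * Y)) ⟩
    10 * (430 * (Y * Y)) + 263 * (Y * Y)    ≡⟨ e₈ Y ⟩
    507 * (9 * (Y * Y)) ∎)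

private
  -- For v + 2 = 5τ and w + 1 = 15τ² this is ((v + 2)/v)² - 1/τ < (w/(w + 1))² without denominators,
  -- since then (w + 1)/τ = 3(v + 2). The left side is the bound on the product and the right side
  -- the bound on a², both relative to (τD)².
  vw-inequality : ∀ v w → 18 ≤ v → 5 * (w + 1) ≡ 3 * ((v + 2) * (v + 2)) →
    ((w + 1) * (w + 1)) * ((v + 2) * (v + 2)) < (v * v) * (w * w) + 3 * ((v + 2) * (w + 1)) * (v * v)
  vw-inequality v w 18≤v rel = begin-strict
    ((w + 1) * (w + 1)) * ((v + 2) * (v + 2))       ≡⟨ e₁ v w ⟩
    common + (w * (4 * (w * (v + 1)) + 8 * v + 8) + (4 * v + 4))   <⟨ +-monoʳ-< common (+-mono-≤-< (*-monoʳ-≤ w cubic) linear) ⟩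
    common + (w * (3 * (v * (v * v)) + 4 * (v * v)) + (3 * (v * (v * v)) + 5 * (v * v)))  ≡⟨ e₂ v w ⟩
    (v * v) * (w * w) + 3 * ((v + 2) * (w + 1)) * (v * v) ∎
    where
    open ≤-Reasoning
    common = (v * v) * (w * w) + 2 * (w * (v * v)) + v * v
    e₁ : ∀ v w → ((w + 1) * (w + 1)) * ((v + 2) * (v + 2)) ≡ ((v * v) * (w * w) + 2 * (w * (v * v)) + v * v) + (w * (4 * (w * (v + 1)) + 8 * v + 8) + (4 * v + 4))
    e₁ = solve-∀
    e₂ : ∀ v w → ((v * v) * (w * w) + 2 * (w * (v * v)) + v * v) + (w * (3 * (v * (v * v)) + 4 * (v * v)) + (3 * (v * (v * v)) + 5 * (v * v)))
           ≡ (v * v) * (w * w) + 3 * ((v + 2) * (w + 1)) * (v * v)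
    e₂ = solve-∀
    18v≤v² : 18 * v ≤ v * v
    18v≤v² = *-monoˡ-≤ v 18≤v
    linear : 4 * v + 4 < 3 * (v * (v * v)) + 5 * (v * v)
    linear = begin-strict
      4 * v + 4            <⟨ +-monoʳ-< (4 * v) (≤-trans (s≤s (s≤s (s≤s (s≤s (s≤s z≤n))))) 18≤v) ⟩
      4 * v + v            ≡⟨ e₃ v ⟩
      5 * v                ≤⟨ *-monoʳ-≤ 5 (≤-trans (m≤m+n v (17 * v)) 18v≤v²) ⟩
      5 * (v * v)          ≤⟨ m≤n+m _ (3 * (v * (v * v))) ⟩
      3 * (v * (v * v)) + 5 * (v * v) ∎
      where
      e₃ : ∀ v → 4 * v + v ≡ 5 * v
      e₃ = solve-∀
    cubic : 4 * (w * (v + 1)) + 8 * v + 8 ≤ 3 * (v * (v * v)) + 4 * (v * v)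
    cubic = *-cancelˡ-≤ 5 (begin
      5 * (4 * (w * (v + 1)) + 8 * v + 8)                        ≡⟨ e₄ v w ⟩
      4 * (v + 1) * (5 * (w + 1)) + 20 * (v + 1)                 ≡⟨ cong (λ z → 4 * (v + 1) * z + 20 * (v + 1)) rel ⟩
      4 * (v + 1) * (3 * ((v + 2) * (v + 2))) + 20 * (v + 1)     ≡⟨ e₅ v ⟩
      12 * (v * (v * v)) + 60 * (v * v) + (116 * v + 68)         ≤⟨ +-monoʳ-≤ (12 * (v * (v * v)) + 60 * (v * v)) (+-monoʳ-≤ (116 * v) (≤-trans (*-monoʳ-≤ 4 (≤-trans (n≤1+n 17) 18≤v)) (m≤m+n (4 * v) (132 * v)))) ⟩
      12 * (v * (v * v)) + 60 * (v * v) + (116 * v + (4 * v + 132 * v)) ≡⟨ e₆ v ⟩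
      12 * (v * (v * v)) + 60 * (v * v) + 14 * (18 * v)          ≤⟨ +-monoʳ-≤ (12 * (v * (v * v)) + 60 * (v * v)) (*-monoʳ-≤ 14 18v≤v²) ⟩
      12 * (v * (v * v)) + 60 * (v * v) + 14 * (v * v)           ≡⟨ e₇ v ⟩
      12 * (v * (v * v)) + 20 * (v * v) + 3 * (18 * v * v)       ≤⟨ +-monoʳ-≤ (12 * (v * (v * v)) + 20 * (v * v)) (*-monoʳ-≤ 3 (*-monoˡ-≤ v 18v≤v²)) ⟩
      12 * (v * (v * v)) + 20 * (v * v) + 3 * (v * v * v)        ≡⟨ e₈ v ⟩
      5 * (3 * (v * (v * v)) + 4 * (v * v)) ∎)
      where
      e₄ : ∀ v w → 5 * (4 * (w * (v + 1)) + 8 * v + 8) ≡ 4 * (v + 1) * (5 * (w + 1)) + 20 * (v + 1)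
      e₄ = solve-∀
      e₅ : ∀ v → 4 * (v + 1) * (3 * ((v + 2) * (v + 2))) + 20 * (v + 1) ≡ 12 * (v * (v * v)) + 60 * (v * v) + (116 * v + 68)
      e₅ = solve-∀
      e₆ : ∀ v → 12 * (v * (v * v)) + 60 * (v * v) + (116 * v + (4 * v + 132 * v)) ≡ 12 * (v * (v * v)) + 60 * (v * v) + 14 * (18 * v)
      e₆ = solve-∀
      e₇ : ∀ v → 12 * (v * (v * v)) + 60 * (v * v) + 14 * (v * v) ≡ 12 * (v * (v * v)) + 20 * (v * v) + 3 * (18 * v * v)
      e₇ = solve-∀
      e₈ : ∀ v → 12 * (v * (v * v)) + 20 * (v * v) + 3 * (v * v * v) ≡ 5 * (3 * (v * (v * v)) + 4 * (v * v))
      e₈ = solve-∀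

-- With τ = t + 2 and v = 5 τ − 2 one has 15 τ² = 6 τ + 3 τ v.
small-few-𝓐 : ∀ {P a s τ v w D} → 0 < D → s + 1 ≡ τ → v + 2 ≡ 5 * τ → w + 1 ≡ 15 * (τ * τ) → 18 ≤ v →
  (15 * (τ * τ)) * D ≤ (15 * τ) * a + D →
  (P + (τ * D) * (τ * D)) * ((3 * τ * v) * (3 * τ * v)) ≤ (s * τ) * (D * D) * ((3 * τ * v) * (3 * τ * v)) + (τ * D) * (τ * D) * ((15 * (τ * τ)) * (15 * (τ * τ))) →
  P < a * a
small-few-𝓐 {P} {a} {s} {τ} {v} {w} {D} D>0 refl v≡ w≡ 18≤v a≥ bound = *-cancelˡ-< (225 * (τ * τ) * (v * v)) P (a * a) (+-cancelʳ-< z _ _ (begin-strict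
  225 * (τ * τ) * (v * v) * P + z                          ≡⟨ e₁ τ v P D ⟩
  225 * (τ * τ) * (P * (v * v) + τ * (D * D) * (v * v))    ≤⟨ *-monoʳ-≤ (225 * (τ * τ)) reduced ⟩
  225 * (τ * τ) * (25 * (τ * τ * (τ * τ)) * (D * D))       ≡⟨ e₂ τ D ⟩
  (15 * (τ * τ) * (15 * (τ * τ)) * ((5 * τ) * (5 * τ))) * (D * D)  ≡⟨ cong₂ (λ x y → (x * x * (y * y)) * (D * D)) (sym w≡) (sym v≡) ⟩
  ((w + 1) * (w + 1) * ((v + 2) * (v + 2))) * (D * D)      <⟨ *-monoˡ-< (D * D) {{>-nonZero (*-mono-< D>0 D>0)}} (vw-inequality v w 18≤v rel) ⟩
  ((v * v) * (w * w) + 3 * ((v + 2) * (w + 1)) * (v * v)) * (D * D)  ≡⟨ cong₂ (λ x y → ((v * v) * (w * w) + 3 * (x * y) * (v * v)) * (D * D)) v≡ w≡ ⟩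
  ((v * v) * (w * w) + 3 * ((5 * τ) * (15 * (τ * τ))) * (v * v)) * (D * D) ≡⟨ e₃ v w τ D ⟩
  (v * v) * ((w * D) * (w * D)) + z                        ≤⟨ +-monoˡ-≤ z (*-monoʳ-≤ (v * v) (*-mono-≤ wD≤ wD≤)) ⟩
  (v * v) * ((15 * τ * a) * (15 * τ * a)) + z              ≡⟨ cong (_+ z) (e₄ v τ a) ⟩
  225 * (τ * τ) * (v * v) * (a * a) + z ∎))
  where
  open ≤-Reasoning
  z : ℕ
  z = 225 * (τ * τ) * (τ * (D * D) * (v * v))
  e₁ : ∀ τ v P D → 225 * (τ * τ) * (v * v) * P + 225 * (τ * τ) * (τ * (D * D) * (v * v)) ≡ 225 * (τ * τ) * (P * (v * v) + τ * (D * D) * (v * v))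
  e₁ = solve-∀
  e₂ : ∀ τ D → 225 * (τ * τ) * (25 * (τ * τ * (τ * τ)) * (D * D)) ≡ (15 * (τ * τ) * (15 * (τ * τ)) * ((5 * τ) * (5 * τ))) * (D * D)
  e₂ = solve-∀
  e₃ : ∀ v w τ D → ((v * v) * (w * w) + 3 * ((5 * τ) * (15 * (τ * τ))) * (v * v)) * (D * D) ≡ (v * v) * ((w * D) * (w * D)) + 225 * (τ * τ) * (τ * (D * D) * (v * v))
  e₃ = solve-∀
  e₄ : ∀ v τ a → (v * v) * ((15 * τ * a) * (15 * τ * a)) ≡ 225 * (τ * τ) * (v * v) * (a * a)
  e₄ = solve-∀
  e₅ : ∀ τ → 5 * (15 * (τ * τ)) ≡ 3 * ((5 * τ) * (5 * τ))
  e₅ = solve-∀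
  rel : 5 * (w + 1) ≡ 3 * ((v + 2) * (v + 2))
  rel = trans (cong (5 *_) w≡) (trans (e₅ τ) (cong (λ x → 3 * (x * x)) (sym v≡)))
  wD≤ : w * D ≤ 15 * τ * a
  wD≤ = +-cancelʳ-≤ D _ _ (≤-trans (≤-reflexive (trans (e₆ w D) (cong (_* D) w≡))) a≥)
    where
    e₆ : ∀ w D → w * D + D ≡ (w + 1) * D
    e₆ = solve-∀
  reduced : P * (v * v) + τ * (D * D) * (v * v) ≤ 25 * (τ * τ * (τ * τ)) * (D * D)
  reduced = *-cancelˡ-≤ (9 * (τ * τ)) {{>-nonZero τ²>0}} (+-cancelʳ-≤ (s * τ * (D * D) * (9 * (τ * τ) * (v * v))) _ _ (begin
    9 * (τ * τ) * (P * (v * v) + τ * (D * D) * (v * v)) + s * τ * (D * D) * (9 * (τ * τ) * (v * v))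
      ≡⟨ e₇ s v P D ⟩
    (P + (τ * D) * (τ * D)) * ((3 * τ * v) * (3 * τ * v))
      ≤⟨ bound ⟩
    (s * τ) * (D * D) * ((3 * τ * v) * (3 * τ * v)) + (τ * D) * (τ * D) * ((15 * (τ * τ)) * (15 * (τ * τ)))
      ≡⟨ e₈ s v τ D ⟩
    9 * (τ * τ) * (25 * (τ * τ * (τ * τ)) * (D * D)) + s * τ * (D * D) * (9 * (τ * τ) * (v * v)) ∎))
    where
    τ²>0 : 0 < 9 * (τ * τ)
    τ²>0 = *-mono-< {0} {9} (s≤s z≤n) (*-mono-< {0} (m≤n+m 1 s) (m≤n+m 1 s))
    e₇ : ∀ s v P D → 9 * ((s + 1) * (s + 1)) * (P * (v * v) + (s + 1) * (D * D) * (v * v)) + s * (s + 1) * (D * D) * (9 * ((s + 1) * (s + 1)) * (v * v))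
         ≡ (P + ((s + 1) * D) * ((s + 1) * D)) * ((3 * (s + 1) * v) * (3 * (s + 1) * v))
    e₇ = solve-∀
    e₈ : ∀ s v τ D → (s * τ) * (D * D) * ((3 * τ * v) * (3 * τ * v)) + (τ * D) * (τ * D) * ((15 * (τ * τ)) * (15 * (τ * τ)))
         ≡ 9 * (τ * τ) * (25 * (τ * τ * (τ * τ)) * (D * D)) + s * τ * (D * D) * (9 * (τ * τ) * (v * v))
    e₈ = solve-∀

-- With Y = mD the bound gives P ≤ (s/m - 1 + (g/c)²)Y². The gap hypothesis makes s/m - 1 ≤ -18m/g,
-- and h ≥ yY/(2g) with y = 2g - r. What remains, (g/c)² < 18m/g + (y/(2g))², is `poly`.
small-few-𝓗 : ∀ {P h r s x D} → let m = suc r ; g = 30 * m + x ; c = 24 * m + x in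
  0 < D → g * s + 18 * (m * m) ≤ g * m → 2 * (g * (m * D)) ≤ 2 * (g * h) + (m * r) * D →
  (P + (m * D) * (m * D)) * (c * c) ≤ (s * m) * (D * D) * (c * c) + (m * D) * (m * D) * (g * g) → P < h * h
small-few-𝓗 {P} {h} {r} {s} {x} {D} D>0 gap h≥ bound = *-cancelˡ-< (4 * (g * g) * (c * c)) P (h * h) (+-cancelʳ-< z _ _ (begin-strict
  4 * (g * g) * (c * c) * P + z                                             ≡⟨ e₁ g c P (m * D) ⟩
  4 * (g * g) * ((P + (m * D) * (m * D)) * (c * c))                         ≤⟨ *-monoʳ-≤ (4 * (g * g)) bound ⟩
  4 * (g * g) * ((s * m) * (D * D) * (c * c) + (m * D) * (m * D) * (g * g)) ≡⟨ e₂ g s m D c ⟩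
  (4 * g * m * (c * c) * (g * s) + m * m * (4 * (g * g * (g * g)))) * (D * D)
    <⟨ *-monoˡ-< (D * D) {{>-nonZero (*-mono-< D>0 D>0)}} (<-≤-trans (+-monoʳ-< (4 * g * m * (c * c) * (g * s)) (*-monoʳ-< (m * m) poly)) (≤-reflexive (e₃ g m c s y))) ⟩
  (4 * g * m * (c * c) * (g * s + 18 * (m * m)) + m * m * (c * c * (y * y))) * (D * D)
    ≤⟨ *-monoˡ-≤ (D * D) (+-monoˡ-≤ (m * m * (c * c * (y * y))) (*-monoʳ-≤ (4 * g * m * (c * c)) gap)) ⟩
  (4 * g * m * (c * c) * (g * m) + m * m * (c * c * (y * y))) * (D * D)     ≡⟨ e₄ g m c y D ⟩
  (c * c) * ((m * D * y) * (m * D * y)) + z                                 ≤⟨ +-monoˡ-≤ z (*-monoʳ-≤ (c * c) (*-mono-≤ 2gh≥ 2gh≥)) ⟩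
  (c * c) * ((2 * (g * h)) * (2 * (g * h))) + z                             ≡⟨ cong (_+ z) (e₅ c g h) ⟩
  4 * (g * g) * (c * c) * (h * h) + z ∎))
  where
  open ≤-Reasoning
  m g c y z : ℕ
  m = suc r
  g = 30 * m + x
  c = 24 * m + x
  y = 59 * r + 60 + 2 * x
  z = 4 * (g * g) * (c * c) * ((m * D) * (m * D))
  e₁ : ∀ g c P Y → 4 * (g * g) * (c * c) * P + 4 * (g * g) * (c * c) * (Y * Y) ≡ 4 * (g * g) * ((P + Y * Y) * (c * c))
  e₁ = solve-∀
  e₂ : ∀ g s m D c → 4 * (g * g) * ((s * m) * (D * D) * (c * c) + (m * D) * (m * D) * (g * g)) ≡ (4 * g * m * (c * c) * (g * s) + m * m * (4 * (g * g * (g * g)))) * (D * D)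
  e₂ = solve-∀
  e₃ : ∀ g m c s y → 4 * g * m * (c * c) * (g * s) + m * m * (72 * m * g * (c * c) + c * c * (y * y)) ≡ 4 * g * m * (c * c) * (g * s + 18 * (m * m)) + m * m * (c * c * (y * y))
  e₃ = solve-∀
  e₄ : ∀ g m c y D → (4 * g * m * (c * c) * (g * m) + m * m * (c * c * (y * y))) * (D * D) ≡ (c * c) * ((m * D * y) * (m * D * y)) + 4 * (g * g) * (c * c) * ((m * D) * (m * D))
  e₄ = solve-∀
  e₅ : ∀ c g h → (c * c) * ((2 * (g * h)) * (2 * (g * h))) ≡ 4 * (g * g) * (c * c) * (h * h)
  e₅ = solve-∀
  2gh≥ : m * D * y ≤ 2 * (g * h)
  2gh≥ = +-cancelʳ-≤ ((m * r) * D) _ _ (≤-trans (≤-reflexive (e₆ r x D)) h≥)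
    where
    e₆ : ∀ r x D → suc r * D * (59 * r + 60 + 2 * x) + (suc r * r) * D ≡ 2 * ((30 * suc r + x) * (suc r * D))
    e₆ = solve-∀
  poly : 4 * (g * g * (g * g)) < 72 * m * g * (c * c) + c * c * (y * y)
  poly = begin-strict
    4 * (g * g * (g * g))                                    ≤⟨ m≤m+n _ (g * (288 * (m * m * m) + 528 * (m * m * x) + 20 * (m * x * x))) ⟩
    4 * (g * g * (g * g)) + g * (288 * (m * m * m) + 528 * (m * m * x) + 20 * (m * x * x)) ≡⟨ e₇ m x ⟩
    (c * c) * (68 * m * g + 4 * (g * g))                     <⟨ *-monoʳ-< (c * c) {{>-nonZero (s≤s z≤n)}} (m<m+n (68 * m * g + 4 * (g * g)) {4 * g + r * r} (s≤s z≤n)) ⟩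
    (c * c) * (68 * m * g + 4 * (g * g) + (4 * g + r * r))   ≡⟨ e₈ r x ⟩
    72 * m * g * (c * c) + c * c * (y * y) ∎
    where
    e₇ : ∀ m x → 4 * ((30 * m + x) * (30 * m + x) * ((30 * m + x) * (30 * m + x))) + (30 * m + x) * (288 * (m * m * m) + 528 * (m * m * x) + 20 * (m * x * x))
         ≡ ((24 * m + x) * (24 * m + x)) * (68 * m * (30 * m + x) + 4 * ((30 * m + x) * (30 * m + x)))
    e₇ = solve-∀
    e₈ : ∀ r x → let m = suc r ; g = 30 * m + x ; c = 24 * m + x ; y = 59 * r + 60 + 2 * x in
         (c * c) * (68 * m * g + 4 * (g * g) + (4 * g + r * r)) ≡ 72 * m * g * (c * c) + c * c * (y * y)
    e₈ r x = expand r x (24 * suc r + x)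
      where
      expand : ∀ r x c → (c * c) * (68 * suc r * (30 * suc r + x) + 4 * ((30 * suc r + x) * (30 * suc r + x)) + (4 * (30 * suc r + x) + r * r))
               ≡ 72 * suc r * (30 * suc r + x) * (c * c) + c * c * ((59 * r + 60 + 2 * x) * (59 * r + 60 + 2 * x))
      expand = solve-∀

-- (H - a)(H + b) < H² for b < a: the deficit on one side outweighs the surplus on the other.
product-below-square : ∀ {f g H a b} → b < a → f + a ≤ H → g ≤ H + b → f * g < H * H
product-below-square {f} {g} {H} {a} {b} b<a f≤ g≤ with m≤n⇒∃[o]m+o≡n (≤-trans (≤-reflexive (sym (+-suc f b))) (≤-trans (+-monoʳ-≤ f b<a) f≤))
... | e , refl = begin-strict
  f * g                              ≤⟨ *-monoʳ-≤ f g≤ ⟩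
  f * (suc (f + b) + e + b)          <⟨ m<m+n _ {suc (b * b + 2 * (b * suc e) + f * suc e + (2 * e + e * e))} (s≤s z≤n) ⟩
  f * (suc (f + b) + e + b) + suc (b * b + 2 * (b * suc e) + f * suc e + (2 * e + e * e)) ≡⟨ expand f b e ⟩
  (suc (f + b) + e) * (suc (f + b) + e) ∎
  where
  open ≤-Reasoning
  expand : ∀ f b e → f * (suc (f + b) + e + b) + suc (b * b + 2 * (b * suc e) + f * suc e + (2 * e + e * e)) ≡ (suc (f + b) + e) * (suc (f + b) + e)
  expand = solve-∀

-- Binomial estimates for the extremal sizes

C-monoˡ : ∀ {x y} j → x ≤ y → x C j ≤ y C j
C-monoˡ {x} {y} zero _ = ≤-refl
C-monoˡ {zero} {y} (suc j) _ = ≤-trans (≤-reflexive (k>n⇒nCk≡0 (s≤s (z≤n {j})))) z≤n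
C-monoˡ {suc x} {suc y} (suc j) (s≤s le) = subst₂ _≤_ (nCk+nC[k+1]≡[n+1]C[k+1] x j) (nCk+nC[k+1]≡[n+1]C[k+1] y j)
  (+-mono-≤ (C-monoˡ j le) (C-monoˡ (suc j) le))

C>0 : ∀ {x j} → j ≤ x → 0 < x C j
C>0 {x} {zero} _ = s≤s z≤n
C>0 {suc x} {suc j} (s≤s le) = ≤-trans (C>0 le) (≤-trans (m≤m+n (x C j) (x C suc j)) (≤-reflexive (nCk+nC[k+1]≡[n+1]C[k+1] x j)))

C≥2 : ∀ {x j} → 0 < j → j < x → 2 ≤ x C j
C≥2 {suc x} {suc j} _ (s≤s le) = ≤-trans (+-mono-≤ (C>0 (<⇒≤ le)) (C>0 le)) (≤-reflexive (nCk+nC[k+1]≡[n+1]C[k+1] x j))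

pascal : ∀ {x} j → 0 < x → x C suc j ≡ (x ∸ 1) C j + (x ∸ 1) C suc j
pascal {suc x} j _ = sym (nCk+nC[k+1]≡[n+1]C[k+1] x j)

pascal-≤ : ∀ x j → x C suc j ≤ (x ∸ 1) C j + (x ∸ 1) C suc j
pascal-≤ zero j = ≤-trans (≤-reflexive (k>n⇒nCk≡0 (s≤s (z≤n {j})))) z≤n
pascal-≤ (suc x) j = ≤-reflexive (pascal j (s≤s z≤n))

∸-suc : ∀ x s → x ∸ suc s ≡ x ∸ s ∸ 1
∸-suc x s = trans (cong (x ∸_) (+-comm 1 s)) (sym (∸-+-assoc x s 1))

-- When N = n − t, hits s counts the (t + r + 2)-subsets of [n] through a fixed t-set that
-- meet a fixed disjoint s-set, split according to the first element of the s-set they contain.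
module Hits (N r : ℕ) where

  hits : ℕ → ℕ
  hits zero    = 0
  hits (suc s) = hits s + (N ∸ suc s) C (suc r)

  hits-complement : ∀ {s} → s ≤ N → hits s + (N ∸ s) C suc (suc r) ≡ N C suc (suc r)
  hits-complement {zero} _ = refl
  hits-complement {suc s} s<N = trans (+-assoc (hits s) _ _)
    (trans (cong (hits s +_) (trans (cong (λ z → z C suc r + z C suc (suc r)) (∸-suc N s)) (sym (pascal (suc r) (m<n⇒0<n∸m s<N)))))
      (hits-complement (<⇒≤ s<N)))

  hits-mono : ∀ s j → hits s ≤ hits (s + j)
  hits-mono s zero = ≤-reflexive (cong hits (sym (+-identityʳ s)))
  hits-mono s (suc j) = ≤-trans (hits-mono s j) (≤-trans (m≤m+n _ _) (≤-reflexive (cong hits (sym (+-suc s j)))))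

  D D₂ : ℕ
  D  = (N ∸ 1) C suc r
  D₂ = (N ∸ 2) C r

  -- By Pascal's rule, each decrease of the upper index loses at most `D₂`.
  increment-≥ : ∀ s → D ≤ (N ∸ suc s) C suc r + s * D₂
  increment-≥ zero = ≤-reflexive (sym (+-identityʳ D))
  increment-≥ (suc s) = begin
    D                                                      ≤⟨ increment-≥ s ⟩
    (N ∸ suc s) C suc r + s * D₂                           ≤⟨ +-monoˡ-≤ (s * D₂) (pascal-≤ (N ∸ suc s) r) ⟩
    (N ∸ suc s ∸ 1) C r + (N ∸ suc s ∸ 1) C suc r + s * D₂ ≡⟨ cong (λ z → z C r + z C suc r + s * D₂) (sym (∸-suc N (suc s))) ⟩
    (N ∸ suc (suc s)) C r + (N ∸ suc (suc s)) C suc r + s * D₂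
      ≤⟨ +-monoˡ-≤ (s * D₂) (+-monoˡ-≤ ((N ∸ suc (suc s)) C suc r) (C-monoˡ r (∸-monoʳ-≤ N (s≤s (s≤s (z≤n {s})))))) ⟩
    D₂ + (N ∸ suc (suc s)) C suc r + s * D₂                ≡⟨ e D₂ ((N ∸ suc (suc s)) C suc r) (s * D₂) ⟩
    (N ∸ suc (suc s)) C suc r + (D₂ + s * D₂) ∎
    where
    open ≤-Reasoning
    e : ∀ a b c → a + b + c ≡ b + (a + c)
    e = solve-∀

  -- Summing the increments: hits s ≥ sD - (s(s - 1)/2)D₂, here doubled and freed of subtraction.
  hits-≥ : ∀ s → 2 * (s * D) + s * D₂ ≤ 2 * hits s + s * s * D₂
  hits-≥ zero = z≤n
  hits-≥ (suc s) = begin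
    2 * (suc s * D) + suc s * D₂                                  ≡⟨ e₁ s D D₂ ⟩
    (2 * (s * D) + s * D₂) + (2 * D + D₂)                         ≤⟨ +-mono-≤ (hits-≥ s) (+-monoˡ-≤ D₂ (*-monoʳ-≤ 2 (increment-≥ s))) ⟩
    (2 * hits s + s * s * D₂) + (2 * ((N ∸ suc s) C suc r + s * D₂) + D₂) ≡⟨ e₂ (hits s) s D₂ ((N ∸ suc s) C suc r) ⟩
    2 * (hits s + (N ∸ suc s) C suc r) + suc s * suc s * D₂ ∎
    where
    open ≤-Reasoning
    e₁ : ∀ s D D₂ → 2 * (suc s * D) + suc s * D₂ ≡ (2 * (s * D) + s * D₂) + (2 * D + D₂)
    e₁ = solve-∀
    e₂ : ∀ h s D₂ c → (2 * h + s * s * D₂) + (2 * (c + s * D₂) + D₂) ≡ 2 * (h + c) + suc s * suc s * D₂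
    e₂ = solve-∀

  2mD≤2hits : ∀ m′ → 2 * (suc m′ * D) ≤ 2 * hits (suc m′) + suc m′ * m′ * D₂
  2mD≤2hits m′ = +-cancelʳ-≤ (suc m′ * D₂) _ _ (≤-trans (hits-≥ (suc m′)) (≤-reflexive (e m′ (hits (suc m′)) D₂)))
    where
    e : ∀ m h D₂ → 2 * h + suc m * suc m * D₂ ≡ 2 * h + suc m * m * D₂ + suc m * D₂
    e = solve-∀

  -- All increments up to the L-th are at least D - L · D₂ ≥ E.
  hits-growth : ∀ {E L} s j → L * D₂ + E ≤ D → s + j ≤ L → hits s + j * E ≤ hits (s + j)
  hits-growth s zero _ _ = ≤-reflexive (trans (+-identityʳ _) (cong hits (sym (+-identityʳ s))))
  hits-growth {E} {L} s (suc j) room le = begin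
    hits s + (E + j * E)           ≡⟨ e (hits s) E (j * E) ⟩
    hits s + j * E + E             ≤⟨ +-mono-≤ (hits-growth {E} {L} s j room (<⇒≤ le′)) step ⟩
    hits (suc (s + j))             ≡⟨ cong hits (sym (+-suc s j)) ⟩
    hits (s + suc j) ∎
    where
    open ≤-Reasoning
    e : ∀ a b c → a + (b + c) ≡ a + c + b
    e = solve-∀
    le′ : suc (s + j) ≤ L
    le′ = subst (_≤ L) (+-suc s j) le
    step : E ≤ (N ∸ suc (s + j)) C suc r
    step = +-cancelˡ-≤ ((s + j) * D₂) _ _ (begin
      (s + j) * D₂ + E       ≤⟨ +-monoˡ-≤ E (*-monoˡ-≤ D₂ (<⇒≤ le′)) ⟩
      L * D₂ + E             ≤⟨ room ⟩
      D                      ≤⟨ increment-≥ (s + j) ⟩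
      (N ∸ suc (s + j)) C suc r + (s + j) * D₂ ≡⟨ +-comm _ ((s + j) * D₂) ⟩
      (s + j) * D₂ + (N ∸ suc (s + j)) C suc r ∎)

  D≡ : 1 < N → D ≡ D₂ + (N ∸ 2) C suc r
  D≡ 1<N = trans (pascal r (m<n⇒0<n∸m 1<N)) (cong (λ z → z C r + z C suc r) (sym (∸-suc N 1)))

  hits-≤ : ∀ j → hits (2 + j) ≤ D + (N ∸ 2) C suc r + j * ((N ∸ 3) C suc r)
  hits-≤ zero = ≤-reflexive (sym (+-identityʳ _))
  hits-≤ (suc j) = ≤-trans (+-mono-≤ (hits-≤ j) (C-monoˡ (suc r) (∸-monoʳ-≤ N (s≤s (s≤s (s≤s (z≤n {j})))))))
    (≤-reflexive (e (D + (N ∸ 2) C suc r) j ((N ∸ 3) C suc r)))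
    where
    e : ∀ a j c → a + j * c + c ≡ a + (c + j * c)
    e = solve-∀

-- Pascal's rule gives a = D + c₁ + t · c₁, so (r + 1)c₂ + t must stay below t · c₁, where r + 1 ≤
-- t. For r + 1 < t a spare c₁ > t remains; for r + 1 = t the difference c₁ - c₂ = C(N - 3, r) is at
-- least 2.
hits<𝓐 : ∀ {N r t a} → let open Hits N r in 2 ≤ t → r + 3 ≤ t + 2 → r + 4 ≤ N → t + D₂ < D →
  a + (t + 1) * D₂ ≡ (t + 2) * D → hits (3 + r) + t < a
hits<𝓐 {N} {r} {t} {a} 2≤t m≤τ m<N big a≡ = begin-strict
  hits (2 + suc r) + t                        ≤⟨ +-monoˡ-≤ t (hits-≤ (suc r)) ⟩
  D + c₁ + suc r * c₂ + t                     ≡⟨ +-assoc (D + c₁) (suc r * c₂) t ⟩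
  D + c₁ + (suc r * c₂ + t)                   <⟨ +-monoʳ-< (D + c₁) key ⟩
  D + c₁ + t * c₁                             ≡⟨ sym a≡′ ⟩
  a ∎
  where
  open Hits N r
  open ≤-Reasoning
  c₁ c₂ : ℕ
  c₁ = (N ∸ 2) C suc r
  c₂ = (N ∸ 3) C suc r
  4≤N : 4 ≤ N
  4≤N = ≤-trans (m≤n+m 4 r) m<N
  D≡′ : D ≡ D₂ + c₁
  D≡′ = D≡ (≤-trans (s≤s (s≤s z≤n)) 4≤N)
  a≡′ : a ≡ D + c₁ + t * c₁
  a≡′ = +-cancelʳ-≡ ((t + 1) * D₂) _ _ (trans a≡ (trans (cong ((t + 2) *_) D≡′) (trans (e t D₂ c₁) (cong (λ z → z + c₁ + t * c₁ + (t + 1) * D₂) (sym D≡′)))))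
    where
    e : ∀ t d c → (t + 2) * (d + c) ≡ (d + c) + c + t * c + (t + 1) * d
    e = solve-∀
  t<c₁ : t < c₁
  t<c₁ = +-cancelˡ-< D₂ t c₁ (subst₂ _<_ (+-comm t D₂) D≡′ big)
  c₁≡ : c₁ ≡ (N ∸ 3) C r + c₂
  c₁≡ = trans (pascal r (m<n⇒0<n∸m (≤-trans (s≤s (s≤s (s≤s z≤n))) 4≤N))) (cong (λ z → z C r + z C suc r) (sym (∸-suc N 2)))
  c₂≤c₁ : c₂ ≤ c₁
  c₂≤c₁ = ≤-trans (m≤n+m c₂ _) (≤-reflexive (sym c₁≡))
  r+1≤t : suc r ≤ t
  r+1≤t = +-cancelʳ-≤ 2 (suc r) t (≤-trans (≤-reflexive (sym (+-suc r 2))) m≤τ)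
  key : suc r * c₂ + t < t * c₁
  key with suc r ≟ t
  ... | no ≢ = begin-strict
      suc r * c₂ + t       <⟨ +-mono-≤-< (*-monoʳ-≤ (suc r) c₂≤c₁) t<c₁ ⟩
      suc r * c₁ + c₁      ≡⟨ +-comm (suc r * c₁) c₁ ⟩
      suc (suc r) * c₁     ≤⟨ *-monoˡ-≤ c₁ (≤∧≢⇒< r+1≤t ≢) ⟩
      t * c₁ ∎
  ... | yes refl = begin-strict
      t * c₂ + t           <⟨ m<m+n _ {t} (≤-trans (s≤s z≤n) 2≤t) ⟩
      t * c₂ + t + t       ≡⟨ e t c₂ ⟩
      t * (2 + c₂)         ≤⟨ *-monoʳ-≤ t (≤-trans (+-monoˡ-≤ c₂ (C≥2 (≤-pred 2≤t) r<N-3)) (≤-reflexive (sym c₁≡))) ⟩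
      t * c₁ ∎
    where
    e : ∀ t c → t * c + t + t ≡ t * (2 + c)
    e = solve-∀
    r<N-3 : suc r ≤ N ∸ 3
    r<N-3 = ≤-trans (≤-reflexive (sym (m+n∸n≡m (suc r) 3))) (∸-monoˡ-≤ 3 (≤-trans (≤-reflexive (sym (+-suc r 3))) m<N))

8t≤[t+2]² : ∀ {t} → 2 ≤ t → 8 * t ≤ (t + 2) * (t + 2)
8t≤[t+2]² 2≤t with m≤n⇒∃[o]m+o≡n 2≤t
... | u , refl = ≤-trans (m≤m+n (8 * (2 + u)) (u * u)) (≤-reflexive (e u))
  where
  e : ∀ u → 8 * (2 + u) + u * u ≡ (2 + u + 2) * (2 + u + 2)
  e = solve-∀

-- It yields 30m ≤ 15(t + 2)², so the ratio 6m/(15(t + 2)²) is at most 1/5 in the small range.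
2m≤[t+2]² : ∀ {t m} → 2 ≤ t → m < 3 * (t + 1) → 2 * m ≤ (t + 2) * (t + 2)
2m≤[t+2]² {t} {m} 2≤t m< = +-cancelʳ-≤ 2 _ _ (begin
  2 * m + 2                     ≡⟨ e₁ m ⟩
  2 * suc m                     ≤⟨ *-monoʳ-≤ 2 m< ⟩
  2 * (3 * (t + 1))             ≡⟨ e₂ t ⟩
  4 * t + 6 + 2 * t             ≤⟨ +-monoʳ-≤ (4 * t + 6) (*-monoˡ-≤ t 2≤t) ⟩
  4 * t + 6 + t * t             ≡⟨ e₃ t ⟩
  (t + 2) * (t + 2) + 2 ∎)
  where
  open ≤-Reasoning
  e₁ : ∀ m → 2 * m + 2 ≡ 2 * suc m
  e₁ = solve-∀
  e₂ : ∀ t → 2 * (3 * (t + 1)) ≡ 4 * t + 6 + 2 * t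
  e₂ = solve-∀
  e₃ : ∀ t → 4 * t + 6 + t * t ≡ (t + 2) * (t + 2) + 2
  e₃ = solve-∀

-- With t = 2 + u and m = t + 3 + e the range is e ≤ 3 + 2u. Replacing one factor of e² by this
-- bound leaves a difference with nonnegative coefficients only.
small-gap : ∀ {t m} → 2 ≤ t → t + 3 ≤ m → m < 3 * (t + 1) →
  15 * ((t + 2) * (t + 2)) * (t + 1) + 18 * (m * m) ≤ 15 * ((t + 2) * (t + 2)) * m
small-gap 2≤t t+3≤m m< with m≤n⇒∃[o]m+o≡n 2≤t | m≤n⇒∃[o]m+o≡n t+3≤m
... | u , refl | e , refl = begin
  15 * (τ * τ) * (2 + u + 1) + 18 * (m * m)                             ≡⟨ e₁ u e ⟩
  common + 18 * (e * e)                                                 ≤⟨ +-monoʳ-≤ common (*-monoʳ-≤ 18 (*-monoʳ-≤ e e≤)) ⟩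
  common + 18 * (e * (3 + 2 * u))                                       ≤⟨ m≤m+n _ (3 * (10 + 20 * u + 4 * (u * u) + 2 * e + 16 * (u * e) + 5 * (u * u * e))) ⟩
  common + 18 * (e * (3 + 2 * u)) + 3 * (10 + 20 * u + 4 * (u * u) + 2 * e + 16 * (u * e) + 5 * (u * u * e)) ≡⟨ e₂ u e ⟩
  15 * (τ * τ) * m ∎
  where
  open ≤-Reasoning
  τ m common : ℕ
  τ = 2 + u + 2
  m = 2 + u + 3 + e
  common = 15 * (τ * τ) * (2 + u + 1) + 18 * ((5 + u) * (5 + u) + 2 * e * (5 + u))
  e≤ : e ≤ 3 + 2 * u
  e≤ = +-cancelˡ-≤ (6 + u) _ _ (≤-trans (≤-reflexive (p u e)) (≤-trans m< (≤-reflexive (q u))))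
    where
    p : ∀ u e → 6 + u + e ≡ suc (2 + u + 3 + e)
    p = solve-∀
    q : ∀ u → 3 * (2 + u + 1) ≡ 6 + u + (3 + 2 * u)
    q = solve-∀
  e₁ : ∀ u e → 15 * ((2 + u + 2) * (2 + u + 2)) * (2 + u + 1) + 18 * ((2 + u + 3 + e) * (2 + u + 3 + e))
       ≡ 15 * ((2 + u + 2) * (2 + u + 2)) * (2 + u + 1) + 18 * ((5 + u) * (5 + u) + 2 * e * (5 + u)) + 18 * (e * e)
  e₁ = solve-∀
  e₂ : ∀ u e → 15 * ((2 + u + 2) * (2 + u + 2)) * (2 + u + 1) + 18 * ((5 + u) * (5 + u) + 2 * e * (5 + u)) + 18 * (e * (3 + 2 * u))
         + 3 * (10 + 20 * u + 4 * (u * u) + 2 * e + 16 * (u * e) + 5 * (u * u * e))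
       ≡ 15 * ((2 + u + 2) * (2 + u + 2)) * (2 + u + 3 + e)
  e₂ = solve-∀

-- The error term m · r · D₂ is at most mD/10, hence h ≥ (19/20)mD.
few-below-𝓗-large : ∀ {P h t r D D₂} → let m = suc r in 3 * (t + 1) ≤ m → 0 < D → 10 * r * D₂ ≤ D →
  2 * (m * D) ≤ 2 * h + m * r * D₂ →
  (P + (m * D) * (m * D)) * 169 ≤ ((t + 1) * m) * (D * D) * 169 + (m * D) * (m * D) * 256 → P < h * h
few-below-𝓗-large {P} {h} {t} {r} {D} {D₂} 3t≤m D>0 small 2mD≤ bound =
  large-few {P} {h} {suc r} {t + 1} {D} 3t≤m (*-mono-< {0} {suc r} (s≤s z≤n) D>0) 19mD≤20h bound
  where
  open ≤-Reasoning
  m = suc r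
  e₁ : ∀ x → 19 * x + x ≡ 10 * (2 * x)
  e₁ = solve-∀
  e₂ : ∀ h m R d → 10 * (2 * h + m * R * d) ≡ 20 * h + m * (10 * R * d)
  e₂ = solve-∀
  19mD≤20h : 19 * (m * D) ≤ 20 * h
  19mD≤20h = +-cancelʳ-≤ (m * D) _ _ (begin
    19 * (m * D) + m * D           ≡⟨ e₁ (m * D) ⟩
    10 * (2 * (m * D))             ≤⟨ *-monoʳ-≤ 10 2mD≤ ⟩
    10 * (2 * h + m * r * D₂)      ≡⟨ e₂ h m r D₂ ⟩
    20 * h + m * (10 * r * D₂)     ≤⟨ +-monoʳ-≤ (20 * h) (*-monoʳ-≤ m small) ⟩
    20 * h + m * D ∎)

few-below-𝓗-small : ∀ {P h t r D D₂} → let m = suc r ; β = 15 * ((t + 2) * (t + 2)) in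
  2 ≤ t → t + 3 ≤ m → m < 3 * (t + 1) → 0 < D → β * D₂ ≤ D → 2 * (m * D) ≤ 2 * h + m * r * D₂ →
  (∀ {c} → 6 * m + c ≡ β → (P + (m * D) * (m * D)) * (c * c) ≤ ((t + 1) * m) * (D * D) * (c * c) + (m * D) * (m * D) * (β * β)) →
  P < h * h
few-below-𝓗-small {P} {h} {t} {r} {D} {D₂} 2≤t t+3≤m m< D>0 small 2mD≤ bound =
  conclude (m≤n⇒∃[o]m+o≡n (≤-trans (≤-reflexive (30m r)) (*-monoʳ-≤ 15 (2m≤[t+2]² 2≤t m<))))
  where
  open ≤-Reasoning
  30m : ∀ r → 30 * suc r ≡ 15 * (2 * suc r)
  30m = solve-∀
  e : ∀ m x → 6 * m + (24 * m + x) ≡ 30 * m + x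
  e = solve-∀
  e₁ : ∀ g x → 2 * (g * x) ≡ g * (2 * x)
  e₁ = solve-∀
  e₂ : ∀ g h x d → g * (2 * h + x * d) ≡ 2 * (g * h) + x * (g * d)
  e₂ = solve-∀
  2gmD≤ : ∀ {g} → g * D₂ ≤ D → 2 * (g * (suc r * D)) ≤ 2 * (g * h) + (suc r * r) * D
  2gmD≤ {g} gD₂≤D = begin
    2 * (g * (suc r * D))               ≡⟨ e₁ g (suc r * D) ⟩
    g * (2 * (suc r * D))               ≤⟨ *-monoʳ-≤ g 2mD≤ ⟩
    g * (2 * h + suc r * r * D₂)        ≡⟨ e₂ g h (suc r * r) D₂ ⟩
    2 * (g * h) + suc r * r * (g * D₂)  ≤⟨ +-monoʳ-≤ (2 * (g * h)) (*-monoʳ-≤ (suc r * r) gD₂≤D) ⟩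
    2 * (g * h) + (suc r * r) * D ∎
  conclude : ∃[ x ] 30 * suc r + x ≡ 15 * ((t + 2) * (t + 2)) → P < h * h
  conclude (x , g≡) = small-few-𝓗 {P} {h} {r} {t + 1} {x} {D} D>0
    (subst (λ g → g * (t + 1) + 18 * (suc r * suc r) ≤ g * suc r) (sym g≡) (small-gap 2≤t t+3≤m m<))
    (2gmD≤ {30 * suc r + x} (subst (λ g → g * D₂ ≤ D) (sym g≡) small))
    (subst (λ g → (P + (suc r * D) * (suc r * D)) * ((24 * suc r + x) * (24 * suc r + x)) ≤ ((t + 1) * suc r) * (D * D) * ((24 * suc r + x) * (24 * suc r + x)) + (suc r * D) * (suc r * D) * (g * g))
      (sym g≡) (bound (trans (e (suc r) x) g≡)))

few-below-𝓐 : ∀ {P a t D D₂} → let τ = t + 2 ; β = 15 * (τ * τ) in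
  2 ≤ t → 0 < D → β * D₂ ≤ D → a + (t + 1) * D₂ ≡ τ * D →
  (∀ {c} → 6 * τ + c ≡ β → (P + (τ * D) * (τ * D)) * (c * c) ≤ ((t + 1) * τ) * (D * D) * (c * c) + (τ * D) * (τ * D) * (β * β)) →
  P < a * a
few-below-𝓐 {P} {a} {t} {D} {D₂} 2≤t D>0 small a≡ bound =
  small-few-𝓐 {P} {a} {t + 1} {τ} {5 * t + 8} {15 * (τ * τ) ∸ 1} {D} D>0 (e₁ t) (e₂ t)
    (m∸n+n≡m (*-mono-< {0} {15} (s≤s z≤n) (*-mono-< {0} τ>0 τ>0)))
    (+-monoˡ-≤ 8 (*-monoʳ-≤ 5 2≤t)) a≥ (bound (e₃ t))
  where
  open ≤-Reasoning
  τ : ℕ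
  τ = t + 2
  τ>0 : 0 < τ
  τ>0 = ≤-trans (s≤s z≤n) (m≤n+m 2 t)
  e₁ : ∀ t → t + 1 + 1 ≡ t + 2
  e₁ = solve-∀
  e₂ : ∀ t → 5 * t + 8 + 2 ≡ 5 * (t + 2)
  e₂ = solve-∀
  e₃ : ∀ t → 6 * (t + 2) + 3 * (t + 2) * (5 * t + 8) ≡ 15 * ((t + 2) * (t + 2))
  e₃ = solve-∀
  e₄ : ∀ τ D → 15 * (τ * τ) * D ≡ 15 * τ * (τ * D)
  e₄ = solve-∀
  e₅ : ∀ τ a s d → 15 * τ * (a + s * d) ≡ 15 * τ * a + 15 * (τ * s) * d
  e₅ = solve-∀
  a≥ : 15 * (τ * τ) * D ≤ 15 * τ * a + D
  a≥ = begin
    15 * (τ * τ) * D                           ≡⟨ e₄ τ D ⟩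
    15 * τ * (τ * D)                           ≡⟨ cong (15 * τ *_) (sym a≡) ⟩
    15 * τ * (a + (t + 1) * D₂)                ≡⟨ e₅ τ a (t + 1) D₂ ⟩
    15 * τ * a + 15 * (τ * (t + 1)) * D₂       ≤⟨ +-monoʳ-≤ (15 * τ * a) (≤-trans (*-monoˡ-≤ D₂ (*-monoʳ-≤ 15 (*-monoʳ-≤ τ (+-monoʳ-≤ t (n≤1+n 1))))) small) ⟩
    15 * τ * a + D ∎

squeeze : ∀ {f g H} → f ≤ H → g ≤ H → f * g ≡ H * H → f ≡ H × g ≡ H
squeeze {f} {g} {H} f≤H g≤H eq = attained f≤H g≤H eq , attained g≤H f≤H (trans (*-comm g f) eq)
  where
  attained : ∀ {f g} → f ≤ H → g ≤ H → f * g ≡ H * H → f ≡ H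
  attained {f} f≤H g≤H eq with m≤n⇒m<n∨m≡n f≤H
  ... | inj₂ f≡H = f≡H
  ... | inj₁ f<H = contradiction (≤-<-trans (*-monoʳ-≤ f g≤H) (*-monoˡ-< H {{>-nonZero (≤-<-trans z≤n f<H)}} f<H)) (<-irrefl eq)

-- `Form` is only a containment in the extremal pair. Equality excludes the strict alternative and
-- forces both sizes to be `H`, from which equality of the families follows.
bound-and-equality : ∀ {f g H} {Form : Set} → f * g < H * H ⊎ Form → (Form → f ≤ H × g ≤ H) →
  f * g ≤ H ^ 2 × (f * g ≡ H ^ 2 → Form × f ≡ H × g ≡ H)
bound-and-equality {f} {g} {H} {Form} outcome sizes = subst (f * g ≤_) sq (bound outcome) , λ eq → equality outcome (trans eq (sym sq))
  where
  sq : H * H ≡ H ^ 2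
  sq = cong (H *_) (sym (*-identityʳ H))
  bound : f * g < H * H ⊎ Form → f * g ≤ H * H
  bound (inj₁ lt) = <⇒≤ lt
  bound (inj₂ form) = *-mono-≤ (proj₁ (sizes form)) (proj₂ (sizes form))
  equality : f * g < H * H ⊎ Form → f * g ≡ H * H → Form × f ≡ H × g ≡ H
  equality (inj₁ lt) eq = contradiction lt (<-irrefl eq)
  equality (inj₂ form) eq = form , squeeze (proj₁ (sizes form)) (proj₂ (sizes form)) eq

two-members : ∀ {n} (X : Subset n) → 2 ≤ ∣ X ∣ → ∃[ x ] ∃[ y ] (x ∈ X × y ∈ X × y ≢ x)
two-members {n} X 2≤∣X∣ with ∣p∣<∣q∣⇒∃ ∅ X (subst (_< ∣ X ∣) (sym (∣⊥∣≡0 n)) (<⇒≤ 2≤∣X∣))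
... | x , x∈X , _ with ∣p∣<∣q∣⇒∃ ⁅ x ⁆ X (subst (_< ∣ X ∣) (sym (∣⁅x⁆∣≡1 x)) 2≤∣X∣)
... | y , y∈X , y∉ = x , y , x∈X , y∈X , λ { refl → y∉ (x∈⁅x⁆ x) }

∣K∩L∣-≥ : ∀ {n t} (K L : Subset n) {x y} → x ∈ K → x ∈ L → y ∈ K → y ∈ L → y ≢ x →
  t ≤ ∣ (K - x) ∩ (L - y) ∣ → t + 2 ≤ ∣ K ∩ L ∣
∣K∩L∣-≥ {t = t} K L {x} {y} x∈K x∈L y∈K y∈L y≢x le = begin
  t + 2                                  ≡⟨ +-comm t 2 ⟩
  suc (suc t)                            ≤⟨ s≤s (s≤s le) ⟩
  suc (suc ∣ (K - x) ∩ (L - y) ∣)        ≤⟨ s≤s (s≤s (p⊆q⇒∣p∣≤∣q∣ sub)) ⟩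
  suc (suc ∣ ((K ∩ L) - x) - y ∣)        ≡⟨ cong suc (x∈p⇒suc∣p-x∣≡∣p∣ ((K ∩ L) - x) (x∈p∧x≢y⇒x∈p-y (x∈p∩q⁺ (y∈K , y∈L)) y≢x)) ⟩
  suc ∣ (K ∩ L) - x ∣                    ≡⟨ x∈p⇒suc∣p-x∣≡∣p∣ (K ∩ L) (x∈p∩q⁺ (x∈K , x∈L)) ⟩
  ∣ K ∩ L ∣ ∎
  where
  open ≤-Reasoning
  sub : (K - x) ∩ (L - y) ⊆ ((K ∩ L) - x) - y
  sub z∈ with x∈p∩q⁻ (K - x) (L - y) z∈
  ... | z∈K-x , z∈L-y with ∈-⁻ K z∈K-x | ∈-⁻ L z∈L-y
  ...   | z∈K , z≢x | z∈L , z≢y = x∈p∧x≢y⇒x∈p-y (x∈p∧x≢y⇒x∈p-y (x∈p∩q⁺ (z∈K , z∈L)) z≢x) z≢y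

-- The parameter range

module Range (n k t : ℕ) (k≥ : k ≥ t + 2) (t+2≥4 : t + 2 ≥ 4) (n≥ : n ≥ t + ((15 * (t + 2) ^ 2 * (k ∸ t)) ⊔ (10 * k ^ 2))) where

  -- `R` is k - t written as a double successor, ready for Pascal's rule; mD and τD are the leading
  -- terms of the two extremal sizes.
  N r₀ R m τ : ℕ
  N = n ∸ t
  r₀ = k ∸ t ∸ 2
  R = suc (suc r₀)
  m = suc R
  τ = t + 2

  open Hits N r₀ public
  open ≤-Reasoning

  t≤k : t ≤ k
  t≤k = ≤-trans (m≤m+n t 2) k≥

  k∸t≡ : k ∸ t ≡ R
  k∸t≡ = sym (m+[n∸m]≡n (≤-trans (≤-reflexive (sym (m+n∸m≡n t 2))) (∸-monoˡ-≤ t k≥)))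

  t+R≡k : t + R ≡ k
  t+R≡k = trans (cong (t +_) (sym k∸t≡)) (m+[n∸m]≡n t≤k)

  2≤t : 2 ≤ t
  2≤t = +-cancelʳ-≤ 2 2 t t+2≥4

  t≤n : t ≤ n
  t≤n = ≤-trans (m≤m+n t _) n≥

  N≥ : (15 * (t + 2) ^ 2 * (k ∸ t)) ⊔ (10 * k ^ 2) ≤ N
  N≥ = ≤-trans (≤-reflexive (sym (m+n∸m≡n t _))) (∸-monoˡ-≤ t n≥)

  15τ²R≤N : (15 * (τ * τ)) * R ≤ N
  15τ²R≤N = ≤-trans (≤-reflexive (trans (cong₂ (λ x y → (15 * x) * y) (e τ) (sym k∸t≡)) refl)) (≤-trans (m≤m⊔n _ (10 * k ^ 2)) N≥)
    where
    e : ∀ τ → τ * τ ≡ τ * (τ * 1)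
    e = solve-∀

  10k²≤N : 10 * (k * k) ≤ N
  10k²≤N = ≤-trans (≤-reflexive (cong (10 *_) (e k))) (≤-trans (m≤n⊔m (15 * (t + 2) ^ 2 * (k ∸ t)) _) N≥)
    where
    e : ∀ k → k * k ≡ k * (k * 1)
    e = solve-∀

  R≤k : R ≤ k
  R≤k = ≤-trans (m≤n+m R t) (≤-reflexive t+R≡k)

  m<k : m < k
  m<k = ≤-trans (+-monoˡ-≤ R 2≤t) (≤-reflexive t+R≡k)

  m≤k : m ≤ k
  m≤k = <⇒≤ m<k

  0<k : 0 < k
  0<k = ≤-trans (s≤s z≤n) m<k

  k≤N : k + k ≤ N
  k≤N = begin
    k + k          ≡⟨ e k ⟩
    2 * k * 1      ≤⟨ *-mono-≤ (*-monoˡ-≤ k (s≤s (s≤s (z≤n {8})))) 0<k ⟩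
    10 * k * k     ≡⟨ *-assoc 10 k k ⟩
    10 * (k * k)   ≤⟨ 10k²≤N ⟩
    N ∎
    where
    e : ∀ k → k + k ≡ 2 * k * 1
    e = solve-∀

  R≤N : R ≤ N
  R≤N = ≤-trans R≤k (≤-trans (m≤m+n k k) k≤N)

  m≤N : m ≤ N
  m≤N = ≤-trans m≤k (≤-trans (m≤m+n k k) k≤N)

  k+1≤n : k + 1 ≤ n
  k+1≤n = ≤-trans (+-monoʳ-≤ k 0<k) (≤-trans k≤N (m∸n≤m n t))

  10kR≤N : (10 * k) * R ≤ N
  10kR≤N = ≤-trans (*-monoʳ-≤ (10 * k) R≤k) (≤-trans (≤-reflexive (*-assoc 10 k k)) 10k²≤N)

  D₂>0 : 0 < D₂
  D₂>0 = C>0 (≤-trans (≤-reflexive (sym (m+n∸m≡n 2 r₀))) (∸-monoˡ-≤ 2 R≤N))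

  private
    decay : ∀ {β} → 0 < β → β * R ≤ N → β * D₂ ≤ D
    decay {β} β>0 βR≤N = ≤-trans (degree-step N R 0 β 1 (s≤s (s≤s z≤n)) R≤N (decay-ratio β>0 βR≤N 1 (s≤s (s≤s z≤n)))) (≤-reflexive (*-identityˡ D))

  -- D₂/D = (R - 1)/(N - 1) ≤ R/N, and the two lower bounds on `N` make this at most 1/(10k) and
  -- 1/(15τ²).
  10kD₂≤D : 10 * k * D₂ ≤ D
  10kD₂≤D = decay (*-mono-< {0} {10} (s≤s z≤n) 0<k) 10kR≤N

  15τ²D₂≤D : 15 * (τ * τ) * D₂ ≤ D
  15τ²D₂≤D = decay (*-mono-< {0} {15} (s≤s z≤n) (*-mono-< τ>0 τ>0)) 15τ²R≤N
    where
    τ>0 : 0 < τ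
    τ>0 = ≤-trans (s≤s z≤n) t+2≥4

  D>0 : 0 < D
  D>0 = ≤-trans (*-mono-< (*-mono-< {0} {10} (s≤s z≤n) 0<k) D₂>0) 10kD₂≤D

  multiple-≤-D : ∀ {c} → c ≤ 10 * k → c * D₂ ≤ D
  multiple-≤-D le = ≤-trans (*-monoˡ-≤ D₂ le) 10kD₂≤D

  t+D₂<D : t + D₂ < D
  t+D₂<D = begin-strict
    t + D₂               <⟨ +-monoˡ-< D₂ (<-≤-trans (m<m+n t (s≤s z≤n)) (≤-reflexive t+R≡k)) ⟩
    k + D₂               ≤⟨ +-monoˡ-≤ D₂ (≤-trans (≤-reflexive (sym (*-identityʳ k))) (*-monoʳ-≤ k D₂>0)) ⟩
    k * D₂ + D₂          ≡⟨ +-comm (k * D₂) D₂ ⟩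
    suc k * D₂           ≤⟨ multiple-≤-D (≤-trans (+-monoˡ-≤ k 0<k) (≤-trans (≤-reflexive (e k)) (*-monoˡ-≤ k (s≤s (s≤s (z≤n {8})))))) ⟩
    D ∎
    where
    e : ∀ k → k + k ≡ 2 * k
    e = solve-∀

  -- Sizes of the extremal families

  size-𝓗≡ : ∀ {X K L : Subset n} → ∣ X ∣ ≡ t → ∣ L ∣ ≡ k + 1 → X ⊆ K → X ⊆ L → size (𝓗 k X K L) ≡ hits m + t
  size-𝓗≡ {X} {K} {L} ∣X∣ ∣L∣ X⊆K X⊆L = +-cancelʳ-≡ ((N ∸ m) C R) _ _ (trans
    (cong₂ (λ x y → size (𝓗 k X K L) + x C y) eN (sym k∸t≡))
    (trans (size-𝓗 X K L ∣X∣ ∣L∣ X⊆K X⊆L t≤k) (trans (cong (λ z → N C z + t) k∸t≡)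
      (trans (cong (_+ t) (sym (hits-complement m≤N))) (e (hits m) ((N ∸ m) C R) t)))))
    where
    eN : N ∸ m ≡ n ∸ (k + 1)
    eN = trans (∸-+-assoc n t m) (cong (n ∸_) (trans (+-suc t R) (trans (cong suc t+R≡k) (+-comm 1 k))))
    e : ∀ a b c → a + b + c ≡ a + c + b
    e = solve-∀

  size-𝓗₀≡ : size (𝓗₀ n k t) ≡ hits m + t
  size-𝓗₀≡ = size-𝓗≡ (∣[1⋯]∣ n t t≤n) (∣[1⋯]∣ n (k + 1) k+1≤n) ([1⋯]-mono le) ([1⋯]-mono le)
    where
    le : t ≤ k + 1
    le = ≤-trans t≤k (m≤m+n k 1)

  #-hitting≡ : ∀ {X A : Subset n} → ∣ X ∣ ≡ t → ∣ A ∣ ≤ m → (∀ {x} → x ∈ X → x ∉ A) → # (hitting? X A k) ≡ hits ∣ A ∣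
  #-hitting≡ {X} {A} ∣X∣ A≤m dis = +-cancelʳ-≡ ((N ∸ ∣ A ∣) C R) _ _ (trans
    (cong₂ (λ x y → # (hitting? X A k) + x C y) (trans (∸-+-assoc n t ∣ A ∣) (cong (λ z → n ∸ (z + ∣ A ∣)) (sym ∣X∣))) (trans (sym k∸t≡) (cong (k ∸_) (sym ∣X∣))))
    (trans (#-hitting X A (≤-trans (≤-reflexive ∣X∣) t≤k) dis)
      (trans (cong₂ _C_ (cong (n ∸_) ∣X∣) (trans (cong (k ∸_) ∣X∣) k∸t≡)) (sym (hits-complement (≤-trans A≤m m≤N))))))

  size-𝓐≡ : ∀ {Z Z′ : Subset n} → ∣ Z ∣ ≡ t + 2 → ∣ Z′ ∣ ≡ t + 2 → size (𝓐 k t Z) ≡ size (𝓐 k t Z′)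
  size-𝓐≡ {Z} {Z′} ∣Z∣ ∣Z′∣ = trans (size-𝓐 Z ∣Z∣ k≥) (sym (size-𝓐 Z′ ∣Z′∣ k≥))

  τ≤n : t + 2 ≤ n
  τ≤n = ≤-trans k≥ (≤-trans (m≤m+n k 1) k+1≤n)

  size-𝓐₀+ : size (𝓐₀ n k t) + (t + 1) * D₂ ≡ τ * D
  size-𝓐₀+ = trans (cong (_+ (t + 1) * D₂) (trans (size-𝓐 [1⋯ t + 2 ] (∣[1⋯]∣ n (t + 2) τ≤n) k≥)
      (cong₂ (λ x y → (t + 2) * x + y) (cong₂ _C_ (sym (∸-+-assoc n t 2)) e₁) (cong₂ _C_ (sym (∸-+-assoc n t 2)) (sym (∸-+-assoc k t 2))))))
    (trans (e t ((N ∸ 2) C suc r₀) D₂) (cong (τ *_) (sym (D≡ 1<N))))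
    where
    e₁ : k ∸ (t + 1) ≡ suc r₀
    e₁ = trans (sym (∸-+-assoc k t 1)) (cong (_∸ 1) k∸t≡)
    1<N : 1 < N
    1<N = ≤-trans (s≤s (s≤s z≤n)) R≤N
    e : ∀ t c d → (t + 2) * c + d + (t + 1) * d ≡ (t + 2) * (d + c)
    e = solve-∀

  𝓐₀≤ : size (𝓐₀ n k t) ≤ τ * D
  𝓐₀≤ = ≤-trans (m≤m+n _ ((t + 1) * D₂)) (≤-reflexive size-𝓐₀+)

  h a : ℕ
  h = size (𝓗₀ n k t)
  a = size (𝓐₀ n k t)

  2mD≤2h : 2 * (m * D) ≤ 2 * h + m * R * D₂
  2mD≤2h = ≤-trans (2mD≤2hits R) (+-monoˡ-≤ (m * R * D₂) (*-monoʳ-≤ 2 (≤-trans (m≤m+n (hits m) t) (≤-reflexive (sym size-𝓗₀≡)))))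

  RD₂≤D : R * D₂ ≤ D
  RD₂≤D = multiple-≤-D (≤-trans R≤k (m≤m+n k (9 * k)))

  𝓗₀<𝓐₀ : m ≤ τ → h < a
  𝓗₀<𝓐₀ m≤τ = subst (_< a) (sym size-𝓗₀≡)
    (hits<𝓐 2≤t (≤-trans (≤-reflexive (+-comm r₀ 3)) m≤τ) r+4≤N t+D₂<D size-𝓐₀+)
    where
    r+4≤N : r₀ + 4 ≤ N
    r+4≤N = ≤-trans (≤-reflexive (+-comm r₀ 4)) (≤-trans m<k (≤-trans (m≤m+n k k) k≤N))

  -- 2 a ≤ 2 τ D falls short of 2 h ≥ 2 m D − m R D₂.
  𝓐₀<𝓗₀ : τ < m → a < h
  𝓐₀<𝓗₀ τ<m = *-cancelˡ-< 2 a h (+-cancelʳ-< (m * R * D₂) _ _ (begin-strict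
    2 * a + m * R * D₂           ≤⟨ +-monoˡ-≤ (m * R * D₂) (*-monoʳ-≤ 2 𝓐₀≤) ⟩
    2 * (τ * D) + m * R * D₂     <⟨ gap ⟩
    2 * (m * D)                  ≤⟨ 2mD≤2h ⟩
    2 * h + m * R * D₂ ∎))
    where
    gap : 2 * (τ * D) + m * R * D₂ < 2 * (m * D)
    -- For m ≤ 2τ the error mRD₂ is at most 4τ²D₂ ≤ D, less than the 2D that τ < m provides. For
    -- larger m it is at most mD, and 2τ < m makes room for it.
    gap with m ≤? 2 * τ
    ... | yes m≤2τ = begin-strict
      2 * (τ * D) + m * R * D₂              ≤⟨ +-monoʳ-≤ (2 * (τ * D)) (*-monoˡ-≤ D₂ (*-mono-≤ m≤2τ (≤-trans (n≤1+n R) m≤2τ))) ⟩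
      2 * (τ * D) + 2 * τ * (2 * τ) * D₂    ≤⟨ +-monoʳ-≤ (2 * (τ * D)) (≤-trans (*-monoˡ-≤ D₂ (≤-trans (m≤m+n (2 * τ * (2 * τ)) (11 * (τ * τ))) (≤-reflexive (e₁ τ)))) 15τ²D₂≤D) ⟩
      2 * (τ * D) + D                       <⟨ m<m+n _ D>0 ⟩
      2 * (τ * D) + D + D                   ≡⟨ e₂ τ D ⟩
      2 * (suc τ * D)                       ≤⟨ *-monoʳ-≤ 2 (*-monoˡ-≤ D τ<m) ⟩
      2 * (m * D) ∎
      where
      e₁ : ∀ τ → 2 * τ * (2 * τ) + 11 * (τ * τ) ≡ 15 * (τ * τ)
      e₁ = solve-∀
      e₂ : ∀ τ D → 2 * (τ * D) + D + D ≡ 2 * (suc τ * D)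
      e₂ = solve-∀
    ... | no m≰2τ = begin-strict
      2 * (τ * D) + m * R * D₂              ≡⟨ cong₂ _+_ (sym (*-assoc 2 τ D)) (*-assoc m R D₂) ⟩
      2 * τ * D + m * (R * D₂)              ≤⟨ +-monoʳ-≤ (2 * τ * D) (*-monoʳ-≤ m RD₂≤D) ⟩
      2 * τ * D + m * D                     <⟨ +-monoˡ-< (m * D) (*-monoˡ-< D {{>-nonZero D>0}} (≰⇒> m≰2τ)) ⟩
      m * D + m * D                         ≡⟨ e (m * D) ⟩
      2 * (m * D) ∎
      where
      e : ∀ x → x + x ≡ 2 * x
      e = solve-∀

  t<k : t < k
  t<k = ≤-trans (≤-trans (n≤1+n (suc t)) (≤-reflexive (+-comm 2 t))) k≥

  module FewCase {𝒮 𝒯 : Pred (Subset n) 0ℓ} (dual : Dual n k t 𝒮 𝒯)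
    (𝓕 𝓖 : Family n) (u𝓕 : Uniform k 𝓕) (u𝓖 : Uniform k 𝓖)
    (gen𝓕 : Generates 𝒮 𝓕) (gen𝓖 : Generates 𝒯 𝓖) where

    private
      #𝒮₁#𝒯₁ : ℕ
      #𝒮₁#𝒯₁ = Levels.#level dual 1 * Levels.#level (swapDual dual) 1

      large-bound : 3 * (t + 1) ≤ m → #𝒮₁#𝒯₁ ≤ (t + 1) * m →
        (size 𝓕 * size 𝓖 + (m * D) * (m * D)) * 169 ≤ ((t + 1) * m) * (D * D) * 169 + (m * D) * (m * D) * 256
      -- The product bound speaks of k ∸ t; the motive rewrites it to `R` everywhere at once.
      large-bound 3t≤m #≤ = subst
        (λ r → 3 * (t + 1) ≤ suc r → 10 * (suc r * r) ≤ N → 120 * (t * r) ≤ N → r ≤ N → 0 < N →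
            (size 𝓕 * size 𝓖 + (suc r * degree N r 0) * (suc r * degree N r 0)) * 169 ≤
            ((t + 1) * m) * (degree N r 0 * degree N r 0) * 169 + (suc r * degree N r 0) * (suc r * degree N r 0) * 256)
          k∸t≡ (Product.large-product dual t<k 𝓕 𝓖 u𝓕 u𝓖 gen𝓕 gen𝓖 #≤)
          3t≤m (≤-trans (*-monoʳ-≤ 10 (*-mono-≤ m≤k R≤k)) 10k²≤N) 120tR≤N R≤N (≤-trans (s≤s z≤n) R≤N)
        where
        120tR≤N : 120 * (t * R) ≤ N
        120tR≤N = ≤-trans (≤-reflexive (e t R)) (≤-trans (*-monoˡ-≤ R (*-monoʳ-≤ 15 (8t≤[t+2]² 2≤t))) 15τ²R≤N)
          where
          e : ∀ t R → 120 * (t * R) ≡ 15 * (8 * t) * R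
          e = solve-∀

      small-bound : ∀ {M c Q} → let β = 15 * (τ * τ) in #𝒮₁#𝒯₁ ≤ Q → t + 2 ≤ M → m ≤ M → 6 * M + c ≡ β →
        (size 𝓕 * size 𝓖 + (M * D) * (M * D)) * (c * c) ≤ Q * (D * D) * (c * c) + (M * D) * (M * D) * (β * β)
      small-bound {M} {c} {Q} #≤Q t+2≤M m≤M eq =
        subst (λ r → suc r ≤ M → r ≤ N → 15 * (τ * τ) * r ≤ N →
            (size 𝓕 * size 𝓖 + (M * degree N r 0) * (M * degree N r 0)) * (c * c) ≤
            Q * (degree N r 0 * degree N r 0) * (c * c) + (M * degree N r 0) * (M * degree N r 0) * (15 * (τ * τ) * (15 * (τ * τ))))
          k∸t≡ (λ m≤M R≤N βR≤N → Product.small-product dual t<k 𝓕 𝓖 u𝓕 u𝓖 gen𝓕 gen𝓖 #≤Q {M} {c} {15 * (τ * τ)} t+2≤M m≤M R≤N eq βR≤N) m≤M R≤N 15τ²R≤N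

    -- The bound of ratio 3/16 requires 3(t + 1) ≤ m; below that threshold 6m/(15τ²) is small
    -- enough.
    few⇒<h² : τ < m → #𝒮₁#𝒯₁ ≤ (t + 1) * m → size 𝓕 * size 𝓖 < h * h
    few⇒<h² τ<m #≤ with 3 * (t + 1) ≤? m
    ... | yes 3t≤m = few-below-𝓗-large {size 𝓕 * size 𝓖} {h} {t} {R} {D} {D₂} 3t≤m D>0 (multiple-≤-D (*-monoʳ-≤ 10 R≤k)) 2mD≤2h (large-bound 3t≤m #≤)
    ... | no 3t≰m = few-below-𝓗-small {size 𝓕 * size 𝓖} {h} {t} {R} {D} {D₂} 2≤t (≤-trans (≤-reflexive (+-suc t 2)) τ<m) (≰⇒> 3t≰m) D>0 15τ²D₂≤D 2mD≤2h
        λ {c} → small-bound {m} {c} #≤ (<⇒≤ τ<m) ≤-refl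

    few⇒<a² : m ≤ τ → #𝒮₁#𝒯₁ ≤ (t + 1) * τ → size 𝓕 * size 𝓖 < a * a
    few⇒<a² m≤τ #≤ = few-below-𝓐 {size 𝓕 * size 𝓖} {a} {t} {D} {D₂} 2≤t D>0 15τ²D₂≤D size-𝓐₀+ λ {c} → small-bound {τ} {c} #≤ ≤-refl m≤τ

-- Reaching the extremal pairs

module Extremal (n k t : ℕ) (k≥ : k ≥ t + 2) (t+2≥4 : t + 2 ≥ 4) (n≥ : n ≥ t + ((15 * (t + 2) ^ 2 * (k ∸ t)) ⊔ (10 * k ^ 2)))
  (𝓕 𝓖 : Family n) (u𝓕 : Uniform k 𝓕) (u𝓖 : Uniform k 𝓖) (cross : CrossIntersecting t 𝓕 𝓖)
  (nontriv𝓕 : ∣ ⋂ᶠ 𝓕 ∣ < t) (nontriv𝓖 : ∣ ⋂ᶠ 𝓖 ∣ < t) where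
  open Range n k t k≥ t+2≥4 n≥
  open FromFamilies t≤n 𝓕 𝓖 u𝓕 u𝓖 cross nontriv𝓕 nontriv𝓖
  open FewCase dual 𝓕 𝓖 u𝓕 u𝓖 gen𝓕 gen𝓖
  open ≤-Reasoning

  m≡ : suc (k ∸ t) ≡ m
  m≡ = cong suc k∸t≡

  private
    -- By `room`, one more extension raises `hits` by at least this much. That covers the mD₂ sets
    -- which a missing extension admits, the tD₂ sets not through X, and a reserve of (t + 1)D₂,
    -- whence 2t + 1.
    E₀ : ℕ
    E₀ = m * D₂ + (2 * t + 1) * D₂

    room : m * D₂ + E₀ ≤ D
    room = ≤-trans (≤-reflexive (e₁ m t D₂)) (multiple-≤-D (begin
      2 * m + (2 * t + 1)   ≤⟨ +-mono-≤ (*-monoʳ-≤ 2 m≤k) (+-mono-≤ (*-monoʳ-≤ 2 t≤k) 0<k) ⟩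
      2 * k + (2 * k + k)   ≤⟨ m≤m+n _ (5 * k) ⟩
      2 * k + (2 * k + k) + 5 * k ≡⟨ e₂ k ⟩
      10 * k ∎))
      where
      e₁ : ∀ m t d → m * d + (m * d + (2 * t + 1) * d) ≡ (2 * m + (2 * t + 1)) * d
      e₁ = solve-∀
      e₂ : ∀ k → 2 * k + (2 * k + k) + 5 * k ≡ 10 * k
      e₂ = solve-∀

    deficient : ∀ {f s} → s < m → f ≤ hits s + ((m ∸ s) * (m * D₂) + t * D₂) → f + (t + 1) * D₂ ≤ hits m
    deficient {f} {s} s<m f≤ with m≤n⇒∃[o]m+o≡n s<m
    ... | j , eq = begin
      f + (t + 1) * D₂                                              ≤⟨ +-monoˡ-≤ ((t + 1) * D₂) f≤ ⟩
      hits s + ((m ∸ s) * (m * D₂) + t * D₂) + (t + 1) * D₂         ≡⟨ cong (λ z → hits s + (z * (m * D₂) + t * D₂) + (t + 1) * D₂) m∸s≡ ⟩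
      hits s + (suc j * (m * D₂) + t * D₂) + (t + 1) * D₂           ≡⟨ e (hits s) j (m * D₂) t D₂ ⟩
      hits s + (suc j * (m * D₂) + (2 * t + 1) * D₂)                ≤⟨ +-monoʳ-≤ (hits s) (+-monoʳ-≤ (suc j * (m * D₂)) (m≤m+n _ (j * ((2 * t + 1) * D₂)))) ⟩
      hits s + (suc j * (m * D₂) + suc j * ((2 * t + 1) * D₂))      ≡⟨ cong (hits s +_) (sym (*-distribˡ-+ (suc j) (m * D₂) _)) ⟩
      hits s + suc j * E₀                                           ≤⟨ hits-growth {E₀} {m} s (suc j) room (≤-reflexive s+j≡) ⟩
      hits (s + suc j)                                              ≡⟨ cong hits s+j≡ ⟩
      hits m ∎
      where
      s+j≡ : s + suc j ≡ m
      s+j≡ = trans (+-suc s j) eq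
      m∸s≡ : m ∸ s ≡ suc j
      m∸s≡ = trans (cong (_∸ s) (sym s+j≡)) (m+n∸m≡n s (suc j))
      e : ∀ h j x t d → h + (suc j * x + t * d) + (t + 1) * d ≡ h + (suc j * x + (2 * t + 1) * d)
      e = solve-∀

    not-exceeding : ∀ {f s} → s ≤ m → f ≤ hits s + ((m ∸ s) * (m * D₂) + t * D₂) → f ≤ hits m + t * D₂
    not-exceeding {f} {s} s≤m f≤ = begin
      f                                                ≤⟨ f≤ ⟩
      hits s + ((m ∸ s) * (m * D₂) + t * D₂)           ≡⟨ sym (+-assoc (hits s) _ (t * D₂)) ⟩
      hits s + (m ∸ s) * (m * D₂) + t * D₂             ≤⟨ +-monoˡ-≤ (t * D₂) (hits-growth {m * D₂} {m} s (m ∸ s)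
                                                            (≤-trans (+-monoʳ-≤ (m * D₂) (m≤m+n (m * D₂) _)) room) (≤-reflexive (m+[n∸m]≡n s≤m))) ⟩
      hits (s + (m ∸ s)) + t * D₂                      ≡⟨ cong (λ z → hits z + t * D₂) (m+[n∸m]≡n s≤m) ⟩
      hits m + t * D₂ ∎

    hits²≤h² : hits m * hits m ≤ h * h
    hits²≤h² = *-mono-≤ le le
      where
      le : hits m ≤ h
      le = ≤-trans (m≤m+n (hits m) t) (≤-reflexive (sym size-𝓗₀≡))

    -- One family falls short of `hits m` by at least (t + 1)D₂, and the other exceeds it by at most
    -- tD₂.
    below : ∀ {f g s u} → s < m → u ≤ m → f ≤ hits s + ((m ∸ s) * (m * D₂) + t * D₂) → g ≤ hits u + ((m ∸ u) * (m * D₂) + t * D₂) → f * g < h * h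
    below {f} {g} s<m u≤m f≤ g≤ = <-≤-trans (product-below-square {f} {g} {hits m} {(t + 1) * D₂} {t * D₂}
      (*-monoˡ-< D₂ {{>-nonZero D₂>0}} (m<m+n t (s≤s z≤n))) (deficient {f} s<m f≤) (not-exceeding {g} u≤m g≤)) hits²≤h²

    star-size : ∀ {𝒮 𝒯 : Pred (Subset n) 0ℓ} (dual : Dual n k t 𝒮 𝒯) {X} → ∣ X ∣ ≡ t →
      3 ≤ ∣ Extensions.extensions dual X ∣ → 3 ≤ ∣ Extensions.extensions (swapDual dual) X ∣ →
      (𝓕 : Family n) → Uniform k 𝓕 → Generates 𝒮 𝓕 →
      let s = ∣ Extensions.extensions dual X ∣ in
      s ≤ m × size 𝓕 ≤ hits s + ((m ∸ s) * (m * D₂) + t * D₂)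
    star-size dual {X} ∣X∣ A≥3 B≥3 𝓕 u gen = A≤m , ≤-trans (S.size≤ 𝓕 u gen (≤-trans (s≤s z≤n) A≥3) B≥3)
      (≤-reflexive (cong₂ _+_ (#-hitting≡ ∣X∣ A≤m S.disjoint) (cong₂ (λ m d → (m ∸ ∣ Extensions.extensions dual X ∣) * (m * d) + t * d) m≡ D₂≡)))
      where
      module S = Star dual k≥ {X} ∣X∣
      A≤m : ∣ Extensions.extensions dual X ∣ ≤ m
      A≤m = ≤-trans S.∣A∣≤m (≤-reflexive m≡)
      D₂≡ : (n ∸ (t + 2)) C (k ∸ (t + 2)) ≡ D₂
      D₂≡ = cong₂ _C_ (sym (∸-+-assoc n t 2)) (sym (∸-+-assoc k t 2))

  -- The structural argument yields containments only; |K ∩ L| ≥ t + 2 becomes available once they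
  -- are equalities.
  𝓗-Form 𝓐-Form : Set
  𝓗-Form = ∃[ X ] ∃[ K ] ∃[ L ] (∣ X ∣ ≡ t × ∣ K ∣ ≡ k + 1 × ∣ L ∣ ≡ k + 1 × X ⊆ K × X ⊆ L ×
    (∀ F → F ∈ᶠ 𝓕 → F ∈ᶠ 𝓗 k X K L) × (∀ G → G ∈ᶠ 𝓖 → G ∈ᶠ 𝓗 k X L K))
  𝓐-Form = ∃[ Z ] (∣ Z ∣ ≡ t + 2 × (∀ F → F ∈ᶠ 𝓕 → F ∈ᶠ 𝓐 k t Z) × (∀ G → G ∈ᶠ 𝓖 → G ∈ᶠ 𝓐 k t Z))

  𝓗-Extremal 𝓐-Extremal : Set
  𝓗-Extremal = ∃[ X ] ∃[ K ] ∃[ L ] (∣ X ∣ ≡ t × ∣ K ∣ ≡ k + 1 × ∣ L ∣ ≡ k + 1 × X ⊆ K ∩ L × ∣ K ∩ L ∣ ≥ t + 2 ×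
       𝓕 ≈ᶠ 𝓗 k X K L × 𝓖 ≈ᶠ 𝓗 k X L K)
  𝓐-Extremal = ∃[ Z ] (∣ Z ∣ ≡ t + 2 × 𝓕 ≈ᶠ 𝓐 k t Z × 𝓖 ≈ᶠ 𝓐 k t Z)

  private
    star-case : ∀ X → ∣ X ∣ ≡ t → Three (λ A → FirstLevel.𝒮₁ dual A × X ⊆ A) → Three (λ B → FirstLevel.𝒯₁ dual B × X ⊆ B) →
      size 𝓕 * size 𝓖 < h * h ⊎ 𝓗-Form
    star-case X ∣X∣ as bs = decide (∣ A ∣ ≟ m) (∣ B ∣ ≟ m)
      where
      A B : Subset n
      A = Extensions.extensions dual X
      B = Extensions.extensions (swapDual dual) X
      A≥3 : 3 ≤ ∣ A ∣
      A≥3 = Extensions.three≤∣extensions∣ dual X ∣X∣ as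
      B≥3 : 3 ≤ ∣ B ∣
      B≥3 = Extensions.three≤∣extensions∣ (swapDual dual) X ∣X∣ bs
      f = star-size dual ∣X∣ A≥3 B≥3 𝓕 u𝓕 gen𝓕
      g = star-size (swapDual dual) ∣X∣ B≥3 A≥3 𝓖 u𝓖 gen𝓖
      t+m≡ : t + m ≡ k + 1
      t+m≡ = trans (+-suc t R) (trans (cong suc t+R≡k) (+-comm 1 k))
      decide : Dec (∣ A ∣ ≡ m) → Dec (∣ B ∣ ≡ m) → size 𝓕 * size 𝓖 < h * h ⊎ 𝓗-Form
      decide (no A≢m) _ = inj₁ (below (≤∧≢⇒< (proj₁ f) A≢m) (proj₁ g) (proj₂ f) (proj₂ g))
      decide (yes _) (no B≢m) = inj₁ (subst (_< h * h) (*-comm (size 𝓖) (size 𝓕)) (below (≤∧≢⇒< (proj₁ g) B≢m) (proj₁ f) (proj₂ g) (proj₂ f)))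
      decide (yes A≡m) (yes B≡m) = inj₂ (X , X ∪ B , X ∪ A , ∣X∣ ,
        trans (disjoint⇒∣∪∣≡ X B (Star.disjoint (swapDual dual) k≥ ∣X∣)) (trans (cong₂ _+_ ∣X∣ B≡m) t+m≡) ,
        trans (disjoint⇒∣∪∣≡ X A (Star.disjoint dual k≥ ∣X∣)) (trans (cong₂ _+_ ∣X∣ A≡m) t+m≡) ,
        (λ {x} → p⊆p∪q {p = X} B {x}) , (λ {x} → p⊆p∪q {p = X} A {x}) ,
        Star.full⇒𝓗 dual k≥ ∣X∣ 𝓕 u𝓕 gen𝓕 (trans A≡m (sym m≡)) (trans B≡m (sym m≡)) ,
        Star.full⇒𝓗 (swapDual dual) k≥ ∣X∣ 𝓖 u𝓖 gen𝓖 (trans B≡m (sym m≡)) (trans A≡m (sym m≡)))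

    triangle-case : ∀ Z → ∣ Z ∣ ≡ suc (suc t) → Three (λ A → FirstLevel.𝒮₁ dual A × A ⊆ Z) → Three (λ B → FirstLevel.𝒯₁ dual B × B ⊆ Z) → 𝓐-Form
    triangle-case Z ∣Z∣ as bs = Z , trans ∣Z∣ (+-comm 2 t) ,
      triangle⇒𝓐 dual {Z} ∣Z∣ bs 𝓕 u𝓕 gen𝓕 , triangle⇒𝓐 (swapDual dual) {Z} ∣Z∣ as 𝓖 u𝓖 gen𝓖

  size-𝓐≡a : ∀ Z → ∣ Z ∣ ≡ t + 2 → size (𝓐 k t Z) ≡ a
  size-𝓐≡a Z ∣Z∣ = size-𝓐≡ {Z} ∣Z∣ (∣[1⋯]∣ n (t + 2) τ≤n)

  𝓐-sizes : 𝓐-Form → size 𝓕 ≤ a × size 𝓖 ≤ a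
  𝓐-sizes (Z , ∣Z∣ , 𝓕⊆ , 𝓖⊆) =
    ≤-trans (#-mono (mem? 𝓕) (mem? (𝓐 k t Z)) 𝓕⊆) (≤-reflexive sz) , ≤-trans (#-mono (mem? 𝓖) (mem? (𝓐 k t Z)) 𝓖⊆) (≤-reflexive sz)
    where
    sz : size (𝓐 k t Z) ≡ a
    sz = size-𝓐≡a Z ∣Z∣

  𝓗-sizes : 𝓗-Form → size 𝓕 ≤ h × size 𝓖 ≤ h
  𝓗-sizes (X , K , L , ∣X∣ , ∣K∣ , ∣L∣ , X⊆K , X⊆L , 𝓕⊆ , 𝓖⊆) =
    ≤-trans (#-mono (mem? 𝓕) (mem? (𝓗 k X K L)) 𝓕⊆) (≤-reflexive (trans (size-𝓗≡ ∣X∣ ∣L∣ X⊆K X⊆L) (sym size-𝓗₀≡))) ,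
    ≤-trans (#-mono (mem? 𝓖) (mem? (𝓗 k X L K)) 𝓖⊆) (≤-reflexive (trans (size-𝓗≡ ∣X∣ ∣K∣ X⊆L X⊆K) (sym size-𝓗₀≡)))

  -- A triangle confines both families to 𝓐(Z), and a < h in this range. In the other range the
  -- roles of star and triangle are exchanged.
  outcome-𝓗 : τ < m → size 𝓕 * size 𝓖 < h * h ⊎ 𝓗-Form
  outcome-𝓗 τ<m with classify dual 2≤t k≥ {m} (≤-reflexive m≡) (<⇒≤ τ<m)
  ... | few #≤ = inj₁ (few⇒<h² τ<m #≤)
  ... | star X ∣X∣ as bs = star-case X ∣X∣ as bs
  ... | triangle Z ∣Z∣ as bs = let (f≤ , g≤) = 𝓐-sizes (triangle-case Z ∣Z∣ as bs) in
          inj₁ (≤-<-trans (*-mono-≤ f≤ g≤) (*-mono-< (𝓐₀<𝓗₀ τ<m) (𝓐₀<𝓗₀ τ<m)))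

  outcome-𝓐 : m ≤ τ → size 𝓕 * size 𝓖 < a * a ⊎ 𝓐-Form
  outcome-𝓐 m≤τ with classify dual 2≤t k≥ {τ} (≤-trans (≤-reflexive m≡) m≤τ) ≤-refl
  ... | few #≤ = inj₁ (few⇒<a² m≤τ #≤)
  ... | star X ∣X∣ as bs = inj₁ (≤-<-trans
          ([ <⇒≤ , (λ form → let (f≤ , g≤) = 𝓗-sizes form in *-mono-≤ f≤ g≤) ]′ (star-case X ∣X∣ as bs))
          (*-mono-< (𝓗₀<𝓐₀ m≤τ) (𝓗₀<𝓐₀ m≤τ)))
  ... | triangle Z ∣Z∣ as bs = inj₂ (triangle-case Z ∣Z∣ as bs)

  -- As t ≥ 2, there are distinct x and y in `X`. The members `K - x` of 𝓕 and `L - y` of 𝓖 meet in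
  -- |K ∩ L| - 2 points.
  ∣K∩L∣≥t+2 : ∀ {X K L} → ∣ X ∣ ≡ t → X ⊆ K → X ⊆ L → 𝓕 ≈ᶠ 𝓗 k X K L → 𝓖 ≈ᶠ 𝓗 k X L K → ∣ K ∩ L ∣ ≥ t + 2
  ∣K∩L∣≥t+2 {X} {K} {L} ∣X∣ X⊆K X⊆L (_ , 𝓗⊆𝓕) (_ , 𝓗⊆𝓖) =
    let (x , y , x∈X , y∈X , y≢x) = two-members X (subst (2 ≤_) (sym ∣X∣) 2≤t) in
    ∣K∩L∣-≥ K L (X⊆K x∈X) (X⊆L x∈X) (X⊆K y∈X) (X⊆L y∈X) y≢x
      (cross (K - x) (L - y) (𝓗⊆𝓕 (inj₂ (x , x∈X , refl))) (𝓗⊆𝓖 (inj₂ (y , y∈X , refl))))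

  saturate : ∀ {𝓕 𝓔 : Family n} {e} → (∀ F → F ∈ᶠ 𝓕 → F ∈ᶠ 𝓔) → size 𝓕 ≡ e → size 𝓔 ≡ e → 𝓕 ≈ᶠ 𝓔
  saturate {𝓕} {𝓔} 𝓕⊆ f≡ e≡ = (λ {F} → 𝓕⊆ F) , λ {F} → #-saturated (mem? 𝓕) (mem? 𝓔) 𝓕⊆ (≤-reflexive (trans e≡ (sym f≡))) F

  part-i : k ≥ 2 * t + 2 → (size 𝓕 * size 𝓖 ≤ h ^ 2) × ((size 𝓕 * size 𝓖 ≡ h ^ 2) ⇔ 𝓗-Extremal)
  part-i k≥2t+2 = proj₁ main , mk⇔ to from
    where
    -- Since m = k - t + 1, the hypothesis k ≥ 2t + 2 is exactly m > t + 2.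
    τ<m : τ < m
    τ<m = s≤s (+-cancelˡ-≤ t τ R (≤-trans (≤-reflexive (e t)) (≤-trans k≥2t+2 (≤-reflexive (sym t+R≡k)))))
      where
      e : ∀ t → t + (t + 2) ≡ 2 * t + 2
      e = solve-∀
    main = bound-and-equality {size 𝓕} {size 𝓖} {h} (outcome-𝓗 τ<m) 𝓗-sizes
    to : size 𝓕 * size 𝓖 ≡ h ^ 2 → 𝓗-Extremal
    to eq with proj₂ main eq
    ... | (X , K , L , ∣X∣ , ∣K∣ , ∣L∣ , X⊆K , X⊆L , 𝓕⊆ , 𝓖⊆) , f≡ , g≡ =
      X , K , L , ∣X∣ , ∣K∣ , ∣L∣ , (λ x∈ → x∈p∩q⁺ (X⊆K x∈ , X⊆L x∈)) , ∣K∩L∣≥t+2 ∣X∣ X⊆K X⊆L 𝓕≈ 𝓖≈ , 𝓕≈ , 𝓖≈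
      where
      𝓕≈ : 𝓕 ≈ᶠ 𝓗 k X K L
      𝓕≈ = saturate {𝓕} {𝓗 k X K L} 𝓕⊆ f≡ (trans (size-𝓗≡ ∣X∣ ∣L∣ X⊆K X⊆L) (sym size-𝓗₀≡))
      𝓖≈ : 𝓖 ≈ᶠ 𝓗 k X L K
      𝓖≈ = saturate {𝓖} {𝓗 k X L K} 𝓖⊆ g≡ (trans (size-𝓗≡ ∣X∣ ∣K∣ X⊆L X⊆K) (sym size-𝓗₀≡))
    from : 𝓗-Extremal → size 𝓕 * size 𝓖 ≡ h ^ 2
    from (X , K , L , ∣X∣ , ∣K∣ , ∣L∣ , X⊆K∩L , _ , (𝓕⊆ , 𝓗⊆𝓕) , (𝓖⊆ , 𝓗⊆𝓖)) = trans
      (cong₂ _*_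
        (trans (#-cong (mem? 𝓕) (mem? (𝓗 k X K L)) (λ F → 𝓕⊆) (λ F → 𝓗⊆𝓕)) (trans (size-𝓗≡ ∣X∣ ∣L∣ X⊆K X⊆L) (sym size-𝓗₀≡)))
        (trans (#-cong (mem? 𝓖) (mem? (𝓗 k X L K)) (λ G → 𝓖⊆) (λ G → 𝓗⊆𝓖)) (trans (size-𝓗≡ ∣X∣ ∣K∣ X⊆L X⊆K) (sym size-𝓗₀≡))))
      (cong (h *_) (sym (*-identityʳ h)))
      where
      X⊆K : X ⊆ K
      X⊆K x∈ = p∩q⊆p K L (X⊆K∩L x∈)
      X⊆L : X ⊆ L
      X⊆L x∈ = p∩q⊆q K L (X⊆K∩L x∈)

  part-ii : k ≤ 2 * t + 1 → (size 𝓕 * size 𝓖 ≤ a ^ 2) × ((size 𝓕 * size 𝓖 ≡ a ^ 2) ⇔ 𝓐-Extremal)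
  part-ii k≤2t+1 = proj₁ main , mk⇔ to from
    where
    m≤τ : m ≤ τ
    m≤τ = +-cancelˡ-≤ t m τ (≤-trans (≤-reflexive (trans (+-suc t R) (cong suc t+R≡k))) (≤-trans (s≤s k≤2t+1) (≤-reflexive (e t))))
      where
      e : ∀ t → suc (2 * t + 1) ≡ t + (t + 2)
      e = solve-∀
    main = bound-and-equality {size 𝓕} {size 𝓖} {a} (outcome-𝓐 m≤τ) 𝓐-sizes
    to : size 𝓕 * size 𝓖 ≡ a ^ 2 → 𝓐-Extremal
    to eq with proj₂ main eq
    ... | (Z , ∣Z∣ , 𝓕⊆ , 𝓖⊆) , f≡ , g≡ =
      Z , ∣Z∣ , saturate {𝓕} {𝓐 k t Z} 𝓕⊆ f≡ (size-𝓐≡a Z ∣Z∣) , saturate {𝓖} {𝓐 k t Z} 𝓖⊆ g≡ (size-𝓐≡a Z ∣Z∣)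
    from : 𝓐-Extremal → size 𝓕 * size 𝓖 ≡ a ^ 2
    from (Z , ∣Z∣ , (𝓕⊆ , 𝓐⊆𝓕) , (𝓖⊆ , 𝓐⊆𝓖)) = trans
      (cong₂ _*_
        (trans (#-cong (mem? 𝓕) (mem? (𝓐 k t Z)) (λ F → 𝓕⊆) (λ F → 𝓐⊆𝓕)) (size-𝓐≡a Z ∣Z∣))
        (trans (#-cong (mem? 𝓖) (mem? (𝓐 k t Z)) (λ G → 𝓖⊆) (λ G → 𝓐⊆𝓖)) (size-𝓐≡a Z ∣Z∣)))
      (cong (a *_) (sym (*-identityʳ a)))

theorem1p7 : (n k t : ℕ) → k ≥ t + 2 → t + 2 ≥ 4 →
    n ≥ t + ((15 * (t + 2) ^ 2 * (k ∸ t)) ⊔ (10 * k ^ 2)) →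
    (𝓕 𝓖 : Family n) → Uniform k 𝓕 → Uniform k 𝓖 →
    CrossIntersecting t 𝓕 𝓖 →
    ∣ ⋂ᶠ 𝓕 ∣ < t → ∣ ⋂ᶠ 𝓖 ∣ < t →
    (k ≥ 2 * t + 2 →
    (size 𝓕 * size 𝓖 ≤ size (𝓗₀ n k t) ^ 2) ×
    ((size 𝓕 * size 𝓖 ≡ size (𝓗₀ n k t) ^ 2) ⇔
    (∃[ X ] ∃[ K ] ∃[ L ]
    (∣ X ∣ ≡ t × ∣ K ∣ ≡ k + 1 × ∣ L ∣ ≡ k + 1 ×
    X ⊆ K ∩ L × ∣ K ∩ L ∣ ≥ t + 2 ×
    𝓕 ≈ᶠ 𝓗 k X K L × 𝓖 ≈ᶠ 𝓗 k X L K))))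
    ×
    (k ≤ 2 * t + 1 →
    (size 𝓕 * size 𝓖 ≤ size (𝓐₀ n k t) ^ 2) ×
    ((size 𝓕 * size 𝓖 ≡ size (𝓐₀ n k t) ^ 2) ⇔
    (∃[ Z ] (∣ Z ∣ ≡ t + 2 × 𝓕 ≈ᶠ 𝓐 k t Z × 𝓖 ≈ᶠ 𝓐 k t Z))))
theorem1p7 n k t k≥ t+2≥4 n≥ 𝓕 𝓖 u𝓕 u𝓖 cross nontriv𝓕 nontriv𝓖 = part-i , part-ii
  where open Extremal n k t k≥ t+2≥4 n≥ 𝓕 𝓖 u𝓕 u𝓖 cross nontriv𝓕 nontriv𝓖
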